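{- For any integer $\ell \ge 7$, \[ \mathrm{ex}(n, C^{\Join- }_{2\ell}) \le \mathrm{ex}(n, C^{\Join}_{2\ell}) = O(n^{3/2}). \]
   Context: $\mathrm{ex}(n,H)$ is the maximum number of edges in an $n$-vertex graph containing no subgraph isomorphic to $H$; $O$ refers to $n\to\infty$ with constant depending on $\ell$. The Cartesian product $G\,\square\,H$ has vertex set $V(G)\times V(H)$, with $(u,v)$ adjacent to $(u',v')$ iff either $u=u'$ and $vv'\in E(H)$, or $v=v'$ and $uu'\in E(G)$; an edge with $u=u'$ is of type $H$, and one with $v=v'$ is of type $G$. The prism graph is $C^{\square}_{2\ell} := C_{2\ell}\,\square\,K_2$ (two disjoint $2\ell$-cycles, whose edges are of type $C_{2\ell}$, joined by a perfect matching of edges of type $K_2$). $C^{\Join}_{2\ell}$ is the graph obtained by gluing two vertex-disjoint copies of $C^{\square}_{2\ell}$ along one edge of type $K_2$ (identifying that edge and its two endpoints). $C^{\Join- }_{2\ell}$ is obtained from $C^{\Join}_{2\ell}$ by deleting the merged edge $e_1$ and one further edge $e_2$ that shares exactly one vertex with $e_1$. -}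

module Defs where

open import Data.Nat using (ℕ; zero; suc; _+_; _*_; _∸_; _<ᵇ_)
open import Data.Fin using (Fin; toℕ; zero; suc)
open import Data.Bool using (Bool; true; false; _∧_; if_then_else_)
open import Data.List using (List; map; allFin)
open import Data.Nat.ListAction using (sum)
open import Data.Product using (Σ; _×_; _,_; ∃-syntax)
open import Data.Sum using (_⊎_)
open import Relation.Binary.PropositionalEquality using (_≡_; _≢_)
open import Relation.Nullary using (¬_)
open import Function.Definitions using (Injective)

record Graph (n : ℕ) : Set where
  field
    adj    : Fin n → Fin n → Bool
    sym    : ∀ i j → adj i j ≡ adj j i
    irrefl : ∀ i → adj i i ≡ false
open Graph public

edges : ∀ {n} → Graph n → ℕ
edges {n} G =
  sum (map (λ i → sum (map (λ j → if (toℕ i <ᵇ toℕ j) ∧ adj G i j then 1 else 0)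
                           (allFin n)))
           (allFin n))

-- Forbidden (pattern) graphs: a vertex type and an edge relation.
-- Orientation of E is irrelevant since host graphs are symmetric.

record Pattern : Set₁ where
  field
    V : Set
    E : V → V → Set
open Pattern public

Contains : ∀ {n} → Graph n → Pattern → Set
Contains {n} G H =
  Σ (V H → Fin n) λ f → Injective _≡_ _≡_ f × (∀ u v → E H u v → adj G (f u) (f v) ≡ true)

Free : ∀ {n} → Graph n → Pattern → Set
Free G H = ¬ Contains G H

ExLe : ℕ → Pattern → ℕ → Set
ExLe n H m = ∀ (G : Graph n) → Free G H → edges G Data.Nat.≤ m

Next : (m : ℕ) → Fin m → Fin m → Set
Next m i j = (suc (toℕ i) ≡ toℕ j) ⊎ (suc (toℕ i) ≡ m × toℕ j ≡ 0)

PrismEdge : (m : ℕ) → Fin m × Fin 2 → Fin m × Fin 2 → Set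
PrismEdge m (i , s) (j , t) =
  (s ≡ t × Next m i j)
  ⊎ (i ≡ j × toℕ s ≡ 0 × toℕ t ≡ 1)

-- Vertices of the glued graph, for m = suc k positions:
-- the two endpoints of the shared K_2-edge (position 0, side s),
-- and, for each copy c, the vertices at positions 1..k.
data GV (k : ℕ) : Set where
  shared : Fin 2 → GV k
  other  : Bool → Fin k → Fin 2 → GV k

lift : ∀ {k} → Bool → Fin (suc k) × Fin 2 → GV k
lift c (zero  , s) = shared s
lift c (suc j , s) = other c j s

-- m = 2ℓ positions, written as suc (suc (κ ℓ)) with κ ℓ = 2ℓ - 2 (ℓ ≥ 1)
κ : ℕ → ℕ
κ ℓ = (ℓ + ℓ) ∸ 2

GluedEdge : (k : ℕ) → GV k → GV k → Set
GluedEdge k u v =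
  ∃[ c ] ∃[ a ] ∃[ b ] (PrismEdge (suc k) a b × lift c a ≡ u × lift c b ≡ v)

Glued : ℕ → Pattern
Glued ℓ = record { V = GV (suc (κ ℓ)) ; E = GluedEdge (suc (κ ℓ)) }

NotEdge : ∀ {A : Set} → A → A → A → A → Set
NotEdge a b u v = ¬ (u ≡ a × v ≡ b) × ¬ (u ≡ b × v ≡ a)

-- C^⋈-_{2ℓ}: delete e₁ = {shared 0, shared 1} (the merged edge) and
-- e₂ = {shared 0, (copy false, position 1, side 0)}, a C-type edge
-- sharing exactly one vertex with e₁ (all such choices are equivalent
-- up to automorphism).
GluedMinusEdge : (k : ℕ) → GV (suc k) → GV (suc k) → Set
GluedMinusEdge k u v =
  GluedEdge (suc k) u v
  × NotEdge (shared zero) (shared (suc zero)) u v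
  × NotEdge (shared zero) (other false zero zero) u v

GluedMinus : ℕ → Pattern
GluedMinus ℓ = record { V = GV (suc (κ ℓ)) ; E = GluedMinusEdge (κ ℓ) }

{-# OPTIONS --safe #-}
module Submission where

-- Call two edges xy and x′y′ of G consecutive if x, y, x′, y′ form a 4-cycle with edges xy, xy′, x′y, x′y′.
-- A closed walk of 2ℓ consecutive edges which are pairwise disjoint is a prism.  Suppose that G contains
-- no two glued prisms, and fix a prism at each edge that lies in one.  Then every closed walk of length 2ℓ
-- has a conflict: two of its edges meet, or one of them meets the prism fixed at another.  Weight the
-- steps so that D, the total weight of the steps from an edge, is an eigenvector, and let t_j be the trace
-- of the (2j+2)-nd power of the walk operator, normalised to have largest eigenvalue 1.  If a step from
-- any edge meets a given vertex with probability at most 1/β, Cauchy–Schwarz bounds the weight of the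
-- conflicting walks by √((κ/β) t_{ℓ-1} t_{ℓ-2}); hence t_{ℓ-1} ≤ (κ/β) t_{ℓ-2}, and as the t_j are
-- log-convex, 1 ≤ t_{ℓ-1} ≤ (κ/β)^(ℓ-1) t_0.
--
-- This is applied twice.  First, let x₀ have degree d and take the edges between the neighbourhood of x₀
-- and a set of vertices which have at least d/r² neighbours in it, with steps weighted inversely to the
-- codegree of x and x′.  The inequality shows that there are only O(r³) such vertices, if d is at least
-- of order r⁵ and ℓ ≥ 7.  Summing over dyadic r, the 4-cycles with a diagonal at x₀ whose codegree is not
-- below d/τ number O(d²).  Now pass to a subgraph of minimum degree at least c√n with c large: by
-- convexity its 4-cycles outnumber the sum of the squared degrees by a large factor, so most of them have
-- only diagonals of small codegree.  Taking the steps along those 4-cycles, with τ a large multiple of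
-- n^(1/6), the inequality reads τ^(ℓ-1) ≤ κ^(ℓ-1) n, which is false.

open import Defs hiding (V; E; κ) renaming (sym to adj-sym)
open import Data.Nat using (ℕ; zero; suc; _+_; _*_; _∸_; _^_; _⊓_; _!; _≤_; _<_; _<ᵇ_; z≤n; s≤s; s≤s⁻¹; >-nonZero; ≢-nonZero)
open import Data.Nat.Properties hiding (_≟_)
open import Data.Nat.Divisibility using (_∣_; m∣m*n; ∣-trans; m≤n⇒m!∣n!)
open import Data.Nat.ListAction using () renaming (sum to sumᴸ)
open import Data.Nat.Tactic.RingSolver using (solve-∀)
open import Data.Bool using (Bool; true; false; _∧_; if_then_else_)
open import Data.Fin using (Fin; zero; suc; toℕ; fromℕ<; _≟_; _↑ˡ_; _↑ʳ_; combine; quotient; remainder)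
open import Data.Fin.Properties using (toℕ<n; toℕ-fromℕ<; toℕ-injective; remQuot-combine; any?)
open import Data.List using (map; allFin; tabulate)
open import Data.List.Properties using (map-tabulate)
open import Data.Product using (Σ-syntax; ∃-syntax; _×_; _,_; proj₁; proj₂)
open import Data.Sum using (_⊎_; inj₁; inj₂; map₂)
open import Data.Empty using (⊥; ⊥-elim)
open import Function using (_∘_)
open import Relation.Nullary using (¬_; Dec; yes; no)
open import Relation.Nullary.Decidable using (_×-dec_)
open import Relation.Binary using (tri<; tri≈; tri>)
open import Relation.Binary.PropositionalEquality using (_≡_; _≢_; refl; sym; trans; cong; cong₂; subst; subst₂; module ≡-Reasoning)
import Algebra.Properties.Semiring.Sum +-*-semiring as Sum

-- Finite sums

-- Opaque, so that the summand can be inferred from a sum.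
opaque
  ∑ : ∀ n → (Fin n → ℕ) → ℕ
  ∑ n = Sum.sum

infixl 10 ∑
syntax ∑ n (λ i → x) = ∑[ i < n ] x

opaque
  unfolding ∑

  ∑-zero : ∀ (f : Fin 0 → ℕ) → ∑ 0 f ≡ 0
  ∑-zero f = refl

  ∑-suc : ∀ {n} (f : Fin (suc n) → ℕ) → ∑ (suc n) f ≡ f zero + ∑ n (f ∘ suc)
  ∑-suc f = refl

  ∑-cong : ∀ {n} {f g : Fin n → ℕ} → (∀ i → f i ≡ g i) → ∑ n f ≡ ∑ n g
  ∑-cong = Sum.sum-cong-≗

  ∑-distrib-+ : ∀ {n} (f g : Fin n → ℕ) → (∑[ i < n ] (f i + g i)) ≡ ∑ n f + ∑ n g
  ∑-distrib-+ = Sum.∑-distrib-+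

  ∑-comm : ∀ {m n} (f : Fin m → Fin n → ℕ) → (∑[ i < m ] ∑[ j < n ] f i j) ≡ ∑[ j < n ] ∑[ i < m ] f i j
  ∑-comm = Sum.∑-comm

  ∑-*ˡ : ∀ {n} c (f : Fin n → ℕ) → c * ∑ n f ≡ ∑[ i < n ] (c * f i)
  ∑-*ˡ = Sum.*-distribˡ-sum

  ∑-*ʳ : ∀ {n} (f : Fin n → ℕ) c → ∑ n f * c ≡ ∑[ i < n ] (f i * c)
  ∑-*ʳ f c = Sum.*-distribʳ-sum c f

  ∑-mono : ∀ {n} {f g : Fin n → ℕ} → (∀ i → f i ≤ g i) → ∑ n f ≤ ∑ n g
  ∑-mono {zero}  h = z≤n
  ∑-mono {suc n} h = +-mono-≤ (h zero) (∑-mono (h ∘ suc))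

-- Positive linear functionals. Iterated sums over tuples and the weighted sum over walks, whose
-- index type `ℕ → Fin N` is infinite, are instances, so Cauchy-Schwarz and the interchange of sums
-- are proved once for all of them.
record IsSum {I : Set} (σ : (I → ℕ) → ℕ) : Set where
  field
    mono  : ∀ {f g : I → ℕ} → (∀ i → f i ≤ g i) → σ f ≤ σ g
    add   : ∀ f g → σ (λ i → f i + g i) ≡ σ f + σ g
    scale : ∀ c f → σ (λ i → c * f i) ≡ c * σ f

  cong-σ : ∀ {f g : I → ℕ} → (∀ i → f i ≡ g i) → σ f ≡ σ g
  cong-σ h = ≤-antisym (mono λ i → ≤-reflexive (h i)) (mono λ i → ≤-reflexive (sym (h i)))

  scaleʳ : ∀ f c → σ (λ i → f i * c) ≡ σ f * c
  scaleʳ f c = trans (cong-σ λ i → *-comm (f i) c) (trans (scale c f) (*-comm c (σ f)))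

  const-0 : σ (λ _ → 0) ≡ 0
  const-0 = scale 0 (λ _ → 0)

  swap-∑ : ∀ {n} (f : I → Fin n → ℕ) → σ (λ i → ∑[ j < n ] f i j) ≡ ∑[ j < n ] σ (λ i → f i j)
  swap-∑ {zero}  f = trans (trans (cong-σ λ i → ∑-zero (f i)) const-0) (sym (∑-zero λ j → σ λ i → f i j))
  swap-∑ {suc n} f = trans (cong-σ λ i → ∑-suc (f i))
    (trans (add (λ i → f i zero) (λ i → ∑[ j < n ] f i (suc j)))
      (trans (cong (σ (λ i → f i zero) +_) (swap-∑ λ i j → f i (suc j))) (sym (∑-suc λ j → σ λ i → f i j))))

open IsSum

∑-isSum : ∀ {n} → IsSum (∑ n)
∑-isSum = record
  { mono  = ∑-mono
  ; add   = ∑-distrib-+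
  ; scale = λ c f → sym (∑-*ˡ c f)
  }

Σ-isSum : ∀ {I J : Set} {σ : (I → ℕ) → ℕ} {τ : I → (J → ℕ) → ℕ} → IsSum σ → (∀ i → IsSum (τ i)) →
          IsSum {I × J} (λ f → σ λ i → τ i λ j → f (i , j))
Σ-isSum S T = record
  { mono  = λ h → mono S λ i → mono (T i) λ j → h (i , j)
  ; add   = λ f g → trans (cong-σ S λ i → add (T i) (λ j → f (i , j)) (λ j → g (i , j))) (add S _ _)
  ; scale = λ c f → trans (cong-σ S λ i → scale (T i) c λ j → f (i , j)) (scale S c _)
  }

_⊗_ : ∀ {I J : Set} {σ : (I → ℕ) → ℕ} {τ : (J → ℕ) → ℕ} → IsSum σ → IsSum τ →
      IsSum {I × J} (λ f → σ λ i → τ λ j → f (i , j))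
S ⊗ T = Σ-isSum S λ _ → T

∑∑-cong : ∀ {m n} {f g : Fin m → Fin n → ℕ} → (∀ i j → f i j ≡ g i j) →
          (∑[ i < m ] ∑[ j < n ] f i j) ≡ ∑[ i < m ] ∑[ j < n ] g i j
∑∑-cong h = ∑-cong λ i → ∑-cong (h i)

∑∑-mono : ∀ {m n} {f g : Fin m → Fin n → ℕ} → (∀ i j → f i j ≤ g i j) →
          (∑[ i < m ] ∑[ j < n ] f i j) ≤ ∑[ i < m ] ∑[ j < n ] g i j
∑∑-mono h = ∑-mono λ i → ∑-mono (h i)

∑-const : ∀ n c → (∑[ i < n ] c) ≡ n * c
∑-const zero    c = ∑-zero _
∑-const (suc n) c = trans (∑-suc _) (cong (c +_) (∑-const n c))

∑-0 : ∀ n → (∑[ i < n ] 0) ≡ 0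
∑-0 n = trans (∑-const n 0) (*-zeroʳ n)

∑-≤-term : ∀ {n} (f : Fin n → ℕ) i → f i ≤ ∑ _ f
∑-≤-term f zero    = ≤-trans (m≤m+n _ _) (≤-reflexive (sym (∑-suc f)))
∑-≤-term f (suc i) = ≤-trans (≤-trans (∑-≤-term (f ∘ suc) i) (m≤n+m _ _)) (≤-reflexive (sym (∑-suc f)))

∑≡0⇒≡0 : ∀ {n} (f : Fin n → ℕ) → ∑ _ f ≡ 0 → ∀ i → f i ≡ 0
∑≡0⇒≡0 f e i = n≤0⇒n≡0 (≤-trans (∑-≤-term f i) (≤-reflexive e))

∑>0⇒∃ : ∀ {n} (f : Fin n → ℕ) → 0 < ∑ _ f → ∃[ i ] 0 < f i
∑>0⇒∃ {zero}  f p = ⊥-elim (n≮0 (subst (0 <_) (∑-zero f) p))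
∑>0⇒∃ {suc n} f p with f zero in eq
... | suc x = zero , subst (0 <_) (sym eq) (s≤s z≤n)
... | zero  with ∑>0⇒∃ (f ∘ suc) (subst (0 <_) (trans (∑-suc f) (cong (_+ ∑ n (f ∘ suc)) eq)) p)
...   | i , q = suc i , q

∑-product : ∀ {m n} (f : Fin m → ℕ) (g : Fin n → ℕ) →
            (∑[ i < m ] ∑[ j < n ] (f i * g j)) ≡ ∑ _ f * ∑ _ g
∑-product f g = trans (∑-cong λ i → sym (∑-*ˡ (f i) g)) (sym (∑-*ʳ f (∑ _ g)))

2ab≤a²+b² : ∀ a b → 2 * (a * b) ≤ a * a + b * b
2ab≤a²+b² a b with ≤-total a b
... | inj₁ a≤b with m≤n⇒∃[o]m+o≡n a≤b
...   | d , refl = ≤-trans (m≤m+n _ (d * d)) (≤-reflexive (lem a d))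
  where lem : ∀ a d → 2 * (a * (a + d)) + d * d ≡ a * a + (a + d) * (a + d)
        lem = solve-∀
2ab≤a²+b² a b | inj₂ b≤a with m≤n⇒∃[o]m+o≡n b≤a
...   | d , refl = ≤-trans (m≤m+n _ (d * d)) (≤-reflexive (lem b d))
  where lem : ∀ b d → 2 * ((b + d) * b) + d * d ≡ (b + d) * (b + d) + b * b
        lem = solve-∀

module _ {I : Set} {σ : (I → ℕ) → ℕ} (S : IsSum σ) where

  σσ-product : ∀ (f g : I → ℕ) → σ (λ i → σ λ j → f i * g j) ≡ σ f * σ g
  σσ-product f g = trans (cong-σ S λ i → scale S (f i) g) (scaleʳ S f (σ g))

  -- Doubling and symmetrising over pairs (i, j) reduces this to 2ab ≤ a² + b² for `a i * b j` and
  -- `b i * a j`, so neither roots nor subtraction are needed.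
  cauchySchwarz : ∀ (c a b : I → ℕ) →
    σ (λ i → c i * (a i * b i)) * σ (λ i → c i * (a i * b i))
      ≤ σ (λ i → c i * (a i * a i)) * σ (λ i → c i * (b i * b i))
  cauchySchwarz c a b = *-cancelˡ-≤ 2 (begin
    2 * (σ x * σ x)                                   ≡⟨ cong (2 *_) (sym (σσ-product x x)) ⟩
    2 * σ (λ i → σ λ j → x i * x j)                   ≡⟨ sym (scale S 2 _) ⟩
    σ (λ i → 2 * σ λ j → x i * x j)                   ≡⟨ cong-σ S (λ i → sym (scale S 2 _)) ⟩
    σ (λ i → σ λ j → 2 * (x i * x j))                 ≤⟨ mono S (λ i → mono S λ j → pointwise i j) ⟩
    σ (λ i → σ λ j → p i * q j + q i * p j)           ≡⟨ cong-σ S (λ i → add S _ _) ⟩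
    σ (λ i → σ (λ j → p i * q j) + σ (λ j → q i * p j)) ≡⟨ add S _ _ ⟩
    σ (λ i → σ λ j → p i * q j) + σ (λ i → σ λ j → q i * p j)
      ≡⟨ cong₂ _+_ (σσ-product p q) (σσ-product q p) ⟩
    σ p * σ q + σ q * σ p                             ≡⟨ fin (σ p) (σ q) ⟩
    2 * (σ p * σ q)                                   ∎)
    where
    open ≤-Reasoning
    x p q : I → ℕ
    x i = c i * (a i * b i)
    p i = c i * (a i * a i)
    q i = c i * (b i * b i)
    fin : ∀ u v → u * v + v * u ≡ 2 * (u * v)
    fin = solve-∀
    l₁ : ∀ c a b c′ a′ b′ → 2 * ((c * (a * b)) * (c′ * (a′ * b′))) ≡ (c * c′) * (2 * ((a * b′) * (b * a′)))
    l₁ = solve-∀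
    l₂ : ∀ c a b c′ a′ b′ → (c * c′) * ((a * b′) * (a * b′) + (b * a′) * (b * a′))
       ≡ (c * (a * a)) * (c′ * (b′ * b′)) + (c * (b * b)) * (c′ * (a′ * a′))
    l₂ = solve-∀
    pointwise : ∀ i j → 2 * (x i * x j) ≤ p i * q j + q i * p j
    pointwise i j = begin
      2 * (x i * x j) ≡⟨ l₁ (c i) (a i) (b i) (c j) (a j) (b j) ⟩
      (c i * c j) * (2 * ((a i * b j) * (b i * a j)))
        ≤⟨ *-monoʳ-≤ (c i * c j) (2ab≤a²+b² (a i * b j) (b i * a j)) ⟩
      (c i * c j) * ((a i * b j) * (a i * b j) + (b i * a j) * (b i * a j))
        ≡⟨ l₂ (c i) (a i) (b i) (c j) (a j) (b j) ⟩
      p i * q j + q i * p j ∎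

-- Kronecker delta and sums over pairs

δ : ∀ {n} → Fin n → Fin n → ℕ
δ zero    zero    = 1
δ zero    (suc j) = 0
δ (suc i) zero    = 0
δ (suc i) (suc j) = δ i j

δ-refl : ∀ {n} (i : Fin n) → δ i i ≡ 1
δ-refl zero    = refl
δ-refl (suc i) = δ-refl i

δ-sym : ∀ {n} (i j : Fin n) → δ i j ≡ δ j i
δ-sym zero    zero    = refl
δ-sym zero    (suc j) = refl
δ-sym (suc i) zero    = refl
δ-sym (suc i) (suc j) = δ-sym i j

δ≡0⇒≢ : ∀ {n} {i j : Fin n} → δ i j ≡ 0 → i ≢ j
δ≡0⇒≢ {i = i} e refl with trans (sym (δ-refl i)) e
... | ()

≢⇒δ≡0 : ∀ {n} (i j : Fin n) → i ≢ j → δ i j ≡ 0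
≢⇒δ≡0 zero    zero    ne = ⊥-elim (ne refl)
≢⇒δ≡0 zero    (suc j) ne = refl
≢⇒δ≡0 (suc i) zero    ne = refl
≢⇒δ≡0 (suc i) (suc j) ne = ≢⇒δ≡0 i j (ne ∘ cong suc)

∑-δ : ∀ {n} (i : Fin n) (f : Fin n → ℕ) → (∑[ j < n ] (δ i j * f j)) ≡ f i
∑-δ {suc n} zero    f = trans (trans (∑-suc _) (cong₂ _+_ (*-identityˡ (f zero)) (∑-0 n))) (+-identityʳ _)
∑-δ {suc n} (suc i) f = trans (∑-suc _) (∑-δ i (f ∘ suc))

∑-δʳ : ∀ {n} (i : Fin n) (f : Fin n → ℕ) → (∑[ j < n ] (f j * δ j i)) ≡ f i
∑-δʳ i f = trans (∑-cong λ j → trans (*-comm (f j) (δ j i)) (cong (_* f j) (δ-sym j i))) (∑-δ i f)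

∑-↑ : ∀ m n (f : Fin (m + n) → ℕ) →
      ∑ _ f ≡ (∑[ i < m ] f (i ↑ˡ n)) + ∑[ j < n ] f (m ↑ʳ j)
∑-↑ zero    n f = cong (_+ ∑ n f) (sym (∑-zero _))
∑-↑ (suc m) n f = trans (∑-suc f) (trans (cong (f zero +_) (∑-↑ m n (f ∘ suc)))
  (trans (sym (+-assoc (f zero) _ _)) (cong (_+ ∑[ j < n ] f (suc m ↑ʳ j)) (sym (∑-suc λ i → f (i ↑ˡ n))))))

∑-combine : ∀ m n (f : Fin (m * n) → ℕ) → ∑ _ f ≡ ∑[ i < m ] ∑[ j < n ] f (combine i j)
∑-combine zero    n f = trans (∑-zero f) (sym (∑-zero _))
∑-combine (suc m) n f = trans (∑-↑ n (m * n) f)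
  (trans (cong ((∑[ j < n ] f (j ↑ˡ (m * n))) +_) (∑-combine m n (f ∘ (n ↑ʳ_)))) (sym (∑-suc λ i → ∑[ j < n ] f (combine i j))))

∑-pairs : ∀ m n (f : Fin m → Fin n → ℕ) →
          (∑[ u < m * n ] f (quotient {m} n u) (remainder {m} n u)) ≡ ∑[ i < m ] ∑[ j < n ] f i j
∑-pairs m n f = trans (∑-combine m n _) (∑∑-cong {m} {n} λ i j →
  cong₂ f (cong proj₁ (remQuot-combine {m} {n} i j)) (cong proj₂ (remQuot-combine {m} {n} i j)))

-- The walk operator and its traces

module Chain {N : ℕ} (w : Fin N → Fin N → ℕ) (w-sym : ∀ u v → w u v ≡ w v u) (m : Fin N → ℕ) where

  -- The kernel w m w ⋯ m w with j + 1 factors w. Unlike the powers `pow` of the walk operator w m,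
  -- which end in a further m, it is symmetric.
  V : ℕ → Fin N → Fin N → ℕ
  V zero    u v = w u v
  V (suc j) u v = ∑[ z < N ] (w u z * (m z * V j z v))

  V-sucʳ : ∀ j u v → V (suc j) u v ≡ ∑[ z < N ] (V j u z * (m z * w z v))
  V-sucʳ zero    u v = refl
  V-sucʳ (suc j) u v = begin
    ∑[ z < N ] (w u z * (m z * V (suc j) z v))
      ≡⟨ ∑-cong (λ z → cong (λ x → w u z * (m z * x)) (V-sucʳ j z v)) ⟩
    ∑[ z < N ] (w u z * (m z * ∑[ y < N ] (V j z y * (m y * w y v))))
      ≡⟨ ∑-cong (λ z → trans (sym (*-assoc (w u z) (m z) _)) (∑-*ˡ (w u z * m z) _)) ⟩
    ∑[ z < N ] ∑[ y < N ] (w u z * m z * (V j z y * (m y * w y v)))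
      ≡⟨ ∑-comm _ ⟩
    ∑[ y < N ] ∑[ z < N ] (w u z * m z * (V j z y * (m y * w y v)))
      ≡⟨ ∑∑-cong (λ y z → lem (w u z) (m z) (V j z y) (m y * w y v)) ⟩
    ∑[ y < N ] ∑[ z < N ] (w u z * (m z * V j z y) * (m y * w y v))
      ≡⟨ ∑-cong (λ y → sym (∑-*ʳ _ (m y * w y v))) ⟩
    ∑[ y < N ] (V (suc j) u y * (m y * w y v)) ∎
    where
    open ≡-Reasoning
    lem : ∀ a b c d → a * b * (c * d) ≡ a * (b * c) * d
    lem = solve-∀

  V-sym : ∀ j u v → V j u v ≡ V j v u
  V-sym zero    u v = w-sym u v
  V-sym (suc j) u v = trans (∑-cong λ z → trans (cong₂ (λ x y → x * (m z * y)) (w-sym u z) (V-sym j z v))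
                                                 (lem (w z u) (m z) (V j v z)))
                            (sym (V-sucʳ j v u))
    where
    lem : ∀ a b c → a * (b * c) ≡ c * (b * a)
    lem = solve-∀

  pow : ℕ → Fin N → Fin N → ℕ
  pow zero    u v = δ u v
  pow (suc j) u v = V j u v * m v

  pow-suc : ∀ j u v → pow (suc j) u v ≡ ∑[ z < N ] (w u z * m z * pow j z v)
  pow-suc zero    u v = sym (∑-δʳ v (λ z → w u z * m z))
  pow-suc (suc j) u v = trans (∑-*ʳ _ (m v)) (∑-cong λ z → lem (w u z) (m z) (V j z v) (m v))
    where
    lem : ∀ a b c d → a * (b * c) * d ≡ a * b * (c * d)
    lem = solve-∀

  pow-+ : ∀ i j u v → pow (i + j) u v ≡ ∑[ z < N ] (pow i u z * pow j z v)
  pow-+ zero    j u v = sym (∑-δ u (λ z → pow j z v))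
  pow-+ (suc i) j u v = begin
    pow (suc (i + j)) u v                                  ≡⟨ pow-suc (i + j) u v ⟩
    ∑[ z < N ] (w u z * m z * pow (i + j) z v)
      ≡⟨ ∑-cong (λ z → trans (cong (w u z * m z *_) (pow-+ i j z v)) (∑-*ˡ (w u z * m z) _)) ⟩
    ∑[ z < N ] ∑[ y < N ] (w u z * m z * (pow i z y * pow j y v))
      ≡⟨ ∑-comm _ ⟩
    ∑[ y < N ] ∑[ z < N ] (w u z * m z * (pow i z y * pow j y v))
      ≡⟨ ∑∑-cong (λ y z → sym (*-assoc (w u z * m z) (pow i z y) (pow j y v))) ⟩
    ∑[ y < N ] ∑[ z < N ] (w u z * m z * pow i z y * pow j y v)
      ≡⟨ ∑-cong (λ y → sym (∑-*ʳ _ (pow j y v))) ⟩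
    ∑[ y < N ] ((∑[ z < N ] (w u z * m z * pow i z y)) * pow j y v)
      ≡⟨ ∑-cong (λ y → cong (_* pow j y v) (sym (pow-suc i u y))) ⟩
    ∑[ y < N ] (pow (suc i) u y * pow j y v) ∎
    where open ≡-Reasoning

  -- By symmetry of `V` this is the trace of the (a + b + 2)-nd power of the walk operator, written
  -- as an inner product with weight m ⊗ m so that Cauchy-Schwarz applies.
  inner : ℕ → ℕ → ℕ
  inner a b = ∑[ u < N ] ∑[ v < N ] (m u * m v * (V a u v * V b u v))

  -- The trace of the (2j + 2)-nd power of the operator with kernel w(u,v) m(v).
  t : ℕ → ℕ
  t j = inner j j

  -- The first step, from u to z, is detached from one factor and, w being symmetric, prefixed to
  -- the other.
  inner-shift : ∀ a b → inner (suc a) b ≡ inner a (suc b)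
  inner-shift a b = begin
    inner (suc a) b
      ≡⟨ ∑∑-cong (λ u v → trans (cong (m u * m v *_) (∑-*ʳ _ (V b u v))) (∑-*ˡ (m u * m v) _)) ⟩
    ∑[ u < N ] ∑[ v < N ] ∑[ z < N ] (m u * m v * (w u z * (m z * V a z v) * V b u v))
      ≡⟨ ∑-cong (λ u → ∑-comm _) ⟩
    ∑[ u < N ] ∑[ z < N ] ∑[ v < N ] (m u * m v * (w u z * (m z * V a z v) * V b u v))
      ≡⟨ ∑-comm _ ⟩
    ∑[ z < N ] ∑[ u < N ] ∑[ v < N ] (m u * m v * (w u z * (m z * V a z v) * V b u v))
      ≡⟨ ∑-cong (λ z → ∑-comm _) ⟩
    ∑[ z < N ] ∑[ v < N ] ∑[ u < N ] (m u * m v * (w u z * (m z * V a z v) * V b u v))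
      ≡⟨ ∑∑-cong (λ z v → ∑-cong λ u → trans (lem (m u) (m v) (w u z) (m z) (V a z v) (V b u v))
                                              (cong (λ x → m z * m v * (V a z v * (x * (m u * V b u v)))) (w-sym u z))) ⟩
    ∑[ z < N ] ∑[ v < N ] ∑[ u < N ] (m z * m v * (V a z v * (w z u * (m u * V b u v))))
      ≡⟨ ∑∑-cong (λ z v → sym (trans (cong (m z * m v *_) (∑-*ˡ (V a z v) _)) (∑-*ˡ (m z * m v) _))) ⟩
    inner a (suc b) ∎
    where
    open ≡-Reasoning
    lem : ∀ p q r s x y → p * q * (r * (s * x) * y) ≡ s * q * (x * (r * (p * y)))
    lem = solve-∀

  -- By `inner-shift`, `t (suc j)` is the inner product of `V j` and `V (suc (suc j))`, whose
  -- squared norms are the factors on the right.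
  t-logConvex : ∀ j → t (suc j) * t (suc j) ≤ t j * t (suc (suc j))
  t-logConvex j = subst (λ x → x * x ≤ t j * t (suc (suc j))) (sym (inner-shift j (suc j)))
    (cauchySchwarz (∑-isSum ⊗ ∑-isSum) (λ { (u , v) → m u * m v }) (λ { (u , v) → V j u v })
                   (λ { (u , v) → V (suc (suc j)) u v }))

  D : Fin N → ℕ
  D u = ∑[ v < N ] w u v

  w≤D : ∀ u v → w u v ≤ D u
  w≤D u v = ∑-≤-term (w u) v

  -- With m proportional to 1/D, the operator w m is M times the transpose of the transition matrix
  -- of the walk with weights w; hence M is its largest eigenvalue.
  module Stationary (M : ℕ) (mD≡M : ∀ u → 0 < D u → m u * D u ≡ M) (m≡0 : ∀ u → D u ≡ 0 → m u ≡ 0) where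

    mD≤M : ∀ u → m u * D u ≤ M
    mD≤M u with D u in eq
    ... | zero  = ≤-trans (≤-reflexive (*-zeroʳ (m u))) z≤n
    ... | suc d = ≤-reflexive (trans (cong (m u *_) (sym eq)) (mD≡M u (subst (0 <_) (sym eq) (s≤s z≤n))))

    mDD≡MD : ∀ u → m u * D u * D u ≡ M * D u
    mDD≡MD u with D u in eq
    ... | zero  = trans (*-zeroʳ (m u * 0)) (sym (*-zeroʳ M))
    ... | suc d = cong (_* suc d) (trans (cong (m u *_) (sym eq)) (mD≡M u (subst (0 <_) (sym eq) (s≤s z≤n))))

    wmD≡wM : ∀ u v → w u v * (m v * D v) ≡ w u v * M
    wmD≡wM u v with w u v in eq
    ... | zero  = refl
    ... | suc x = cong (suc x *_) (mD≡M v (≤-trans (subst (0 <_) (trans (sym eq) (w-sym u v)) (s≤s z≤n)) (w≤D v u)))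

    -- D is an eigenvector with eigenvalue M.
    V-eigen : ∀ j u → (∑[ v < N ] (V j u v * (m v * D v))) ≡ M ^ suc j * D u
    V-eigen zero u = begin
      ∑[ v < N ] (w u v * (m v * D v)) ≡⟨ ∑-cong (wmD≡wM u) ⟩
      ∑[ v < N ] (w u v * M)           ≡⟨ sym (∑-*ʳ (w u) M) ⟩
      D u * M                          ≡⟨ *-comm (D u) M ⟩
      M * D u                          ≡⟨ cong (_* D u) (sym (*-identityʳ M)) ⟩
      M * 1 * D u                      ∎
      where open ≡-Reasoning
    V-eigen (suc j) u = begin
      ∑[ v < N ] (V (suc j) u v * (m v * D v))
        ≡⟨ ∑-cong (λ v → ∑-*ʳ _ (m v * D v)) ⟩
      ∑[ v < N ] ∑[ z < N ] (w u z * (m z * V j z v) * (m v * D v))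
        ≡⟨ ∑-comm _ ⟩
      ∑[ z < N ] ∑[ v < N ] (w u z * (m z * V j z v) * (m v * D v))
        ≡⟨ ∑∑-cong (λ z v → l₁ (w u z) (m z) (V j z v) (m v * D v)) ⟩
      ∑[ z < N ] ∑[ v < N ] (w u z * m z * (V j z v * (m v * D v)))
        ≡⟨ ∑-cong (λ z → trans (sym (∑-*ˡ (w u z * m z) _)) (cong (w u z * m z *_) (V-eigen j z))) ⟩
      ∑[ z < N ] (w u z * m z * (M ^ suc j * D z))
        ≡⟨ ∑-cong (λ z → trans (l₂ (w u z) (m z) (M ^ suc j) (D z)) (cong (M ^ suc j *_) (wmD≡wM u z))) ⟩
      ∑[ z < N ] (M ^ suc j * (w u z * M))
        ≡⟨ trans (sym (∑-*ˡ (M ^ suc j) _)) (cong (M ^ suc j *_) (sym (∑-*ʳ (w u) M))) ⟩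
      M ^ suc j * (D u * M) ≡⟨ l₃ (M ^ suc j) (D u) M ⟩
      M * M ^ suc j * D u ∎
      where
      open ≡-Reasoning
      l₁ : ∀ a b c d → a * (b * c) * d ≡ a * b * (c * d)
      l₁ = solve-∀
      l₂ : ∀ a b c d → a * b * (c * d) ≡ c * (a * (b * d))
      l₂ = solve-∀
      l₃ : ∀ a b c → a * (b * c) ≡ c * a * b
      l₃ = solve-∀

    private
      𝔇 = ∑[ u < N ] D u

    -- The trace of an even power is at least the contribution of a single eigenvalue. Testing `V j`
    -- against D ⊗ D by Cauchy-Schwarz shows this without spectral theory.
    t-lower : 0 < M → 0 < 𝔇 → ∀ j → M ^ suc j * M ^ suc j ≤ t j
    t-lower (s≤s _) p j = *-cancelʳ-≤ (M ^ suc j * M ^ suc j) (t j) (Y * Y) {{>-nonZero (*-mono-< Y>0 Y>0)}} (begin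
      M ^ suc j * M ^ suc j * (Y * Y)     ≡⟨ l₁ (M ^ suc j) Y ⟩
      M ^ suc j * Y * (M ^ suc j * Y)     ≡⟨ cong (λ x → x * x) (sym X≡) ⟩
      X * X                               ≤⟨ cauchySchwarz (∑-isSum ⊗ ∑-isSum) (λ { (u , v) → m u * m v })
                                              (λ { (u , v) → V j u v }) (λ { (u , v) → D u * D v }) ⟩
      t j * (∑[ u < N ] ∑[ v < N ] (m u * m v * (D u * D v * (D u * D v))))
        ≡⟨ cong (t j *_) (trans (∑∑-cong λ u v → l₂ (m u) (m v) (D u) (D v)) (∑-product _ _)) ⟩
      t j * ((∑[ u < N ] (m u * D u * D u)) * ∑[ u < N ] (m u * D u * D u))
        ≡⟨ cong (λ x → t j * (x * x)) Σ≡ ⟩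
      t j * (Y * Y)                       ∎)
      where
      open ≤-Reasoning
      Y = M * 𝔇
      Y>0 : 0 < Y
      Y>0 = *-mono-< {0} {M} {0} {𝔇} (s≤s z≤n) p
      X = ∑[ u < N ] ∑[ v < N ] (m u * m v * (V j u v * (D u * D v)))
      l₁ : ∀ a b → a * a * (b * b) ≡ a * b * (a * b)
      l₁ = solve-∀
      l₂ : ∀ a b c d → a * b * (c * d * (c * d)) ≡ a * c * c * (b * d * d)
      l₂ = solve-∀
      l₃ : ∀ a b c d e → a * b * (c * (d * e)) ≡ a * d * (c * (b * e))
      l₃ = solve-∀
      l₄ : ∀ a b c → a * b * (c * b) ≡ c * (a * b * b)
      l₄ = solve-∀
      Σ≡ : (∑[ u < N ] (m u * D u * D u)) ≡ Y
      Σ≡ = trans (∑-cong mDD≡MD) (sym (∑-*ˡ M D))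
      X≡ : X ≡ M ^ suc j * Y
      X≡ = trans (∑-cong λ u → trans (∑-cong λ v → l₃ (m u) (m v) (V j u v) (D u) (D v))
             (trans (sym (∑-*ˡ (m u * D u) _)) (trans (cong (m u * D u *_) (V-eigen j u)) (l₄ (m u) (D u) (M ^ suc j)))))
           (trans (sym (∑-*ˡ (M ^ suc j) _)) (cong (M ^ suc j *_) Σ≡))

    module Conflict (conf : Fin N → Fin N → ℕ) (conf≤1 : ∀ u z → conf u z ≤ 1) (β γ : ℕ)
      (sparse : ∀ u y → β * (m y * ∑[ z < N ] (w y z * conf u z)) ≤ γ * M) where

      -- The weight of the closed walks of q + q′ steps with a conflict between their start u and
      -- the state z reached after q steps.
      C : ℕ → ℕ → ℕ
      C q q′ = ∑[ u < N ] ∑[ z < N ] (conf u z * (pow q u z * pow q′ z u))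

      -- Closed walks may be reversed. The pair (u, z) keeps its order, as `conf` is not assumed
      -- symmetric.
      C-sym : ∀ q q′ → C (suc q) (suc q′) ≡ C (suc q′) (suc q)
      C-sym q q′ = ∑∑-cong λ u z → cong (conf u z *_)
        (trans (cong₂ (λ x y → x * m z * (y * m u)) (V-sym q u z) (V-sym q′ z u))
               (lem (V q z u) (m z) (V q′ u z) (m u)))
        where
        lem : ∀ a b c d → a * b * (c * d) ≡ c * b * (a * d)
        lem = solve-∀

      -- In a closed walk from u, with a conflict at z after suc q steps, y is the predecessor of z and p
      -- the point antipodal to z.  Cauchy–Schwarz over (y, z, p) separates the half from z to p from the
      -- half from p to y through u; in the latter, summing over z first uses that z rarely conflicts with u.
      module _ (k q r : ℕ) (q+r : r + q ≡ suc k) where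

        private
          R : Fin N → Fin N → Fin N → ℕ
          R z p y = ∑[ u < N ] (conf u z * (pow r p u * pow q u y))

          S₃ = ∑-isSum {N} ⊗ (∑-isSum {N} ⊗ ∑-isSum {N})

          term : Fin N → Fin N × Fin N × Fin N → ℕ
          term u (y , z , p) = conf u z * ((pow q u y * (w y z * m z)) * ((V (suc k) z p * m p) * pow r p u))

          C≡ : C (suc q) (suc (suc k) + r)
               ≡ ∑[ y < N ] ∑[ z < N ] ∑[ p < N ] (w y z * m p * (m z * V (suc k) z p * R z p y))
          C≡ = begin
            ∑[ u < N ] ∑[ z < N ] (conf u z * (pow (suc q) u z * pow (suc (suc k) + r) z u))
              ≡⟨ ∑∑-cong (λ u z → cong (conf u z *_) (trans
                   (cong₂ _*_ (trans (cong (λ x → pow x u z) (+-comm 1 q))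
                                (trans (pow-+ q 1 u z) (∑-cong λ y → refl)))
                              (pow-+ (suc (suc k)) r z u))
                   (sym (∑-product _ _)))) ⟩
            ∑[ u < N ] ∑[ z < N ] (conf u z * ∑[ y < N ] ∑[ p < N ] ((pow q u y * (w y z * m z)) * ((V (suc k) z p * m p) * pow r p u)))
              ≡⟨ ∑∑-cong (λ u z → trans (∑-*ˡ (conf u z) _) (∑-cong λ y → ∑-*ˡ (conf u z) _)) ⟩
            ∑[ u < N ] ∑[ z < N ] ∑[ y < N ] ∑[ p < N ] term u (y , z , p)
              ≡⟨ ∑-cong (λ u → ∑-comm _) ⟩
            ∑[ u < N ] ∑[ y < N ] ∑[ z < N ] ∑[ p < N ] term u (y , z , p)
              ≡⟨ sym (swap-∑ S₃ (λ i u → term u i)) ⟩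
            ∑[ y < N ] ∑[ z < N ] ∑[ p < N ] ∑[ u < N ] term u (y , z , p)
              ≡⟨ ∑∑-cong (λ y z → ∑-cong λ p → trans
                   (∑-cong λ u → lem (conf u z) (pow q u y) (w y z) (m z) (V (suc k) z p) (m p) (pow r p u))
                   (trans (sym (∑-*ˡ (w y z * m p * (m z * V (suc k) z p)) _)) (*-assoc (w y z * m p) _ _))) ⟩
            ∑[ y < N ] ∑[ z < N ] ∑[ p < N ] (w y z * m p * (m z * V (suc k) z p * R z p y)) ∎
            where
            open ≡-Reasoning
            lem : ∀ c a b d e f g → c * ((a * (b * d)) * ((e * f) * g)) ≡ b * f * (d * e) * (c * (g * a))
            lem = solve-∀

          A² = ∑[ y < N ] ∑[ z < N ] ∑[ p < N ] (w y z * m p * ((m z * V (suc k) z p) * (m z * V (suc k) z p)))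
          R² = ∑[ y < N ] ∑[ z < N ] ∑[ p < N ] (w y z * m p * (R z p y * R z p y))

          -- The predecessor y occurs only in `w y z`; summing over it gives `D z`, and `m z * D z`
          -- is at most M.
          A²-bound : A² ≤ M * t (suc k)
          A²-bound = begin
            A² ≡⟨ ∑-comm _ ⟩
            ∑[ z < N ] ∑[ y < N ] ∑[ p < N ] (w y z * m p * ((m z * V (suc k) z p) * (m z * V (suc k) z p)))
              ≡⟨ ∑-cong (λ z → ∑-comm _) ⟩
            ∑[ z < N ] ∑[ p < N ] ∑[ y < N ] (w y z * m p * ((m z * V (suc k) z p) * (m z * V (suc k) z p)))
              ≡⟨ ∑∑-cong (λ z p → trans (∑-cong λ y → lem (w y z) (m p) (m z) (V (suc k) z p)) (sym (∑-*ʳ _ (m z * (m z * m p * (V (suc k) z p * V (suc k) z p)))))) ⟩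
            ∑[ z < N ] ∑[ p < N ] ((∑[ y < N ] w y z) * (m z * (m z * m p * (V (suc k) z p * V (suc k) z p))))
              ≡⟨ ∑∑-cong (λ z p → trans (sym (*-assoc (∑[ y < N ] w y z) (m z) _)) (cong (_* (m z * m p * (V (suc k) z p * V (suc k) z p)))
                    (trans (*-comm (∑[ y < N ] w y z) (m z)) (cong (m z *_) (∑-cong λ y → w-sym y z))))) ⟩
            ∑[ z < N ] ∑[ p < N ] (m z * D z * (m z * m p * (V (suc k) z p * V (suc k) z p)))
              ≤⟨ ∑∑-mono (λ z p → *-monoˡ-≤ (m z * m p * (V (suc k) z p * V (suc k) z p)) (mD≤M z)) ⟩
            ∑[ z < N ] ∑[ p < N ] (M * (m z * m p * (V (suc k) z p * V (suc k) z p)))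
              ≡⟨ trans (∑-cong λ z → sym (∑-*ˡ M _)) (sym (∑-*ˡ M _)) ⟩
            M * t (suc k) ∎
            where
            open ≤-Reasoning
            lem : ∀ a b c d → a * b * ((c * d) * (c * d)) ≡ a * (c * (c * b * (d * d)))
            lem = solve-∀

          R≤pow : ∀ z p y → R z p y ≤ V k p y * m y
          R≤pow z p y = begin
            R z p y ≤⟨ ∑-mono (λ u → ≤-trans (*-monoˡ-≤ (pow r p u * pow q u y) (conf≤1 u z)) (≤-reflexive (*-identityˡ _))) ⟩
            ∑[ u < N ] (pow r p u * pow q u y) ≡⟨ sym (pow-+ r q p y) ⟩
            pow (r + q) p y ≡⟨ cong (λ x → pow x p y) q+r ⟩
            V k p y * m y ∎
            where open ≤-Reasoning

          R-sparse : ∀ y p → β * (m y * ∑[ z < N ] (w y z * R z p y)) ≤ γ * M * (V k p y * m y)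
          R-sparse y p = begin
            β * (m y * ∑[ z < N ] (w y z * R z p y))
              ≡⟨ cong (λ x → β * (m y * x)) (trans (∑-cong λ z → ∑-*ˡ (w y z) _) (∑-comm _)) ⟩
            β * (m y * ∑[ u < N ] ∑[ z < N ] (w y z * (conf u z * (pow r p u * pow q u y))))
              ≡⟨ cong (λ x → β * (m y * x)) (∑-cong λ u → trans (∑-cong λ z → l₁ (w y z) (conf u z) _) (sym (∑-*ˡ (pow r p u * pow q u y) _))) ⟩
            β * (m y * ∑[ u < N ] (pow r p u * pow q u y * ∑[ z < N ] (w y z * conf u z)))
              ≡⟨ trans (cong (β *_) (∑-*ˡ (m y) _)) (∑-*ˡ β _) ⟩
            ∑[ u < N ] (β * (m y * (pow r p u * pow q u y * ∑[ z < N ] (w y z * conf u z))))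
              ≡⟨ ∑-cong (λ u → l₂ β (m y) (pow r p u * pow q u y) (∑[ z < N ] (w y z * conf u z))) ⟩
            ∑[ u < N ] (pow r p u * pow q u y * (β * (m y * ∑[ z < N ] (w y z * conf u z))))
              ≤⟨ ∑-mono (λ u → *-monoʳ-≤ (pow r p u * pow q u y) (sparse u y)) ⟩
            ∑[ u < N ] (pow r p u * pow q u y * (γ * M)) ≡⟨ sym (∑-*ʳ _ (γ * M)) ⟩
            (∑[ u < N ] (pow r p u * pow q u y)) * (γ * M) ≡⟨ cong (_* (γ * M)) (trans (sym (pow-+ r q p y)) (cong (λ x → pow x p y) q+r)) ⟩
            V k p y * m y * (γ * M) ≡⟨ *-comm _ (γ * M) ⟩
            γ * M * (V k p y * m y) ∎
            where
            open ≤-Reasoning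
            l₁ : ∀ a b c → a * (b * c) ≡ c * (a * b)
            l₁ = solve-∀
            l₂ : ∀ a b c d → a * (b * (c * d)) ≡ c * (a * (b * d))
            l₂ = solve-∀

          -- In one of the two factors `R` the conflict is forgotten. The other keeps it, so that
          -- the sum over z gains γ/β by `R-sparse`.
          R²-bound : β * R² ≤ γ * M * t k
          R²-bound = begin
            β * R² ≤⟨ *-monoʳ-≤ β (∑∑-mono λ y z → ∑-mono λ p → *-monoʳ-≤ (w y z * m p) (*-monoʳ-≤ (R z p y) (R≤pow z p y))) ⟩
            β * (∑[ y < N ] ∑[ z < N ] ∑[ p < N ] (w y z * m p * (R z p y * (V k p y * m y))))
              ≡⟨ cong (β *_) (∑-cong λ y → trans (∑-comm _) (∑-cong λ p → trans (∑-cong λ z → l₁ (w y z) (m p) (R z p y) (V k p y) (m y))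
                   (trans (sym (∑-*ˡ (m p * V k p y * m y) _)) (*-assoc (m p * V k p y) (m y) _)))) ⟩
            β * (∑[ y < N ] ∑[ p < N ] (m p * V k p y * (m y * ∑[ z < N ] (w y z * R z p y))))
              ≡⟨ trans (∑-*ˡ β _) (∑-cong λ y → trans (∑-*ˡ β _) (∑-cong λ p → l₂ β (m p * V k p y) _)) ⟩
            ∑[ y < N ] ∑[ p < N ] (m p * V k p y * (β * (m y * ∑[ z < N ] (w y z * R z p y))))
              ≤⟨ ∑∑-mono (λ y p → *-monoʳ-≤ (m p * V k p y) (R-sparse y p)) ⟩
            ∑[ y < N ] ∑[ p < N ] (m p * V k p y * (γ * M * (V k p y * m y)))
              ≡⟨ ∑∑-cong (λ y p → l₃ (m p) (V k p y) (γ * M) (m y)) ⟩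
            ∑[ y < N ] ∑[ p < N ] (γ * M * (m p * m y * (V k p y * V k p y)))
              ≡⟨ trans (∑-cong λ y → sym (∑-*ˡ (γ * M) _)) (sym (∑-*ˡ (γ * M) _)) ⟩
            γ * M * (∑[ y < N ] ∑[ p < N ] (m p * m y * (V k p y * V k p y)))
              ≡⟨ cong (γ * M *_) (∑-comm _) ⟩
            γ * M * t k ∎
            where
            open ≤-Reasoning
            l₁ : ∀ a b c d e → a * b * (c * (d * e)) ≡ b * d * e * (a * c)
            l₁ = solve-∀
            l₂ : ∀ a b c → a * (b * c) ≡ b * (a * c)
            l₂ = solve-∀
            l₃ : ∀ a b c d → a * b * (c * (b * d)) ≡ c * (a * d * (b * b))
            l₃ = solve-∀

        C-bound : β * (C (suc q) (suc (suc k) + r) * C (suc q) (suc (suc k) + r)) ≤ γ * (M * M) * (t (suc k) * t k)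
        C-bound = begin
          β * (C (suc q) (suc (suc k) + r) * C (suc q) (suc (suc k) + r)) ≡⟨ cong (λ x → β * (x * x)) C≡ ⟩
          _ ≤⟨ *-monoʳ-≤ β (cauchySchwarz S₃ (λ { (y , z , p) → w y z * m p }) (λ { (y , z , p) → m z * V (suc k) z p })
                                             (λ { (y , z , p) → R z p y })) ⟩
          β * (A² * R²) ≡⟨ l₁ β A² R² ⟩
          A² * (β * R²) ≤⟨ *-mono-≤ A²-bound R²-bound ⟩
          M * t (suc k) * (γ * M * t k) ≡⟨ l₂ M (t (suc k)) γ (t k) ⟩
          γ * (M * M) * (t (suc k) * t k) ∎
          where
          open ≤-Reasoning
          l₁ : ∀ a b c → a * (b * c) ≡ b * (a * c)
          l₁ = solve-∀
          l₂ : ∀ M a g b → M * a * (g * M * b) ≡ g * (M * M) * (a * b)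
          l₂ = solve-∀

-- Closed walks and their conflicts

_◂_ : {A : Set} → A → (ℕ → A) → ℕ → A
(a ◂ p) zero    = a
(a ◂ p) (suc t) = p t

module Walks {N : ℕ} (w : Fin N → Fin N → ℕ) (w-sym : ∀ u v → w u v ≡ w v u) (m : Fin N → ℕ) where

  open Chain w w-sym m

  Walk : ℕ → (ℕ → Fin N) → Set
  Walk k p = ∀ s → s < k → w (p s) (p (suc s)) ≢ 0

  -- A walk p with k steps has weight Π w(p s, p (s+1)) m(p (s+1)); p is constant beyond its end.
  walkSum : ℕ → Fin N → ((ℕ → Fin N) → ℕ) → ℕ
  walkSum zero    a F = F (λ _ → a)
  walkSum (suc k) a F = ∑[ s < N ] (w a s * m s * walkSum k s (λ p → F (a ◂ p)))

  walkSum-isSum : ∀ k a → IsSum (walkSum k a)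
  walkSum-isSum zero    a = record { mono = λ h → h _ ; add = λ f g → refl ; scale = λ c f → refl }
  walkSum-isSum (suc k) a = record
    { mono  = λ h → ∑-mono λ s → *-monoʳ-≤ (w a s * m s) (mono (walkSum-isSum k s) λ p → h (a ◂ p))
    ; add   = λ f g → trans (∑-cong λ s → trans (cong (w a s * m s *_) (add (walkSum-isSum k s) _ _))
                                                (*-distribˡ-+ (w a s * m s) _ _)) (∑-distrib-+ _ _)
    ; scale = λ c f → trans (∑-cong λ s → trans (cong (w a s * m s *_) (scale (walkSum-isSum k s) c _))
                                                (lem (w a s * m s) c _)) (sym (∑-*ˡ c _))
    }
    where
    lem : ∀ x c y → x * (c * y) ≡ c * (x * y)
    lem = solve-∀

  -- A sequence with a step of weight w = 0 contributes nothing, so the comparison is needed on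
  -- genuine walks only.
  walkSum-mono : ∀ k a {F G : (ℕ → Fin N) → ℕ} →
    (∀ p → p 0 ≡ a → Walk k p → F p ≤ G p) → walkSum k a F ≤ walkSum k a G
  walkSum-mono zero    a h = h _ refl λ s ()
  walkSum-mono (suc k) a {F} {G} h = ∑-mono step
    where
    step : ∀ s → w a s * m s * walkSum k s (λ p → F (a ◂ p)) ≤ w a s * m s * walkSum k s (λ p → G (a ◂ p))
    step s with w a s in eq
    ... | zero  = z≤n
    ... | suc x = *-monoʳ-≤ (suc x * m s) (walkSum-mono k s λ p p0 wk → h (a ◂ p) refl (walk p p0 wk))
      where
      walk : ∀ p → p 0 ≡ s → Walk k p → Walk (suc k) (a ◂ p)
      walk p p0 wk zero    _         e with trans (trans (sym eq) (cong (w a) (sym p0))) e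
      ... | ()
      walk p p0 wk (suc r) (s≤s r<k) e = wk r r<k e

  walkSum-start : ∀ k a (F : Fin N → (ℕ → Fin N) → ℕ) →
    walkSum k a (λ p → F (p 0) p) ≡ walkSum k a (F a)
  walkSum-start zero    a F = refl
  walkSum-start (suc k) a F = refl

  walkSum-end : ∀ r a b → walkSum r a (λ p → δ (p r) b) ≡ pow r a b
  walkSum-end zero    a b = refl
  walkSum-end (suc r) a b = trans (∑-cong λ s → cong (w a s * m s *_) (walkSum-end r s b)) (sym (pow-suc r a b))

  pow-step : ∀ q a (X : Fin N → ℕ) →
    (∑[ s < N ] (w a s * m s * ∑[ z < N ] (pow q s z * X z))) ≡ ∑[ z < N ] (pow (suc q) a z * X z)
  pow-step q a X = begin
    ∑[ s < N ] (w a s * m s * ∑[ z < N ] (pow q s z * X z))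
      ≡⟨ ∑-cong (λ s → trans (∑-*ˡ (w a s * m s) _) (∑-cong λ z → sym (*-assoc (w a s * m s) _ _))) ⟩
    ∑[ s < N ] ∑[ z < N ] (w a s * m s * pow q s z * X z) ≡⟨ ∑-comm _ ⟩
    ∑[ z < N ] ∑[ s < N ] (w a s * m s * pow q s z * X z)
      ≡⟨ ∑-cong (λ z → trans (sym (∑-*ʳ _ (X z))) (cong (_* X z) (sym (pow-suc q a z)))) ⟩
    ∑[ z < N ] (pow (suc q) a z * X z) ∎
    where open ≡-Reasoning

  walkSum-mark₁ : ∀ q r a b (h : Fin N → ℕ) →
    walkSum (q + r) a (λ p → h (p q) * δ (p (q + r)) b) ≡ ∑[ z < N ] (pow q a z * (h z * pow r z b))
  walkSum-mark₁ zero r a b h = begin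
    walkSum r a (λ p → h (p 0) * δ (p r) b) ≡⟨ walkSum-start r a (λ x p → h x * δ (p r) b) ⟩
    walkSum r a (λ p → h a * δ (p r) b)     ≡⟨ scale (walkSum-isSum r a) (h a) _ ⟩
    h a * walkSum r a (λ p → δ (p r) b)     ≡⟨ cong (h a *_) (walkSum-end r a b) ⟩
    h a * pow r a b                         ≡⟨ sym (∑-δ a (λ z → h z * pow r z b)) ⟩
    ∑[ z < N ] (δ a z * (h z * pow r z b))  ∎
    where open ≡-Reasoning
  walkSum-mark₁ (suc q) r a b h =
    trans (∑-cong λ s → cong (w a s * m s *_) (walkSum-mark₁ q r s b h)) (pow-step q a _)

  walkSum-mark₂ : ∀ i q r a b (h : Fin N → Fin N → ℕ) →
    walkSum (i + (q + r)) a (λ p → h (p i) (p (i + q)) * δ (p (i + (q + r))) b)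
      ≡ ∑[ u < N ] (pow i a u * ∑[ z < N ] (pow q u z * (h u z * pow r z b)))
  walkSum-mark₂ zero q r a b h = begin
    walkSum (q + r) a (λ p → h (p 0) (p q) * δ (p (q + r)) b)
      ≡⟨ walkSum-start (q + r) a (λ x p → h x (p q) * δ (p (q + r)) b) ⟩
    walkSum (q + r) a (λ p → h a (p q) * δ (p (q + r)) b)
      ≡⟨ walkSum-mark₁ q r a b (h a) ⟩
    ∑[ z < N ] (pow q a z * (h a z * pow r z b)) ≡⟨ sym (∑-δ a (λ u → ∑[ z < N ] (pow q u z * (h u z * pow r z b)))) ⟩
    ∑[ u < N ] (δ a u * ∑[ z < N ] (pow q u z * (h u z * pow r z b))) ∎
    where open ≡-Reasoning
  walkSum-mark₂ (suc i) q r a b h =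
    trans (∑-cong λ s → cong (w a s * m s *_) (walkSum-mark₂ i q r s b h)) (pow-step i a _)

  -- Summing over the starting point a joins the last r steps to the first i. Only the lengths of
  -- the two arcs between the marked positions matter.
  closed-mark₂ : ∀ i q r (h : Fin N → Fin N → ℕ) →
    (∑[ a < N ] walkSum (i + (q + r)) a (λ p → h (p i) (p (i + q)) * δ (p (i + (q + r))) a))
      ≡ ∑[ u < N ] ∑[ z < N ] (h u z * (pow q u z * pow (r + i) z u))
  closed-mark₂ i q r h = begin
    ∑[ a < N ] walkSum (i + (q + r)) a (λ p → h (p i) (p (i + q)) * δ (p (i + (q + r))) a)
      ≡⟨ ∑-cong (λ a → walkSum-mark₂ i q r a a h) ⟩
    ∑[ a < N ] ∑[ u < N ] (pow i a u * ∑[ z < N ] (pow q u z * (h u z * pow r z a)))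
      ≡⟨ trans (∑-comm _) (∑∑-cong λ u a → ∑-*ˡ (pow i a u) _) ⟩
    ∑[ u < N ] ∑[ a < N ] ∑[ z < N ] (pow i a u * (pow q u z * (h u z * pow r z a)))
      ≡⟨ ∑-cong (λ u → ∑-comm _) ⟩
    ∑[ u < N ] ∑[ z < N ] ∑[ a < N ] (pow i a u * (pow q u z * (h u z * pow r z a)))
      ≡⟨ ∑∑-cong (λ u z → trans (∑-cong λ a → lem (pow i a u) (pow q u z) (h u z) (pow r z a))
           (trans (sym (∑-*ˡ (h u z * pow q u z) _))
             (trans (cong (h u z * pow q u z *_) (sym (pow-+ r i z u))) (*-assoc (h u z) _ _)))) ⟩
    ∑[ u < N ] ∑[ z < N ] (h u z * (pow q u z * pow (r + i) z u)) ∎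
    where
    open ≡-Reasoning
    lem : ∀ a b c d → a * (b * (c * d)) ≡ c * b * (d * a)
    lem = solve-∀

  closed-total : ∀ k → (∑[ a < N ] walkSum (suc k + suc k) a (λ p → δ (p (suc k + suc k)) a)) ≡ t k
  closed-total k = ∑-cong λ a → trans (walkSum-end (suc k + suc k) a a)
    (trans (pow-+ (suc k) (suc k) a a) (∑-cong λ v →
      trans (cong (λ x → V k a v * m v * (x * m a)) (V-sym k v a)) (lem (V k a v) (m v) (m a))))
    where
    lem : ∀ x a b → x * a * (x * b) ≡ b * a * (x * x)
    lem = solve-∀

-- The conflict inequality

^-distribʳ-* : ∀ k a b → (a * b) ^ k ≡ a ^ k * b ^ k
^-distribʳ-* zero    a b = refl
^-distribʳ-* (suc k) a b = trans (cong (a * b *_) (^-distribʳ-* k a b)) (lem a b (a ^ k) (b ^ k))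
  where
  lem : ∀ a b c d → a * b * (c * d) ≡ a * c * (b * d)
  lem = solve-∀

square-cancel : ∀ b x c → b * (x * x) ≤ c * x → b * x ≤ c
square-cancel b zero    c h = ≤-trans (≤-reflexive (*-zeroʳ b)) z≤n
square-cancel b (suc x) c h = *-cancelʳ-≤ (b * suc x) c (suc x) (≤-trans (≤-reflexive (*-assoc b _ _)) h)

-- By log-convexity the ratios of consecutive terms do not decrease, so the bound X/β on the last
-- one holds for all the earlier ones, and their product telescopes.
ratio-descent : ∀ (t : ℕ → ℕ) (convex : ∀ j → t (suc j) * t (suc j) ≤ t j * t (suc (suc j))) β X k →
  β * t (suc k) ≤ X * t k → β ^ suc k * t (suc k) ≤ X ^ suc k * t 0
ratio-descent t convex β X zero    h = subst₂ (λ b x → b * t 1 ≤ x * t 0) (sym (*-identityʳ β)) (sym (*-identityʳ X)) h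
ratio-descent t convex β X (suc k) h = begin
  β ^ suc (suc k) * t (suc (suc k))     ≡⟨ l₁ β (β ^ suc k) (t (suc (suc k))) ⟩
  β ^ suc k * (β * t (suc (suc k)))     ≤⟨ *-monoʳ-≤ (β ^ suc k) h ⟩
  β ^ suc k * (X * t (suc k))           ≡⟨ l₂ (β ^ suc k) X (t (suc k)) ⟩
  X * (β ^ suc k * t (suc k))           ≤⟨ *-monoʳ-≤ X (ratio-descent t convex β X k h′) ⟩
  X * (X ^ suc k * t 0)                 ≡⟨ sym (*-assoc X _ _) ⟩
  X ^ suc (suc k) * t 0                 ∎
  where
  open ≤-Reasoning
  l₁ : ∀ a b c → a * b * c ≡ b * (a * c)
  l₁ = solve-∀
  l₂ : ∀ a b c → a * (b * c) ≡ b * (a * c)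
  l₂ = solve-∀
  h′ : β * t (suc k) ≤ X * t k
  h′ = square-cancel β (t (suc k)) (X * t k) (begin
    β * (t (suc k) * t (suc k))     ≤⟨ *-monoʳ-≤ β (convex k) ⟩
    β * (t k * t (suc (suc k)))     ≡⟨ l₂ β (t k) _ ⟩
    t k * (β * t (suc (suc k)))     ≤⟨ *-monoʳ-≤ (t k) h ⟩
    t k * (X * t (suc k))           ≡⟨ trans (l₂ (t k) X (t (suc k))) (sym (*-assoc X _ _)) ⟩
    X * t k * t (suc k)             ∎)

module _ {N : ℕ} (w : Fin N → Fin N → ℕ) (w-sym : ∀ u v → w u v ≡ w v u) (m : Fin N → ℕ) where

  open Chain w w-sym m
  open Walks w w-sym m

  module _ (M : ℕ) (mD≡M : ∀ u → 0 < D u → m u * D u ≡ M) (m≡0 : ∀ u → D u ≡ 0 → m u ≡ 0)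
           (conf : Fin N → Fin N → ℕ) (conf≤1 : ∀ u z → conf u z ≤ 1) (β γ : ℕ)
           (sparse : ∀ u y → β * (m y * ∑[ z < N ] (w y z * conf u z)) ≤ γ * M) (k : ℕ) where

    open Stationary M mD≡M m≡0
    open Conflict conf conf≤1 β γ sparse

    private
      K = suc (suc k) + suc (suc k)
      Q = γ * (M * M) * (t (suc k) * t k)

      C-bound-≤ : ∀ q b → suc q + b ≡ K → suc q ≤ suc (suc k) → β * (C (suc q) b * C (suc q) b) ≤ Q
      C-bound-≤ q b e (s≤s q≤) with m≤n⇒∃[o]m+o≡n q≤
      ... | r , q+r = subst (λ x → β * (C (suc q) x * C (suc q) x) ≤ Q) (sym b≡) (C-bound k q r (trans (+-comm r q) q+r))
        where
        lem : ∀ q r → suc (q + r) + suc (q + r) ≡ suc q + (suc (q + r) + r)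
        lem = solve-∀
        b≡ : b ≡ suc (suc k) + r
        b≡ = +-cancelˡ-≡ (suc q) b _ (trans e (subst (λ x → suc x + suc x ≡ suc q + (suc x + r)) q+r (lem q r)))

      -- `C-bound` requires the first arc to have at most k + 2 of the 2k + 4 steps; otherwise the
      -- walk is reversed, which exchanges the arcs.
      C-bound-+ : ∀ a b → a + b ≡ K → 0 < a → 0 < b → β * (C a b * C a b) ≤ Q
      C-bound-+ (suc a) (suc b) e _ _ with ≤-total (suc a) (suc (suc k))
      ... | inj₁ a≤ = C-bound-≤ a (suc b) e a≤
      ... | inj₂ a≥ = subst (λ x → β * (x * x) ≤ Q) (C-sym b a) (C-bound-≤ b (suc a) (trans (+-comm (suc b) (suc a)) e)
                        (+-cancelˡ-≤ (suc (suc k)) (suc b) (suc (suc k)) (≤-trans (+-monoˡ-≤ (suc b) a≥) (≤-reflexive e))))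

      G : ℕ → ℕ → ℕ
      G i j = ∑[ a < N ] walkSum K a (λ p → conf (p i) (p j) * δ (p K) a)

      -- Both orders of the two positions are treated because `conf` is not assumed symmetric; in
      -- the second, u and z exchange their roles.
      G-bound-< : ∀ i q r → i + (suc q + suc r) ≡ K → β * (G i (i + suc q) * G i (i + suc q)) ≤ Q
                × β * (G (i + suc q) i * G (i + suc q) i) ≤ Q
      G-bound-< i q r e = subst (λ x → β * (x * x) ≤ Q) (sym fwd) (C-bound-+ (suc q) (suc r + i) e′ (s≤s z≤n) (s≤s z≤n))
                        , subst (λ x → β * (x * x) ≤ Q) (sym bwd)
                            (C-bound-+ (suc r + i) (suc q) (trans (+-comm (suc r + i) (suc q)) e′) (s≤s z≤n) (s≤s z≤n))
        where
        open ≡-Reasoning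
        e′ : suc q + (suc r + i) ≡ K
        e′ = trans (trans (sym (+-assoc (suc q) (suc r) i)) (+-comm (suc q + suc r) i)) e
        fwd : G i (i + suc q) ≡ C (suc q) (suc r + i)
        fwd = subst (λ x → (∑[ a < N ] walkSum x a (λ p → conf (p i) (p (i + suc q)) * δ (p x) a)) ≡ C (suc q) (suc r + i))
                    e (closed-mark₂ i (suc q) (suc r) conf)
        bwd : G (i + suc q) i ≡ C (suc r + i) (suc q)
        bwd = trans (subst (λ x → (∑[ a < N ] walkSum x a (λ p → conf (p (i + suc q)) (p i) * δ (p x) a))
                                    ≡ ∑[ u < N ] ∑[ z < N ] (conf z u * (pow (suc q) u z * pow (suc r + i) z u)))
                           e (closed-mark₂ i (suc q) (suc r) (λ u z → conf z u)))
                    (trans (∑-comm _) (∑∑-cong λ u z → cong (conf u z *_) (*-comm (pow (suc q) z u) (pow (suc r + i) u z))))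

      split : ∀ {i j} → i < j → j < K → ∃[ q ] ∃[ r ] (i + suc q ≡ j × i + (suc q + suc r) ≡ K)
      split {i} {j} i<j j<K with m≤n⇒∃[o]m+o≡n i<j | m≤n⇒∃[o]m+o≡n j<K
      ... | q , e₁ | r , e₂ = q , r , trans (+-suc i q) e₁ , (begin
        i + (suc q + suc r) ≡⟨ sym (+-assoc i (suc q) (suc r)) ⟩
        i + suc q + suc r   ≡⟨ cong (_+ suc r) (trans (+-suc i q) e₁) ⟩
        j + suc r           ≡⟨ +-suc j r ⟩
        suc j + r           ≡⟨ e₂ ⟩
        K                   ∎)
        where open ≡-Reasoning

      G-bound : ∀ i j → i < K → j < K → i ≢ j → β * (G i j * G i j) ≤ Q
      G-bound i j i<K j<K i≢j with <-cmp i j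
      ... | tri≈ _ e _ = ⊥-elim (i≢j e)
      ... | tri< i<j _ _ with split i<j j<K
      ...   | q , r , refl , e = proj₁ (G-bound-< i q r e)
      G-bound i j i<K j<K i≢j | tri> _ _ j<i with split j<i i<K
      ...   | q , r , refl , e = proj₂ (G-bound-< j q r e)

      off : Fin K → Fin K → ℕ
      off i j = 1 ∸ δ i j

      G′ : Fin K → Fin K → ℕ
      G′ i j = off i j * G (toℕ i) (toℕ j)

      G′-bound : ∀ i j → β * (G′ i j * G′ i j) ≤ Q
      G′-bound i j with i ≟ j
      ... | yes refl rewrite δ-refl i = ≤-trans (≤-reflexive (*-zeroʳ β)) z≤n
      ... | no  i≢j  rewrite ≢⇒δ≡0 i j i≢j | *-identityˡ (G (toℕ i) (toℕ j)) =
        G-bound (toℕ i) (toℕ j) (toℕ<n i) (toℕ<n j) (i≢j ∘ toℕ-injective)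

      -- In place of adding square roots, Cauchy-Schwarz over the K² pairs of positions costs one
      -- factor K², and adding up the K² bounds costs another.
      ∑G-bound : β * ((∑[ i < K ] ∑[ j < K ] G′ i j) * (∑[ i < K ] ∑[ j < K ] G′ i j)) ≤ K * K * (K * K) * Q
      ∑G-bound = begin
        β * ((∑[ i < K ] ∑[ j < K ] G′ i j) * (∑[ i < K ] ∑[ j < K ] G′ i j))
          ≡⟨ cong (λ x → β * (x * x)) (∑∑-cong λ i j → l₁ (G′ i j)) ⟩
        β * ((∑[ i < K ] ∑[ j < K ] (1 * (1 * G′ i j))) * (∑[ i < K ] ∑[ j < K ] (1 * (1 * G′ i j))))
          ≤⟨ *-monoʳ-≤ β (cauchySchwarz (∑-isSum ⊗ ∑-isSum) (λ _ → 1) (λ _ → 1) (λ { (i , j) → G′ i j })) ⟩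
        β * ((∑[ i < K ] ∑[ j < K ] 1) * (∑[ i < K ] ∑[ j < K ] (1 * (G′ i j * G′ i j))))
          ≡⟨ cong₂ (λ x y → β * (x * y)) (trans (∑-cong λ i → ∑-const K 1) (∑-const K (K * 1))) (∑∑-cong λ i j → *-identityˡ _) ⟩
        β * (K * (K * 1) * (∑[ i < K ] ∑[ j < K ] (G′ i j * G′ i j)))
          ≡⟨ l₂ β K _ ⟩
        K * K * (β * (∑[ i < K ] ∑[ j < K ] (G′ i j * G′ i j)))
          ≡⟨ cong (K * K *_) (trans (∑-*ˡ β _) (∑-cong λ i → ∑-*ˡ β _)) ⟩
        K * K * (∑[ i < K ] ∑[ j < K ] (β * (G′ i j * G′ i j)))
          ≤⟨ *-monoʳ-≤ (K * K) (∑∑-mono G′-bound) ⟩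
        K * K * (∑[ i < K ] ∑[ j < K ] Q)
          ≡⟨ cong (K * K *_) (trans (∑-cong λ i → ∑-const K Q) (∑-const K (K * Q))) ⟩
        K * K * (K * (K * Q)) ≡⟨ l₃ K Q ⟩
        K * K * (K * K) * Q ∎
        where
        open ≤-Reasoning
        l₁ : ∀ x → x ≡ 1 * (1 * x)
        l₁ = solve-∀
        l₂ : ∀ b K x → b * (K * (K * 1) * x) ≡ K * K * (b * x)
        l₂ = solve-∀
        l₃ : ∀ K Q → K * K * (K * (K * Q)) ≡ K * K * (K * K) * Q
        l₃ = solve-∀

    ConflictFree : (ℕ → Fin N) → Set
    ConflictFree p = ∀ i j → i < K → j < K → i ≢ j → conf (p i) (p j) ≡ 0

    module _ (unavoidable : ∀ p → Walk K p → p K ≡ p 0 → ¬ ConflictFree p) where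

      private
        S : (ℕ → Fin N) → ℕ
        S p = ∑[ i < K ] ∑[ j < K ] (off i j * conf (p (toℕ i)) (p (toℕ j)))

        S≡0⇒free : ∀ p → S p ≡ 0 → ConflictFree p
        S≡0⇒free p e i j i<K j<K i≢j = begin
          conf (p i) (p j) ≡⟨ cong₂ (λ x y → conf (p x) (p y)) (sym (toℕ-fromℕ< i<K)) (sym (toℕ-fromℕ< j<K)) ⟩
          conf (p (toℕ i′)) (p (toℕ j′)) ≡⟨ sym (*-identityˡ _) ⟩
          1 * conf (p (toℕ i′)) (p (toℕ j′)) ≡⟨ cong (λ x → (1 ∸ x) * conf (p (toℕ i′)) (p (toℕ j′))) (sym (≢⇒δ≡0 i′ j′ ne)) ⟩
          off i′ j′ * conf (p (toℕ i′)) (p (toℕ j′)) ≡⟨ ∑≡0⇒≡0 _ (∑≡0⇒≡0 _ e i′) j′ ⟩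
          0 ∎
          where
          open ≡-Reasoning
          i′ = fromℕ< i<K
          j′ = fromℕ< j<K
          ne : i′ ≢ j′
          ne q = i≢j (trans (sym (toℕ-fromℕ< i<K)) (trans (cong toℕ q) (toℕ-fromℕ< j<K)))

        pointwise : ∀ a p → p 0 ≡ a → Walk K p → δ (p K) a ≤ S p * δ (p K) a
        pointwise a p refl wk with p K ≟ p 0 | S p in eq
        ... | no  ne | s     = subst (λ x → x ≤ s * x) (sym (≢⇒δ≡0 (p K) (p 0) ne)) z≤n
        ... | yes e  | zero  = ⊥-elim (unavoidable p wk e (S≡0⇒free p eq))
        ... | yes e  | suc s = m≤m+n _ _

        -- Union bound: conflicts being unavoidable, `S` is at least 1 on every closed walk, and
        -- interchanging sums splits it by pairs of positions.
        t≤∑G : t (suc k) ≤ ∑[ i < K ] ∑[ j < K ] G′ i j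
        t≤∑G = begin
          t (suc k) ≡⟨ sym (closed-total (suc k)) ⟩
          ∑[ a < N ] walkSum K a (λ p → δ (p K) a) ≤⟨ ∑-mono (λ a → walkSum-mono K a (pointwise a)) ⟩
          ∑[ a < N ] walkSum K a (λ p → S p * δ (p K) a)
            ≡⟨ ∑-cong (λ a → cong-σ (walkSum-isSum K a) (expand a)) ⟩
          T (λ { (a , p) → ∑[ i < K ] ∑[ j < K ] (off i j * (conf (p (toℕ i)) (p (toℕ j)) * δ (p K) a)) })
            ≡⟨ swap-∑ T-isSum (λ { (a , p) i → ∑[ j < K ] (off i j * (conf (p (toℕ i)) (p (toℕ j)) * δ (p K) a)) }) ⟩
          ∑[ i < K ] T (λ { (a , p) → ∑[ j < K ] (off i j * (conf (p (toℕ i)) (p (toℕ j)) * δ (p K) a)) })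
            ≡⟨ ∑-cong (λ i → trans (swap-∑ T-isSum (λ { (a , p) j → off i j * (conf (p (toℕ i)) (p (toℕ j)) * δ (p K) a) }))
                 (∑-cong λ j → scale T-isSum (off i j) (λ { (a , p) → conf (p (toℕ i)) (p (toℕ j)) * δ (p K) a }))) ⟩
          ∑[ i < K ] ∑[ j < K ] G′ i j ∎
          where
          open ≤-Reasoning
          T : (Fin N × (ℕ → Fin N) → ℕ) → ℕ
          T F = ∑[ a < N ] walkSum K a (λ p → F (a , p))
          T-isSum : IsSum T
          T-isSum = Σ-isSum ∑-isSum (walkSum-isSum K)
          expand : ∀ a p → S p * δ (p K) a ≡ ∑[ i < K ] ∑[ j < K ] (off i j * (conf (p (toℕ i)) (p (toℕ j)) * δ (p K) a))
          expand a p = trans (∑-*ʳ _ (δ (p K) a)) (∑-cong λ i → trans (∑-*ʳ _ (δ (p K) a)) (∑-cong λ j → *-assoc (off i j) _ _))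

        κ = K * K * (K * K) * γ

        -- `Q` contains `t (suc k)` once, the square on the left twice. Cancelling turns the bound
        -- on a square into a bound on a ratio.
        ratio : β * t (suc k) ≤ κ * (M * M) * t k
        ratio = square-cancel β (t (suc k)) (κ * (M * M) * t k) (begin
          β * (t (suc k) * t (suc k)) ≤⟨ *-monoʳ-≤ β (*-mono-≤ t≤∑G t≤∑G) ⟩
          _ ≤⟨ ∑G-bound ⟩
          K * K * (K * K) * Q ≡⟨ lem (K * K * (K * K)) γ (M * M) (t (suc k)) (t k) ⟩
          κ * (M * M) * t k * t (suc k) ∎)
          where
          open ≤-Reasoning
          lem : ∀ a b c d e → a * (b * c * (d * e)) ≡ a * b * c * e * d
          lem = solve-∀

      -- The k + 1 ratios carry the factor M^(2k+2), while `t-lower` gives M^(2k+4); so M² survives.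
      conflict-inequality : 0 < M → 0 < ∑[ u < N ] D u → β ^ suc k * (M * M) ≤ (K * K * (K * K) * γ) ^ suc k * t 0
      conflict-inequality M>0 D>0 = *-cancelʳ-≤ _ _ (Mk * Mk) {{>-nonZero (*-mono-< Mk>0 Mk>0)}} (begin
        β ^ suc k * (M * M) * (Mk * Mk) ≡⟨ l₁ (β ^ suc k) M Mk ⟩
        β ^ suc k * (M ^ suc (suc k) * M ^ suc (suc k)) ≤⟨ *-monoʳ-≤ (β ^ suc k) (t-lower M>0 D>0 (suc k)) ⟩
        β ^ suc k * t (suc k) ≤⟨ ratio-descent t t-logConvex β (κ * (M * M)) k ratio ⟩
        (κ * (M * M)) ^ suc k * t 0 ≡⟨ cong (_* t 0) (trans (^-distribʳ-* (suc k) κ (M * M)) (cong (κ ^ suc k *_) (^-distribʳ-* (suc k) M M))) ⟩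
        κ ^ suc k * (Mk * Mk) * t 0 ≡⟨ l₂ (κ ^ suc k) (Mk * Mk) (t 0) ⟩
        κ ^ suc k * t 0 * (Mk * Mk) ∎)
        where
        open ≤-Reasoning
        Mk = M ^ suc k
        Mk>0 : 0 < Mk
        Mk>0 = m^n>0 M {{>-nonZero M>0}} (suc k)
        l₁ : ∀ a b c → a * (b * b) * (c * c) ≡ a * (b * c * (b * c))
        l₁ = solve-∀
        l₂ : ∀ a b c → a * b * c ≡ a * c * b
        l₂ = solve-∀

-- Pruning and normalisation

≤1⇒0∨1 : ∀ {x} → x ≤ 1 → x ≡ 0 ⊎ x ≡ 1
≤1⇒0∨1 z≤n       = inj₁ refl
≤1⇒0∨1 (s≤s z≤n) = inj₂ refl

module _ {N : ℕ} (w : Fin N → Fin N → ℕ) (w-sym : ∀ u v → w u v ≡ w v u) (θ : Fin N → ℕ) where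

  Rich : (Fin N → ℕ) → Set
  Rich χ = (∀ u → χ u ≤ 1) × (∀ u → χ u ≡ 1 → θ u ≤ ∑[ v < N ] (χ v * w u v))
         × 0 < ∑[ u < N ] (χ u * ∑[ v < N ] (χ v * w u v))

  private
    deg : (Fin N → ℕ) → Fin N → ℕ
    deg χ u = ∑[ v < N ] (χ v * w u v)

    E T : (Fin N → ℕ) → ℕ
    E χ = ∑[ u < N ] (χ u * deg χ u)
    T χ = ∑[ u < N ] (χ u * θ u)

    ∑-remove : ∀ {χ χ′ : Fin N → ℕ} u → (∀ v → χ v ≡ χ′ v + δ u v) → ∀ f →
      (∑[ v < N ] (χ v * f v)) ≡ ∑[ v < N ] (χ′ v * f v) + f u
    ∑-remove {χ} {χ′} u e f = trans (∑-cong λ v → trans (cong (_* f v) (e v)) (*-distribʳ-+ (f v) (χ′ v) (δ u v)))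
      (trans (∑-distrib-+ _ _) (cong ((∑[ v < N ] (χ′ v * f v)) +_) (∑-δ u f)))

    E-remove : ∀ {χ χ′ : Fin N → ℕ} u → (∀ v → χ v ≡ χ′ v + δ u v) → E χ ≤ E χ′ + 2 * deg χ u
    E-remove {χ} {χ′} u e = begin
      E χ ≡⟨ ∑-remove u e (deg χ) ⟩
      ∑[ v < N ] (χ′ v * deg χ v) + deg χ u
        ≡⟨ cong (_+ deg χ u) (trans (∑-cong λ v → trans (cong (χ′ v *_) (∑-remove u e (w v))) (*-distribˡ-+ (χ′ v) _ _)) (∑-distrib-+ _ _)) ⟩
      E χ′ + ∑[ v < N ] (χ′ v * w v u) + deg χ u
        ≤⟨ +-monoˡ-≤ (deg χ u) (+-monoʳ-≤ (E χ′) (∑-mono λ v →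
             *-mono-≤ (≤-trans (m≤m+n (χ′ v) (δ u v)) (≤-reflexive (sym (e v)))) (≤-reflexive (w-sym v u)))) ⟩
      E χ′ + deg χ u + deg χ u ≡⟨ lem (E χ′) (deg χ u) ⟩
      E χ′ + 2 * deg χ u ∎
      where
      open ≤-Reasoning
      lem : ∀ a b → a + b + b ≡ a + 2 * b
      lem = solve-∀

    remove : Fin N → (Fin N → ℕ) → Fin N → ℕ
    remove u χ v = χ v ∸ δ u v

    remove-+ : ∀ u χ → χ u ≡ 1 → ∀ v → χ v ≡ remove u χ v + δ u v
    remove-+ u χ e v with u ≟ v
    ... | yes refl rewrite δ-refl u | e = refl
    ... | no  ne   rewrite ≢⇒δ≡0 u v ne = sym (+-identityʳ _)

    -- Removing u lowers `E` by at most twice its degree, hence by at most 2 θ u, which is just what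
    -- 2 `T` loses. The strict inequality thus persists, and when no vertex can be removed `E` is
    -- still positive. The fuel bounds the number of vertices left.
    prune-from : ∀ fuel χ → ∑ N χ ≤ fuel → (∀ u → χ u ≤ 1) → 2 * T χ < E χ → ∃[ χ′ ] Rich χ′
    prune-from fuel χ size χ≤1 big with any? (λ u → (χ u Data.Nat.≟ 1) ×-dec (deg χ u <? θ u))
    ... | no  none = χ , χ≤1 , (λ u e → ≮⇒≥ λ lt → none (u , e , lt)) , ≤-trans (s≤s z≤n) big
    prune-from zero χ size χ≤1 big | yes (u , e , lt) =
      ⊥-elim (1+n≰n (≤-trans (≤-reflexive (sym e)) (≤-trans (∑-≤-term χ u) size)))
    prune-from (suc fuel) χ size χ≤1 big | yes (u , e , lt) =
      prune-from fuel χ′ size′ (λ v → ≤-trans (m∸n≤m (χ v) (δ u v)) (χ≤1 v)) big′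
      where
      χ′ = remove u χ
      split : ∀ v → χ v ≡ χ′ v + δ u v
      split = remove-+ u χ e
      ∑χ : ∑ N χ ≡ suc (∑ N χ′)
      ∑χ = trans (∑-cong λ v → sym (*-identityʳ (χ v))) (trans (∑-remove u split (λ _ → 1))
             (trans (+-comm _ 1) (cong suc (∑-cong λ v → *-identityʳ (χ′ v)))))
      size′ : ∑ N χ′ ≤ fuel
      size′ = s≤s⁻¹ (subst (_≤ suc fuel) ∑χ size)
      big′ : 2 * T χ′ < E χ′
      big′ = +-cancelʳ-< (2 * θ u) (2 * T χ′) (E χ′) (begin-strict
        2 * T χ′ + 2 * θ u   ≡⟨ sym (*-distribˡ-+ 2 (T χ′) (θ u)) ⟩
        2 * (T χ′ + θ u)     ≡⟨ cong (2 *_) (sym (∑-remove u split θ)) ⟩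
        2 * T χ              <⟨ big ⟩
        E χ                  ≤⟨ E-remove u split ⟩
        E χ′ + 2 * deg χ u   ≤⟨ +-monoʳ-≤ (E χ′) (*-monoʳ-≤ 2 (<⇒≤ lt)) ⟩
        E χ′ + 2 * θ u       ∎)
        where open ≤-Reasoning

  opaque
    prune : 2 * ∑ N θ < ∑[ u < N ] ∑[ v < N ] w u v → ∃[ χ ] Rich χ
    prune big = prune-from N (λ _ → 1) (≤-reflexive (trans (∑-const N 1) (*-identityʳ N))) (λ _ → ≤-refl)
      (subst₂ _<_ (cong (2 *_) (∑-cong λ u → sym (*-identityˡ (θ u))))
        (∑-cong λ u → trans (∑-cong λ v → sym (*-identityˡ (w u v))) (sym (*-identityˡ _))) big)

-- Natural numbers proportional to the inverses of the positive values of D.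
opaque
  reciprocals : ∀ {N} (D : Fin N → ℕ) → Σ[ M ∈ ℕ ] Σ[ m ∈ (Fin N → ℕ) ] 0 < M
              × (∀ u → 0 < D u → m u * D u ≡ M) × (∀ u → D u ≡ 0 → m u ≡ 0)
  -- Each positive value of D is at most the sum of all values, so it divides the factorial of that
  -- sum.
  reciprocals {N} D = ∑ N D ! , (λ u → inv (D u) (∑-≤-term D u)) , M>0 , (λ u → inv-pos (D u) _) , (λ u → inv-zero (D u) _)
    where
    B : ℕ
    B = ∑ N D
    M>0 : 0 < B !
    M>0 = 1≤n! B
    dvd : ∀ d → suc d ≤ B → suc d ∣ B !
    dvd d le = ∣-trans (m∣m*n (d !)) (m≤n⇒m!∣n! le)
    inv : ∀ d → d ≤ B → ℕ
    inv zero    _  = 0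
    inv (suc d) le = _∣_.quotient (dvd d le)
    inv-pos : ∀ d le → 0 < d → inv d le * d ≡ B !
    inv-pos (suc d) le _ = sym (_∣_.equality (dvd d le))
    inv-zero : ∀ d le → d ≡ 0 → inv d le ≡ 0
    inv-zero zero le _ = refl

-- Prisms as closed walks of edges

opposite : Fin 2 → Fin 2
opposite zero       = suc zero
opposite (suc zero) = zero

opposite-involutive : ∀ s → opposite (opposite s) ≡ s
opposite-involutive zero       = refl
opposite-involutive (suc zero) = refl

-- Steps join X to Y crosswise, so the side of a prism that starts at end s of the first edge is at
-- end `turn i s` of the i-th.
turn : ℕ → Fin 2 → Fin 2
turn zero    s = s
turn (suc i) s = opposite (turn i s)

turn-opposite : ∀ i → turn i (suc zero) ≡ opposite (turn i zero)
turn-opposite zero    = refl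
turn-opposite (suc i) = cong opposite (turn-opposite i)

turn-injective : ∀ i {s t} → turn i s ≡ turn i t → s ≡ t
turn-injective zero    e = e
turn-injective (suc i) {s} {t} e = turn-injective i
  (trans (sym (opposite-involutive (turn i s))) (trans (cong opposite e) (opposite-involutive (turn i t))))

turn-double : ∀ i s → turn (i + i) s ≡ s
turn-double zero    s = refl
turn-double (suc i) s = trans (cong (λ j → opposite (turn j s)) (+-suc i i))
  (trans (opposite-involutive (turn (i + i) s)) (turn-double i s))

⊓1≡0⇒≡0 : ∀ x → x ⊓ 1 ≡ 0 → x ≡ 0
⊓1≡0⇒≡0 zero _ = refl

-- This is 2ℓ for ℓ = k + 2, in a form that agrees by computation with the number of positions in
-- `Glued (suc (suc k))`.
prismLength : ℕ → ℕ
prismLength k = suc (suc k) + suc (suc k)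

opaque
  -- The square of the number of pairs of positions on a walk, times the number of vertices of a prism.
  κ : ℕ → ℕ
  κ k = prismLength k * prismLength k * (prismLength k * prismLength k) * (prismLength k * 2)

  κ-def : ∀ k → κ k ≡ prismLength k * prismLength k * (prismLength k * prismLength k) * (prismLength k * 2)
  κ-def k = refl

  κ>0 : ∀ k → 0 < κ k
  κ>0 k = s≤s z≤n

module Host {n : ℕ} (G : Graph n) (k : ℕ) where

  K = prismLength k

  -- Edges are walked on as ordered pairs of vertices. Pairs that are not edges remain as states but
  -- get weight 0 in both applications.
  State = Fin (n * n)

  X Y : State → Fin n
  X u = quotient {n} n u
  Y u = remainder {n} n u

  pick : Fin 2 → State → Fin n
  pick zero       = X
  pick (suc zero) = Y

  Adj : Fin n → Fin n → Set
  Adj x y = adj G x y ≡ true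

  Adj-sym : ∀ {x y} → Adj x y → Adj y x
  Adj-sym {x} {y} a = trans (adj-sym G y x) a

  Adj-irrefl : ∀ {x y} → Adj x y → x ≢ y
  Adj-irrefl {x} a refl with trans (sym a) (irrefl G x)
  ... | ()

  -- Consecutive edges of a walk are joined crosswise, X u to Y v and X v to Y u, so that X and Y may
  -- range over different vertex classes.
  Step : State → State → Set
  Step u v = Adj (X u) (Y u) × Adj (X u) (Y v) × Adj (X v) (Y u)

  step-edge : ∀ {u v} → Step u v → ∀ s → Adj (pick s u) (pick (opposite s) v)
  step-edge (_ , a , b) zero       = a
  step-edge (_ , a , b) (suc zero) = Adj-sym b

  state-edge : ∀ {u} → Adj (X u) (Y u) → ∀ s → Adj (pick s u) (pick (opposite s) u)
  state-edge a zero       = a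
  state-edge a (suc zero) = Adj-sym a

  pick-injective : ∀ {u} → Adj (X u) (Y u) → ∀ s t → pick s u ≡ pick t u → s ≡ t
  pick-injective a zero       zero       e = refl
  pick-injective a zero       (suc zero) e = ⊥-elim (Adj-irrefl a e)
  pick-injective a (suc zero) zero       e = ⊥-elim (Adj-irrefl a (sym e))
  pick-injective a (suc zero) (suc zero) e = refl

  record PrismAt (u : State) : Set where
    field
      vertex    : Fin K → Fin 2 → Fin n
      root      : ∀ s → vertex zero s ≡ pick s u
      edge      : ∀ a b → PrismEdge K a b → Adj (vertex (proj₁ a) (proj₂ a)) (vertex (proj₁ b) (proj₂ b))
      injective : ∀ i s j t → vertex i s ≡ vertex j t → i ≡ j × s ≡ t
  open PrismAt

  -- If there is no prism at u, its ends are repeated at every position. In either case the ends of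
  -- u are among the values, so avoiding them all includes being disjoint from u.
  forbidden : ∀ {u} → Dec (PrismAt u) → Fin K → Fin 2 → Fin n
  forbidden     (yes P) i s = vertex P i s
  forbidden {u} (no  _) i s = pick s u

  forbidden-root : ∀ {u} (d : Dec (PrismAt u)) s → forbidden d zero s ≡ pick s u
  forbidden-root (yes P) s = root P s
  forbidden-root (no  _) s = refl

  -- If a prism P was fixed at u, then Q meets it in the root edge only, and the two form the glued
  -- graph. If none was fixed, Q contradicts that.
  glue : ∀ {u} (d : Dec (PrismAt u)) (Q : PrismAt u) →
         (∀ i s j t → vertex Q (suc i) s ≢ forbidden d j t) → Contains G (Glued (suc (suc k)))
  glue (no ¬P) Q _        = ⊥-elim (¬P Q)
  glue (yes P) Q disjoint = embed , (λ {x} {y} → embed-injective x y) , embed-edge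
    where
    R : Bool → Fin K → Fin 2 → Fin n
    R false = vertex P
    R true  = vertex Q
    embed : GV (suc (k + suc (suc k))) → Fin n
    embed (shared s)    = vertex P zero s
    embed (other c j s) = R c (suc j) s
    embed-lift : ∀ c a → embed (lift c a) ≡ R c (proj₁ a) (proj₂ a)
    embed-lift false (zero  , s) = refl
    embed-lift true  (zero  , s) = trans (root P s) (sym (root Q s))
    embed-lift c     (suc j , s) = refl
    R-edge : ∀ c a b → PrismEdge K a b → Adj (R c (proj₁ a) (proj₂ a)) (R c (proj₁ b) (proj₂ b))
    R-edge false = edge P
    R-edge true  = edge Q
    embed-edge : ∀ x y → GluedEdge (suc (k + suc (suc k))) x y → Adj (embed x) (embed y)
    embed-edge x y (c , a , b , e , refl , refl) = subst₂ Adj (sym (embed-lift c a)) (sym (embed-lift c b)) (R-edge c a b e)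
    embed-injective : ∀ x y → embed x ≡ embed y → x ≡ y
    embed-injective (shared s) (shared t) e = cong shared (proj₂ (injective P zero s zero t e))
    embed-injective (shared s) (other false j t) e with injective P zero s (suc j) t e
    ... | () , _
    embed-injective (shared s) (other true j t) e = ⊥-elim (disjoint j t zero s (sym e))
    embed-injective (other false i s) (shared t) e with injective P (suc i) s zero t e
    ... | () , _
    embed-injective (other true i s) (shared t) e = ⊥-elim (disjoint i s zero t e)
    embed-injective (other false i s) (other false j t) e with injective P (suc i) s (suc j) t e
    ... | refl , refl = refl
    embed-injective (other true i s) (other true j t) e with injective Q (suc i) s (suc j) t e
    ... | refl , refl = refl
    embed-injective (other false i s) (other true j t) e = ⊥-elim (disjoint j t (suc i) s (sym e))
    embed-injective (other true i s) (other false j t) e = ⊥-elim (disjoint i s (suc j) t e)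

  -- Each side of the prism alternates between X and Y, and closes up because the length is even.
  walkPrism : (p : ℕ → State) → (∀ s → s < K → Step (p s) (p (suc s))) → p K ≡ p 0 →
              (∀ i j → i < K → j < K → i ≢ j → ∀ s t → pick s (p i) ≢ pick t (p j)) → PrismAt (p 0)
  walkPrism p step closed disjoint = record
    { vertex    = λ i s → vtx (toℕ i) s
    ; root      = λ s → refl
    ; edge      = λ { (i , s) (j , t) → edge′ i s j t }
    ; injective = inj
    }
    where
    vtx : ℕ → Fin 2 → Fin n
    vtx i s = pick (turn i s) (p i)
    edge′ : ∀ i s j t → PrismEdge K (i , s) (j , t) → Adj (vtx (toℕ i) s) (vtx (toℕ j) t)
    edge′ i s j t (inj₁ (refl , inj₁ e)) = subst (λ x → Adj (vtx (toℕ i) s) (vtx x s)) e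
      (step-edge (step (toℕ i) (toℕ<n i)) (turn (toℕ i) s))
    edge′ i s j t (inj₁ (refl , inj₂ (e , j0))) = subst (Adj (vtx (toℕ i) s)) last
      (step-edge (step (toℕ i) (toℕ<n i)) (turn (toℕ i) s))
      where
      last : vtx (suc (toℕ i)) s ≡ vtx (toℕ j) s
      last = trans (cong (λ x → vtx x s) e) (trans (cong₂ pick (turn-double (suc (suc k)) s) closed)
               (cong (λ x → vtx x s) (sym j0)))
    edge′ i zero       j (suc zero) (inj₂ (refl , _ , _)) = subst (λ x → Adj (vtx (toℕ i) zero) (pick x (p (toℕ i))))
      (sym (turn-opposite (toℕ i))) (state-edge (proj₁ (step (toℕ i) (toℕ<n i))) (turn (toℕ i) zero))
    edge′ i zero       j zero       (inj₂ (_ , _ , ()))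
    edge′ i (suc zero) j t          (inj₂ (_ , () , _))
    inj : ∀ i s j t → vtx (toℕ i) s ≡ vtx (toℕ j) t → i ≡ j × s ≡ t
    inj i s j t e with i ≟ j
    ... | yes refl = refl , turn-injective (toℕ i) (pick-injective (proj₁ (step (toℕ i) (toℕ<n i))) _ _ e)
    ... | no  i≢j  = ⊥-elim (disjoint (toℕ i) (toℕ j) (toℕ<n i) (toℕ<n j) (i≢j ∘ toℕ-injective) (turn (toℕ i) s) (turn (toℕ j) t) e)

  -- `prism?` serves two purposes: it tells whether an edge lies in a prism, and it fixes one if so.
  module _ (free : Free G (Glued (suc (suc k)))) (prism? : ∀ u → Dec (PrismAt u)) where

    Z : State → Fin K → Fin 2 → Fin n
    Z u = forbidden (prism? u)

    meets : Fin n → State → ℕ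
    meets a v = δ a (X v) + δ a (Y v)

    -- The incidences counted by `hit` are linear, which suits the union bound in `sparse`; the cap
    -- at 1 allows a conflict to be forgotten in the trace estimate.
    hit conf : State → State → ℕ
    hit u v = ∑[ i < K ] ∑[ s < 2 ] meets (Z u i s) v
    conf u v = hit u v ⊓ 1

    conf≡0⇒avoids : ∀ {u v} → conf u v ≡ 0 → ∀ i s t → Z u i s ≢ pick t v
    conf≡0⇒avoids {u} {v} e i s t = avoid t
      where
      none : meets (Z u i s) v ≡ 0
      none = ∑≡0⇒≡0 _ (∑≡0⇒≡0 _ (⊓1≡0⇒≡0 (hit u v) e) i) s
      avoid : ∀ t → Z u i s ≢ pick t v
      avoid zero       = δ≡0⇒≢ (m+n≡0⇒m≡0 _ none)
      avoid (suc zero) = δ≡0⇒≢ (m+n≡0⇒n≡0 (δ (Z u i s) (X v)) none)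

    -- Absence of conflicts makes the edges of the walk pairwise disjoint, so the walk is a prism at
    -- `p 0`. It also keeps the later edges away from the prism fixed at `p 0`, so the two can be
    -- glued.
    no-conflictFree-walk : ∀ p → (∀ s → s < K → Step (p s) (p (suc s))) → p K ≡ p 0 →
      ¬ (∀ i j → i < K → j < K → i ≢ j → conf (p i) (p j) ≡ 0)
    no-conflictFree-walk p step closed cf = free (glue (prism? (p 0)) P λ i s j t e →
        conf≡0⇒avoids (cf 0 (toℕ (suc i)) (s≤s z≤n) (toℕ<n (suc i)) (λ ())) j t (turn (toℕ (suc i)) s) (sym e))
      where
      P : PrismAt (p 0)
      P = walkPrism p step closed λ i j i<K j<K i≢j s t e →
            conf≡0⇒avoids (cf i j i<K j<K i≢j) zero s t (trans (forbidden-root (prism? (p i)) s) e)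

    -- θ is the degree below which an edge is pruned.  By spread, a step of the pruned walk meets a given
    -- vertex with probability at most 1/β; the constants c, ω, b, b′ serve to bound the trace t 0.
    module _ (w : State → State → ℕ) (w-sym : ∀ u v → w u v ≡ w v u) (w-step : ∀ u v → w u v ≢ 0 → Step u v)
             (θ : State → ℕ) (heavy : 2 * ∑ (n * n) θ < ∑[ u < n * n ] ∑[ v < n * n ] w u v)
             (β : ℕ) (spread : ∀ u a → β * ∑[ v < n * n ] (w u v * meets a v) ≤ θ u)
             (c ω : ℕ) (w≤ω : ∀ u v → c * w u v ≤ ω)
             (b b′ : ℕ) (mass : ∀ M m → (∀ u → m u * θ u ≤ M) → (∀ u → (∀ v → w u v ≡ 0) → m u ≡ 0) →
                                b * (ω * ∑ (n * n) m) ≤ b′ * M) where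

      private
        N = n * n

        pruned = prune w w-sym θ heavy
        χ = proj₁ pruned
        χ≤1 = proj₁ (proj₂ pruned)
        θ≤deg = proj₁ (proj₂ (proj₂ pruned))

        w′ : State → State → ℕ
        w′ u v = χ u * (χ v * w u v)

        w′-sym : ∀ u v → w′ u v ≡ w′ v u
        w′-sym u v = trans (cong (λ x → χ u * (χ v * x)) (w-sym u v)) (lem (χ u) (χ v) (w v u))
          where
          lem : ∀ a b c → a * (b * c) ≡ b * (a * c)
          lem = solve-∀

        D : State → ℕ
        D u = ∑[ v < N ] w′ u v

        dχ : State → ℕ
        dχ u = ∑[ v < N ] (χ v * w u v)

        D≡ : ∀ u → D u ≡ χ u * dχ u
        D≡ u = sym (∑-*ˡ (χ u) _)

        M = proj₁ (reciprocals D)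
        m = proj₁ (proj₂ (reciprocals D))
        M>0 = proj₁ (proj₂ (proj₂ (reciprocals D)))
        mD≡M = proj₁ (proj₂ (proj₂ (proj₂ (reciprocals D))))
        m≡0 = proj₂ (proj₂ (proj₂ (proj₂ (reciprocals D))))

        open Chain w′ w′-sym m using (t; module Stationary)
        open Stationary M mD≡M m≡0 using (mD≤M)

        mθ≤M : ∀ u → m u * θ u ≤ M
        mθ≤M u with ≤1⇒0∨1 (χ≤1 u)
        ... | inj₁ χ0 = ≤-trans (≤-reflexive (cong (_* θ u) (m≡0 u (trans (D≡ u) (cong (_* dχ u) χ0))))) z≤n
        ... | inj₂ χ1 = ≤-trans (*-monoʳ-≤ (m u) (≤-trans (θ≤deg u χ1)
                          (≤-reflexive (sym (trans (D≡ u) (trans (cong (_* dχ u) χ1) (*-identityˡ _))))))) (mD≤M u)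

        w′≤w : ∀ u v → w′ u v ≤ w u v
        w′≤w u v = ≤-trans (*-mono-≤ (χ≤1 u) (*-monoˡ-≤ (w u v) (χ≤1 v))) (≤-reflexive (trans (*-identityˡ _) (*-identityˡ _)))

        γ = K * 2

        -- Union bound over the γ = 2K positions and sides of the prism fixed at u, each met by the
        -- steps from y with weight at most θ y / β.
        sparse : ∀ u y → β * (m y * ∑[ z < N ] (w′ y z * conf u z)) ≤ γ * M
        sparse u y = begin
          β * (m y * ∑[ z < N ] (w′ y z * conf u z))
            ≤⟨ *-monoʳ-≤ β (*-monoʳ-≤ (m y) (∑-mono λ z → *-mono-≤ (w′≤w y z) (m⊓n≤m (hit u z) 1))) ⟩
          β * (m y * ∑[ z < N ] (w y z * hit u z))
            ≡⟨ cong (λ x → β * (m y * x)) (begin-equality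
                 ∑[ z < N ] (w y z * hit u z) ≡⟨ ∑-cong (λ z → trans (∑-*ˡ (w y z) _) (∑-cong λ i → ∑-*ˡ (w y z) _)) ⟩
                 ∑[ z < N ] ∑[ i < K ] ∑[ s < 2 ] (w y z * meets (Z u i s) z) ≡⟨ ∑-comm _ ⟩
                 ∑[ i < K ] ∑[ z < N ] ∑[ s < 2 ] (w y z * meets (Z u i s) z) ≡⟨ ∑-cong (λ i → ∑-comm _) ⟩
                 ∑[ i < K ] ∑[ s < 2 ] ∑[ z < N ] (w y z * meets (Z u i s) z) ∎) ⟩
          β * (m y * ∑[ i < K ] ∑[ s < 2 ] ∑[ z < N ] (w y z * meets (Z u i s) z))
            ≡⟨ trans (l₁ β (m y) _) (cong (m y *_) (trans (∑-*ˡ β _) (∑-cong λ i → ∑-*ˡ β _))) ⟩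
          m y * ∑[ i < K ] ∑[ s < 2 ] (β * ∑[ z < N ] (w y z * meets (Z u i s) z))
            ≤⟨ *-monoʳ-≤ (m y) (∑∑-mono λ i s → spread y (Z u i s)) ⟩
          m y * ∑[ i < K ] ∑[ s < 2 ] θ y
            ≡⟨ cong (m y *_) (trans (∑-cong λ i → ∑-const 2 (θ y)) (∑-const K (2 * θ y))) ⟩
          m y * (K * (2 * θ y)) ≡⟨ l₂ (m y) K (θ y) ⟩
          γ * (m y * θ y) ≤⟨ *-monoʳ-≤ γ (mθ≤M y) ⟩
          γ * M ∎
          where
          open ≤-Reasoning
          l₁ : ∀ a b c → a * (b * c) ≡ b * (a * c)
          l₁ = solve-∀
          l₂ : ∀ a K b → a * (K * (2 * b)) ≡ K * 2 * (a * b)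
          l₂ = solve-∀

        -- In `t 0` one factor w′ is bounded by ω/c and m u m v by the mean of the squares. What
        -- remains is ω ∑ m² D / c, where m D ≤ M and `mass` bounds ω ∑ m.
        bct≤ : b * (c * t 0) ≤ b′ * M * M
        bct≤ = *-cancelˡ-≤ 2 (begin
          2 * (b * (c * t 0))
            ≡⟨ l₁ b c (t 0) ⟩
          b * (2 * (c * t 0))
            ≡⟨ cong (λ x → b * (2 * x)) (trans (∑-*ˡ c _) (∑-cong λ u → ∑-*ˡ c _)) ⟩
          b * (2 * ∑[ u < N ] ∑[ v < N ] (c * (m u * m v * (w′ u v * w′ u v))))
            ≤⟨ *-monoʳ-≤ b (*-monoʳ-≤ 2 (∑∑-mono bound)) ⟩
          b * (2 * ∑[ u < N ] ∑[ v < N ] (ω * (m u * m v * w′ u v)))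
            ≡⟨ cong (b *_) (trans (∑-*ˡ 2 _) (∑-cong λ u → trans (∑-*ˡ 2 _) (∑-cong λ v → l₂ ω (m u * m v) (w′ u v)))) ⟩
          b * ∑[ u < N ] ∑[ v < N ] (ω * (w′ u v * (2 * (m u * m v))))
            ≤⟨ *-monoʳ-≤ b (∑∑-mono λ u v → *-monoʳ-≤ ω (*-monoʳ-≤ (w′ u v) (2ab≤a²+b² (m u) (m v)))) ⟩
          b * ∑[ u < N ] ∑[ v < N ] (ω * (w′ u v * (m u * m u + m v * m v)))
            ≡⟨ cong (b *_) sum≡ ⟩
          b * (2 * (ω * ∑[ u < N ] (m u * (m u * D u))))
            ≤⟨ *-monoʳ-≤ b (*-monoʳ-≤ 2 (*-monoʳ-≤ ω (∑-mono λ u → *-monoʳ-≤ (m u) (mD≤M u)))) ⟩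
          b * (2 * (ω * ∑[ u < N ] (m u * M)))
            ≡⟨ trans (cong (λ x → b * (2 * (ω * x))) (sym (∑-*ʳ m M))) (l₃ b ω (∑ N m) M) ⟩
          2 * (b * (ω * ∑ N m) * M)
            ≤⟨ *-monoʳ-≤ 2 (*-monoˡ-≤ M (mass M m mθ≤M isolated)) ⟩
          2 * (b′ * M * M) ∎)
          where
          open ≤-Reasoning
          l₁ : ∀ b c t → 2 * (b * (c * t)) ≡ b * (2 * (c * t))
          l₁ = solve-∀
          l₂ : ∀ a b c → 2 * (a * (b * c)) ≡ a * (c * (2 * b))
          l₂ = solve-∀
          l₃ : ∀ b o s M → b * (2 * (o * (s * M))) ≡ 2 * (b * (o * s) * M)
          l₃ = solve-∀
          l₄ : ∀ c m x y → c * (m * (x * y)) ≡ m * x * (c * y)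
          l₄ = solve-∀
          l₅ : ∀ o m x → m * x * o ≡ o * (m * x)
          l₅ = solve-∀
          l₆ : ∀ o x a b → o * (x * (a * a + b * b)) ≡ o * (a * (a * x)) + o * (b * (b * x))
          l₆ = solve-∀
          l₇ : ∀ x → x + x ≡ 2 * x
          l₇ = solve-∀
          bound : ∀ u v → c * (m u * m v * (w′ u v * w′ u v)) ≤ ω * (m u * m v * w′ u v)
          bound u v = ≤-trans (≤-reflexive (l₄ c (m u * m v) (w′ u v) (w′ u v)))
            (≤-trans (*-monoʳ-≤ (m u * m v * w′ u v) (≤-trans (*-monoʳ-≤ c (w′≤w u v)) (w≤ω u v)))
                     (≤-reflexive (l₅ ω (m u * m v) (w′ u v))))
          half : (∑[ u < N ] ∑[ v < N ] (ω * (m u * (m u * w′ u v)))) ≡ ω * ∑[ u < N ] (m u * (m u * D u))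
          half = trans (∑-cong λ u → trans (sym (∑-*ˡ ω _)) (cong (ω *_) (trans (sym (∑-*ˡ (m u) _)) (cong (m u *_) (sym (∑-*ˡ (m u) _))))))
                       (sym (∑-*ˡ ω _))
          sum≡ : (∑[ u < N ] ∑[ v < N ] (ω * (w′ u v * (m u * m u + m v * m v)))) ≡ 2 * (ω * ∑[ u < N ] (m u * (m u * D u)))
          sum≡ = begin-equality
            ∑[ u < N ] ∑[ v < N ] (ω * (w′ u v * (m u * m u + m v * m v)))
              ≡⟨ ∑-cong (λ u → trans (∑-cong λ v → l₆ ω (w′ u v) (m u) (m v)) (∑-distrib-+ _ _)) ⟩
            ∑[ u < N ] ((∑[ v < N ] (ω * (m u * (m u * w′ u v)))) + ∑[ v < N ] (ω * (m v * (m v * w′ u v))))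
              ≡⟨ ∑-distrib-+ _ _ ⟩
            (∑[ u < N ] ∑[ v < N ] (ω * (m u * (m u * w′ u v)))) + (∑[ u < N ] ∑[ v < N ] (ω * (m v * (m v * w′ u v))))
              ≡⟨ cong₂ _+_ half (trans (∑-comm _) (trans (∑∑-cong λ v u → cong (λ x → ω * (m v * (m v * x))) (w′-sym u v)) half)) ⟩
            ω * (∑[ u < N ] (m u * (m u * D u))) + ω * ∑[ u < N ] (m u * (m u * D u))
              ≡⟨ l₇ (ω * ∑[ u < N ] (m u * (m u * D u))) ⟩
            2 * (ω * ∑[ u < N ] (m u * (m u * D u))) ∎
          isolated : ∀ u → (∀ v → w u v ≡ 0) → m u ≡ 0
          isolated u h = m≡0 u (n≤0⇒n≡0 (≤-trans (∑-mono λ v → ≤-trans (w′≤w u v) (≤-reflexive (h v))) (≤-reflexive (∑-0 N))))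

        D>0 : 0 < ∑ N D
        D>0 = ≤-trans (proj₂ (proj₂ (proj₂ pruned))) (≤-reflexive (∑-cong λ u → sym (D≡ u)))

        w′-step : ∀ u v → w′ u v ≢ 0 → Step u v
        w′-step u v ne = w-step u v λ e → ne (n≤0⇒n≡0 (≤-trans (w′≤w u v) (≤-reflexive e)))

      -- The form in which both applications use the conflict inequality; the normalisation M has
      -- cancelled.
      spread-inequality : β ^ suc k * (b * c) ≤ κ k ^ suc k * b′
      spread-inequality = *-cancelʳ-≤ _ _ (M * M) {{>-nonZero (*-mono-< M>0 M>0)}} (begin
        β ^ suc k * (b * c) * (M * M)       ≡⟨ l₁ (β ^ suc k) b c (M * M) ⟩
        b * (c * (β ^ suc k * (M * M)))
          ≤⟨ *-monoʳ-≤ b (*-monoʳ-≤ c (conflict-inequality w′ w′-sym m M mD≡M m≡0 conf (λ u z → m⊓n≤n (hit u z) 1) β γ sparse k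
               (λ p walk closed → no-conflictFree-walk p (λ s s<K → w′-step _ _ (walk s s<K)) closed) M>0 D>0)) ⟩
        b * (c * ((K * K * (K * K) * (K * 2)) ^ suc k * t 0)) ≡⟨ cong (λ x → b * (c * (x ^ suc k * t 0))) (sym (κ-def k)) ⟩
        b * (c * (κ k ^ suc k * t 0))        ≡⟨ l₂ b c (κ k ^ suc k) (t 0) ⟩
        κ k ^ suc k * (b * (c * t 0))        ≤⟨ *-monoʳ-≤ (κ k ^ suc k) bct≤ ⟩
        κ k ^ suc k * (b′ * M * M)           ≡⟨ l₃ (κ k ^ suc k) b′ M ⟩
        κ k ^ suc k * b′ * (M * M)           ∎)
        where
        open ≤-Reasoning
        l₁ : ∀ x b c y → x * (b * c) * y ≡ b * (c * (x * y))
        l₁ = solve-∀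
        l₂ : ∀ b c x t → b * (c * (x * t)) ≡ x * (b * (c * t))
        l₂ = solve-∀
        l₃ : ∀ x b M → x * (b * M * M) ≡ x * b * (M * M)
        l₃ = solve-∀

-- Many vertices of large codegree with a given one

opaque
  -- n!/c, cut off at c < c₁; the factorial keeps the weights integral.
  cutoff : ∀ n c₁ c → c ≤ n → 0 < c₁ → Σ[ L ∈ ℕ ] Σ[ g ∈ ℕ ] g ≤ 1 × L * c ≡ n ! * g × c₁ * L ≤ n ! * g × c ≤ g * c + c₁
  cutoff n c₁ c c≤n c₁>0 with c₁ ≤? c
  ... | no  c₁≰c = 0 , 0 , z≤n , sym (*-zeroʳ (n !)) , ≤-reflexive (trans (*-zeroʳ c₁) (sym (*-zeroʳ (n !)))) , <⇒≤ (≰⇒> c₁≰c)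
  cutoff n c₁ zero    c≤n c₁>0 | yes c₁≤c = ⊥-elim (1+n≰n (≤-trans c₁>0 c₁≤c))
  cutoff n c₁ (suc c) c≤n c₁>0 | yes c₁≤c = q , 1 , ≤-refl , q*c≡ , ≤-trans (≤-reflexive (*-comm c₁ q))
      (≤-trans (*-monoʳ-≤ q c₁≤c) (≤-reflexive q*c≡)) , ≤-trans (m≤m+n (suc c) 0) (m≤m+n _ c₁)
    where
    dvd : suc c ∣ n !
    dvd = ∣-trans (m∣m*n (c !)) (m≤n⇒m!∣n! c≤n)
    q : ℕ
    q = _∣_.quotient dvd
    q*c≡ : q * suc c ≡ n ! * 1
    q*c≡ = trans (sym (_∣_.equality dvd)) (sym (*-identityʳ (n !)))

a*b≢0⇒a≢0 : ∀ a b → a * b ≢ 0 → a ≢ 0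
a*b≢0⇒a≢0 a b ne refl = ne refl

a*b≢0⇒b≢0 : ∀ a b → a * b ≢ 0 → b ≢ 0
a*b≢0⇒b≢0 a b ne refl = ne (*-zeroʳ a)

codegree : ∀ {n} → (Fin n → Fin n → ℕ) → Fin n → Fin n → ℕ
codegree {n} F x x′ = ∑[ y < n ] (F x y * F x′ y)

codegree-sym : ∀ {n} (F : Fin n → Fin n → ℕ) x x′ → codegree F x x′ ≡ codegree F x′ x
codegree-sym F x x′ = ∑-cong λ y → *-comm (F x y) (F x′ y)

codegree≤n : ∀ {n} (F : Fin n → Fin n → ℕ) → (∀ x y → F x y ≤ 1) → ∀ x x′ → codegree F x x′ ≤ n
codegree≤n {n} F F≤1 x x′ = ≤-trans (∑-mono λ y → *-mono-≤ (F≤1 x y) (F≤1 x′ y)) (≤-reflexive (trans (∑-const n 1) (*-identityʳ n)))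

module Bipartite {n : ℕ} (G : Graph n) (k : ℕ) where

  open Host G k

  module Weighted (free : Free G (Glued (suc (suc k)))) (prism? : ∀ u → Dec (PrismAt u))
                  (F : Fin n → Fin n → ℕ) (F≤1 : ∀ x y → F x y ≤ 1) (F⇒Adj : ∀ x y → F x y ≢ 0 → Adj x y)
                  (c₁ : ℕ) (c₁>0 : 0 < c₁) where

    private
      Λ = n !

      cod = codegree F

      cut : ∀ x x′ → _
      cut x x′ = cutoff n c₁ (cod x x′) (codegree≤n F F≤1 x x′) c₁>0

    L good : Fin n → Fin n → ℕ
    L x x′ = proj₁ (cut x x′)
    good x x′ = proj₁ (proj₂ (cut x x′))

    good≤1 : ∀ x x′ → good x x′ ≤ 1
    good≤1 x x′ = proj₁ (proj₂ (proj₂ (cut x x′)))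

    cod≤good : ∀ x x′ → cod x x′ ≤ good x x′ * cod x x′ + c₁
    cod≤good x x′ = proj₂ (proj₂ (proj₂ (proj₂ (proj₂ (cut x x′)))))

    richness : Fin n → Fin n → ℕ
    richness x y = ∑[ x′ < n ] (F x′ y * good x x′)

    size : ℕ
    size = ∑[ x < n ] ∑[ y < n ] F x y

    private
      L*cod : ∀ x x′ → L x x′ * cod x x′ ≡ Λ * good x x′
      L*cod x x′ = proj₁ (proj₂ (proj₂ (proj₂ (cut x x′))))

      c₁L≤ : ∀ x x′ → c₁ * L x x′ ≤ Λ * good x x′
      c₁L≤ x x′ = proj₁ (proj₂ (proj₂ (proj₂ (proj₂ (cut x x′)))))

      L-sym : ∀ x x′ → L x x′ ≡ L x′ x
      L-sym x x′ = same (codegree-sym F x x′) _ _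
        where
        -- `cutoff` also receives a proof that the codegree is at most n; any two such proofs are
        -- equal.
        same : ∀ {c d} → c ≡ d → ∀ p q → proj₁ (cutoff n c₁ c p c₁>0) ≡ proj₁ (cutoff n c₁ d q c₁>0)
        same refl p q = cong (λ r → proj₁ (cutoff n c₁ _ r c₁>0)) (≤-irrelevant p q)

      -- Since `L x x′` is inverse to the codegree, y′ is uniform among the common neighbours of x
      -- and x′, and each good x′ adjacent to y has the same total weight 4Λ. The 4 clears the
      -- denominator of the pruning threshold `Θ`.
      W : Fin n → Fin n → Fin n → Fin n → ℕ
      W x y x′ y′ = 4 * (F x y * F x′ y * (F x y′ * F x′ y′ * L x x′))

      w : State → State → ℕ
      w u v = W (X u) (Y u) (X v) (Y v)

      w-sym : ∀ u v → w u v ≡ w v u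
      w-sym u v = trans (cong (λ x → 4 * (F (X u) (Y u) * F (X v) (Y u) * (F (X u) (Y v) * F (X v) (Y v) * x))) (L-sym (X u) (X v)))
                        (lem (F (X u) (Y u)) (F (X v) (Y u)) (F (X u) (Y v)) (F (X v) (Y v)) (L (X v) (X u)))
        where
        lem : ∀ a b c d l → 4 * (a * b * (c * d * l)) ≡ 4 * (d * c * (b * a * l))
        lem = solve-∀

      w-step : ∀ u v → w u v ≢ 0 → Step u v
      w-step u v ne = F⇒Adj _ _ (a*b≢0⇒a≢0 _ (F (X v) (Y u)) ab) , F⇒Adj _ _ (a*b≢0⇒a≢0 _ (F (X v) (Y v)) cd)
                    , F⇒Adj _ _ (a*b≢0⇒b≢0 (F (X u) (Y u)) _ ab)
        where
        all : F (X u) (Y u) * F (X v) (Y u) * (F (X u) (Y v) * F (X v) (Y v) * L (X u) (X v)) ≢ 0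
        all = a*b≢0⇒b≢0 4 _ ne
        ab : F (X u) (Y u) * F (X v) (Y u) ≢ 0
        ab = a*b≢0⇒a≢0 (F (X u) (Y u) * F (X v) (Y u)) _ all
        cd : F (X u) (Y v) * F (X v) (Y v) ≢ 0
        cd = a*b≢0⇒a≢0 _ (L (X u) (X v)) (a*b≢0⇒b≢0 (F (X u) (Y u) * F (X v) (Y u)) _ all)

      ∑W : ∀ x y x′ → (∑[ y′ < n ] W x y x′ y′) ≡ 4 * (F x y * F x′ y) * (Λ * good x x′)
      ∑W x y x′ = trans (∑-cong λ y′ → l₁ (F x y * F x′ y) (F x y′ * F x′ y′) (L x x′))
        (trans (sym (∑-*ˡ (4 * (F x y * F x′ y) * L x x′) _))
          (trans (*-assoc (4 * (F x y * F x′ y)) (L x x′) (cod x x′)) (cong (4 * (F x y * F x′ y) *_) (L*cod x x′))))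
        where
        l₁ : ∀ a b l → 4 * (a * (b * l)) ≡ 4 * a * l * b
        l₁ = solve-∀

      ∑∑W : ∀ x y → (∑[ x′ < n ] ∑[ y′ < n ] W x y x′ y′) ≡ 4 * Λ * (F x y * richness x y)
      ∑∑W x y = trans (∑-cong λ x′ → trans (∑W x y x′) (l₁ (F x y) (F x′ y) Λ (good x x′)))
        (trans (sym (∑-*ˡ (4 * Λ * F x y) _)) (*-assoc (4 * Λ) (F x y) _))
        where
        l₁ : ∀ a b l g → 4 * (a * b) * (l * g) ≡ 4 * l * a * (b * g)
        l₁ = solve-∀

    module _ (g₀ β : ℕ) (4β≤g₀ : 4 * β ≤ g₀) (4β≤c₁ : 4 * β ≤ c₁)
             (rich : size * g₀ < ∑[ x < n ] ∑[ y < n ] (F x y * richness x y)) where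

      private
        N = n * n

        -- The summand g₀ pays for the steps with x′ = a, of total weight at most 4Λ; the richness
        -- pays for those with y′ = a, of weight at most 4Λ/c₁ for each good x′.
        Θ : Fin n → Fin n → ℕ
        Θ x y = F x y * (Λ * (richness x y + g₀))

        θ : State → ℕ
        θ u = Θ (X u) (Y u)

        R = ∑[ x < n ] ∑[ y < n ] (F x y * richness x y)

        heavy : 2 * ∑ N θ < ∑[ u < N ] ∑[ v < N ] w u v
        heavy = begin-strict
          2 * ∑ N θ ≡⟨ cong (2 *_) (trans (∑-pairs n n Θ) (trans (∑∑-cong λ x y → l₁ (F x y) Λ (richness x y) g₀)
                         (trans (∑-cong λ x → sym (∑-*ˡ Λ _)) (sym (∑-*ˡ Λ _))))) ⟩
          2 * (Λ * ∑[ x < n ] ∑[ y < n ] (F x y * richness x y + F x y * g₀))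
            ≡⟨ cong (λ x → 2 * (Λ * x)) (trans (trans (∑-cong λ x → ∑-distrib-+ _ _) (∑-distrib-+ _ _))
                 (cong (R +_) (trans (∑-cong λ x → sym (∑-*ʳ (F x) g₀)) (sym (∑-*ʳ _ g₀))))) ⟩
          2 * (Λ * (R + size * g₀)) <⟨ *-monoʳ-< 2 (*-monoʳ-< Λ {{>-nonZero (1≤n! n)}} (+-monoʳ-< R rich)) ⟩
          2 * (Λ * (R + R)) ≡⟨ l₂ Λ R ⟩
          4 * Λ * R ≡⟨ trans (∑-*ˡ (4 * Λ) _) (∑-cong λ x → ∑-*ˡ (4 * Λ) _) ⟩
          ∑[ x < n ] ∑[ y < n ] (4 * Λ * (F x y * richness x y)) ≡⟨ ∑∑-cong (λ x y → sym (∑∑W x y)) ⟩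
          ∑[ x < n ] ∑[ y < n ] ∑[ x′ < n ] ∑[ y′ < n ] W x y x′ y′
            ≡⟨ sym (trans (∑-cong λ u → ∑-pairs n n (W (X u) (Y u))) (∑-pairs n n (λ x y → ∑[ x′ < n ] ∑[ y′ < n ] W x y x′ y′))) ⟩
          ∑[ u < N ] ∑[ v < N ] w u v ∎
          where
          open ≤-Reasoning
          l₁ : ∀ a l r g → a * (l * (r + g)) ≡ l * (a * r + a * g)
          l₁ = solve-∀
          l₂ : ∀ l r → 2 * (l * (r + r)) ≡ 4 * l * r
          l₂ = solve-∀

        spread : ∀ x y a → β * ∑[ x′ < n ] ∑[ y′ < n ] (W x y x′ y′ * (δ a x′ + δ a y′)) ≤ Θ x y
        spread x y a = begin
          β * ∑[ x′ < n ] ∑[ y′ < n ] (W x y x′ y′ * (δ a x′ + δ a y′))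
            ≡⟨ cong (β *_) (trans (∑-cong λ x′ → trans (∑-cong λ y′ → *-distribˡ-+ (W x y x′ y′) _ _) (∑-distrib-+ _ _)) (∑-distrib-+ _ _)) ⟩
          β * ((∑[ x′ < n ] ∑[ y′ < n ] (W x y x′ y′ * δ a x′)) + ∑[ x′ < n ] ∑[ y′ < n ] (W x y x′ y′ * δ a y′))
            ≡⟨ cong (β *_) (cong₂ _+_
                 (trans (∑-cong λ x′ → sym (∑-*ʳ _ (δ a x′))) (trans (∑-cong λ x′ → cong (∑ n (W x y x′) *_) (δ-sym a x′)) (∑-δʳ a (λ x′ → ∑ n (W x y x′)))))
                 (∑-cong λ x′ → trans (∑-cong λ y′ → cong (W x y x′ y′ *_) (δ-sym a y′)) (∑-δʳ a (W x y x′)))) ⟩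
          β * ((∑[ y′ < n ] W x y a y′) + ∑[ x′ < n ] W x y x′ a)
            ≡⟨ *-distribˡ-+ β _ _ ⟩
          β * (∑[ y′ < n ] W x y a y′) + β * (∑[ x′ < n ] W x y x′ a)
            ≤⟨ +-mono-≤ first second ⟩
          F x y * (Λ * g₀) + F x y * (Λ * richness x y)
            ≡⟨ l₀ (F x y) Λ g₀ (richness x y) ⟩
          Θ x y ∎
          where
          open ≤-Reasoning
          l₀ : ∀ a l g r → a * (l * g) + a * (l * r) ≡ a * (l * (r + g))
          l₀ = solve-∀
          l₁ : ∀ b a c l → b * (4 * (a * c) * l) ≡ 4 * b * (c * (a * l))
          l₁ = solve-∀
          l₂ : ∀ g a l → g * (1 * (a * (l * 1))) ≡ a * (l * g)
          l₂ = solve-∀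
          first : β * (∑[ y′ < n ] W x y a y′) ≤ F x y * (Λ * g₀)
          first = begin
            β * (∑[ y′ < n ] W x y a y′)                  ≡⟨ cong (β *_) (∑W x y a) ⟩
            β * (4 * (F x y * F a y) * (Λ * good x a))    ≡⟨ l₁ β (F x y) (F a y) (Λ * good x a) ⟩
            4 * β * (F a y * (F x y * (Λ * good x a)))
              ≤⟨ *-mono-≤ 4β≤g₀ (*-mono-≤ (F≤1 a y) (*-monoʳ-≤ (F x y) (*-monoʳ-≤ Λ (good≤1 x a)))) ⟩
            g₀ * (1 * (F x y * (Λ * 1)))                  ≡⟨ l₂ g₀ (F x y) Λ ⟩
            F x y * (Λ * g₀) ∎
          l₃ : ∀ b a c d e l → b * (4 * (a * c * (d * e * l))) ≡ d * e * (a * (c * (4 * b * l)))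
          l₃ = solve-∀
          l₄ : ∀ a c l g → a * (c * (l * g)) ≡ a * l * (c * g)
          l₄ = solve-∀
          second : β * (∑[ x′ < n ] W x y x′ a) ≤ F x y * (Λ * richness x y)
          second = begin
            β * (∑[ x′ < n ] W x y x′ a) ≡⟨ ∑-*ˡ β _ ⟩
            ∑[ x′ < n ] (β * W x y x′ a) ≡⟨ ∑-cong (λ x′ → l₃ β (F x y) (F x′ y) (F x a) (F x′ a) (L x x′)) ⟩
            ∑[ x′ < n ] (F x a * F x′ a * (F x y * (F x′ y * (4 * β * L x x′))))
              ≤⟨ ∑-mono (λ x′ → *-mono-≤ (*-mono-≤ (F≤1 x a) (F≤1 x′ a)) (*-monoʳ-≤ (F x y) (*-monoʳ-≤ (F x′ y)
                   (≤-trans (*-monoˡ-≤ (L x x′) 4β≤c₁) (c₁L≤ x x′))))) ⟩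
            ∑[ x′ < n ] (1 * (F x y * (F x′ y * (Λ * good x x′))))
              ≡⟨ ∑-cong (λ x′ → trans (*-identityˡ _) (l₄ (F x y) (F x′ y) Λ (good x x′))) ⟩
            ∑[ x′ < n ] (F x y * Λ * (F x′ y * good x x′)) ≡⟨ trans (sym (∑-*ˡ (F x y * Λ) _)) (*-assoc (F x y) Λ _) ⟩
            F x y * (Λ * richness x y) ∎

        W≤ω : ∀ x y x′ y′ → c₁ * W x y x′ y′ ≤ 4 * Λ
        W≤ω x y x′ y′ = begin
          c₁ * W x y x′ y′ ≡⟨ l₁ c₁ (F x y) (F x′ y) (F x y′) (F x′ y′) (L x x′) ⟩
          4 * (F x y * F x′ y * (F x y′ * F x′ y′) * (c₁ * L x x′))
            ≤⟨ *-monoʳ-≤ 4 (*-mono-≤ (*-mono-≤ (*-mono-≤ (F≤1 x y) (F≤1 x′ y)) (*-mono-≤ (F≤1 x y′) (F≤1 x′ y′)))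
                 (≤-trans (c₁L≤ x x′) (*-monoʳ-≤ Λ (good≤1 x x′)))) ⟩
          4 * (1 * (Λ * 1)) ≡⟨ l₂ Λ ⟩
          4 * Λ ∎
          where
          open ≤-Reasoning
          l₁ : ∀ c p q r s l → c * (4 * (p * q * (r * s * l))) ≡ 4 * (p * q * (r * s) * (c * l))
          l₁ = solve-∀
          l₂ : ∀ l → 4 * (1 * (l * 1)) ≡ 4 * l
          l₂ = solve-∀

        -- On each of the `size` edges θ is at least Λ g₀, so m is at most M / (Λ g₀); all other
        -- states are isolated.
        mass : ∀ M m → (∀ u → m u * θ u ≤ M) → (∀ u → (∀ v → w u v ≡ 0) → m u ≡ 0) →
               g₀ * (4 * Λ * ∑ N m) ≤ 4 * size * M
        mass M m mθ≤M isolated = begin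
          g₀ * (4 * Λ * ∑ N m) ≡⟨ l₁ g₀ Λ (∑ N m) ⟩
          4 * (Λ * g₀ * ∑ N m) ≡⟨ cong (4 *_) (∑-*ˡ (Λ * g₀) m) ⟩
          4 * (∑[ u < N ] (Λ * g₀ * m u)) ≤⟨ *-monoʳ-≤ 4 (∑-mono bound) ⟩
          4 * (∑[ u < N ] (F (X u) (Y u) * M)) ≡⟨ cong (4 *_) (trans (sym (∑-*ʳ _ M)) (cong (_* M) (∑-pairs n n F))) ⟩
          4 * (size * M) ≡⟨ sym (*-assoc 4 size M) ⟩
          4 * size * M ∎
          where
          open ≤-Reasoning
          l₁ : ∀ g l s → g * (4 * l * s) ≡ 4 * (l * g * s)
          l₁ = solve-∀
          l₂ : ∀ l g m r → l * g * m + m * (l * r) ≡ m * (1 * (l * (r + g)))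
          l₂ = solve-∀
          bound : ∀ u → Λ * g₀ * m u ≤ F (X u) (Y u) * M
          bound u with ≤1⇒0∨1 (F≤1 (X u) (Y u))
          ... | inj₁ F0 = ≤-trans (≤-reflexive (trans (cong (Λ * g₀ *_) (isolated u λ v →
                  cong (λ x → 4 * (x * F (X v) (Y u) * (F (X u) (Y v) * F (X v) (Y v) * L (X u) (X v)))) F0)) (*-zeroʳ (Λ * g₀)))) z≤n
          ... | inj₂ F1 = begin
            Λ * g₀ * m u ≤⟨ m≤m+n _ _ ⟩
            Λ * g₀ * m u + m u * (Λ * richness (X u) (Y u)) ≡⟨ l₂ Λ g₀ (m u) (richness (X u) (Y u)) ⟩
            m u * (1 * (Λ * (richness (X u) (Y u) + g₀))) ≡⟨ cong (λ x → m u * (x * (Λ * (richness (X u) (Y u) + g₀)))) (sym F1) ⟩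
            m u * θ u ≤⟨ mθ≤M u ⟩
            M ≡⟨ sym (*-identityˡ M) ⟩
            1 * M ≡⟨ cong (_* M) (sym F1) ⟩
            F (X u) (Y u) * M ∎

      bipartite-inequality : β ^ suc k * (g₀ * c₁) ≤ κ k ^ suc k * (4 * size)
      bipartite-inequality = spread-inequality free prism? w w-sym w-step θ heavy β
        (λ u a → ≤-trans (≤-reflexive (cong (β *_) (∑-pairs n n (λ x′ y′ → W (X u) (Y u) x′ y′ * (δ a x′ + δ a y′))))) (spread (X u) (Y u) a))
        c₁ (4 * Λ) (λ u v → W≤ω (X u) (Y u) (X v) (Y v)) g₀ (4 * size) mass

divide : ∀ d q → 0 < q → ∃[ c ] (q * c ≤ d × d < q * suc c)
divide zero    q q>0 = 0 , ≤-reflexive (*-zeroʳ q) , ≤-trans q>0 (≤-reflexive (sym (*-identityʳ q)))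
divide (suc d) q q>0 with divide d q q>0
... | c , lo , hi with suc d <? q * suc c
...   | yes lt = c , m≤n⇒m≤1+n lo , lt
...   | no  ge = suc c , ≤-reflexive (sym eq) , ≤-trans (s≤s (≤-reflexive eq))
                   (≤-trans (+-monoˡ-≤ (q * suc c) q>0) (≤-reflexive (sym (*-suc q (suc c)))))
  where
  eq : suc d ≡ q * suc c
  eq = ≤-antisym hi (≮⇒≥ ge)

select : ∀ {n} (h : Fin n → ℕ) P → P ≤ ∑ n h → (∀ x → h x ≤ 1) → Σ[ h′ ∈ (Fin n → ℕ) ] (∀ x → h′ x ≤ h x) × ∑ n h′ ≡ P
select {n} h zero    le h≤1 = (λ _ → 0) , (λ _ → z≤n) , ∑-0 n
select {zero}  h (suc P) le h≤1 = ⊥-elim (n≮0 (≤-trans le (≤-reflexive (∑-zero h))))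
select {suc n} h (suc P) le h≤1 with h zero in eq
... | zero  with select (h ∘ suc) (suc P) (≤-trans le (≤-reflexive (trans (∑-suc h) (cong (_+ ∑ n (h ∘ suc)) eq)))) (h≤1 ∘ suc)
...   | h′ , le′ , sum′ = cons , cons≤ , trans (∑-suc cons) sum′
  where
  cons : Fin (suc n) → ℕ
  cons zero    = 0
  cons (suc x) = h′ x
  cons≤ : ∀ x → cons x ≤ h x
  cons≤ zero    = z≤n
  cons≤ (suc x) = le′ x
select {suc n} h (suc P) le h≤1 | suc a
  with select (h ∘ suc) P (s≤s⁻¹ (≤-trans le (≤-trans (≤-reflexive (∑-suc h)) (+-monoˡ-≤ _ (h≤1 zero))))) (h≤1 ∘ suc)
... | h′ , le′ , sum′ = cons , cons≤ , trans (∑-suc cons) (cong suc sum′)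
  where
  cons : Fin (suc n) → ℕ
  cons zero    = 1
  cons (suc x) = h′ x
  cons≤ : ∀ x → cons x ≤ h x
  cons≤ zero    = ≤-trans (s≤s z≤n) (≤-reflexive (sym eq))
  cons≤ (suc x) = le′ x

indicator : ∀ {P : Set} → Dec P → ℕ
indicator (yes _) = 1
indicator (no  _) = 0

indicator≤1 : ∀ {P : Set} (d : Dec P) → indicator d ≤ 1
indicator≤1 (yes _) = ≤-refl
indicator≤1 (no  _) = z≤n

square≡id : ∀ {x} → x ≤ 1 → x * x ≡ x
square≡id z≤n       = refl
square≡id (s≤s z≤n) = refl

degree : ∀ {n} → (Fin n → Fin n → ℕ) → Fin n → ℕ
degree {n} f x = ∑[ y < n ] f x y

module _ {n : ℕ} (G : Graph n) (k : ℕ) where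

  open Host G k

  module _ (free : Free G (Glued (suc (suc k)))) (prism? : ∀ u → Dec (PrismAt u))
           (f : Fin n → Fin n → ℕ) (f≤1 : ∀ x y → f x y ≤ 1) (f⇒Adj : ∀ x y → f x y ≢ 0 → Adj x y) where

    -- h selects 16βρ + 1 vertices which see at least the fraction 1/ρ of the neighbourhood of x₀.  The
    -- walk runs on the edges F between them and that neighbourhood, with weights inverse to codegrees.
    module _ (x₀ : Fin n) (h : Fin n → ℕ) (h≤1 : ∀ x → h x ≤ 1) (ρ : ℕ) (ρ>0 : 0 < ρ)
             (h-heavy : ∀ x → h x ≢ 0 → degree f x₀ ≤ codegree f x x₀ * ρ)
             (β : ℕ) (β>0 : 0 < β) (P≡ : ∑ n h ≡ suc (16 * β * ρ))
             (c₁ : ℕ) (4β≤c₁ : 4 * β ≤ c₁) (c₁-lo : 2 * (ρ * ρ) * c₁ ≤ degree f x₀) (c₁-hi : degree f x₀ < 2 * (ρ * ρ) * suc c₁) where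

      private
        d = degree f x₀
        P = ∑ n h

        F : Fin n → Fin n → ℕ
        F x y = h x * (f x₀ y * f x y)

        F≤1 : ∀ x y → F x y ≤ 1
        F≤1 x y = *-mono-≤ (h≤1 x) (*-mono-≤ (f≤1 x₀ y) (f≤1 x y))

        F⇒Adj : ∀ x y → F x y ≢ 0 → Adj x y
        F⇒Adj x y ne = f⇒Adj x y (a*b≢0⇒b≢0 (f x₀ y) _ (a*b≢0⇒b≢0 (h x) _ ne))

        c₁>0 : 0 < c₁
        c₁>0 = ≤-trans β>0 (≤-trans (m≤m+n β _) 4β≤c₁)

        open Bipartite.Weighted G k free prism? F F≤1 F⇒Adj c₁ c₁>0

        g₀ = 4 * β
        R = ∑[ x < n ] ∑[ y < n ] (F x y * richness x y)
        S = ∑[ x < n ] ∑[ x′ < n ] codegree F x x′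

        size≡ : size ≡ ∑[ x < n ] (h x * codegree f x x₀)
        size≡ = ∑-cong λ x → trans (sym (∑-*ˡ (h x) _)) (cong (h x *_) (codegree-sym f x₀ x))

        Pd≤sizeρ : P * d ≤ size * ρ
        Pd≤sizeρ = begin
          P * d ≡⟨ ∑-*ʳ h d ⟩
          ∑[ x < n ] (h x * d) ≤⟨ ∑-mono bound ⟩
          ∑[ x < n ] (h x * (codegree f x x₀ * ρ)) ≡⟨ trans (∑-cong λ x → sym (*-assoc (h x) _ ρ)) (sym (∑-*ʳ _ ρ)) ⟩
          (∑[ x < n ] (h x * codegree f x x₀)) * ρ ≡⟨ cong (_* ρ) (sym size≡) ⟩
          size * ρ ∎
          where
          open ≤-Reasoning
          bound : ∀ x → h x * d ≤ h x * (codegree f x x₀ * ρ)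
          bound x with h x in eq
          ... | zero  = z≤n
          ... | suc a = *-monoʳ-≤ (suc a) (h-heavy x (λ e → 1+n≢0 (trans (sym eq) e)))

        size≤Pd : size ≤ P * d
        size≤Pd = begin
          size ≤⟨ ∑∑-mono (λ x y → *-monoʳ-≤ (h x) (≤-trans (*-monoʳ-≤ (f x₀ y) (f≤1 x y)) (≤-reflexive (*-identityʳ _)))) ⟩
          ∑[ x < n ] ∑[ y < n ] (h x * f x₀ y) ≡⟨ ∑-product h (f x₀) ⟩
          P * d ∎
          where open ≤-Reasoning

        -- Convexity over the neighbourhood of x₀. Inserting the idempotent factor `f x₀ y` makes
        -- Cauchy-Schwarz cost d rather than n.
        size²≤dS : size * size ≤ d * S
        size²≤dS = begin
          size * size ≡⟨ cong (λ x → x * x) (trans (∑-comm F) (∑-cong λ y → trans (∑-cong λ x → absorb x y)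
                            (trans (sym (∑-*ˡ (f x₀ y) _)) (sym (*-identityˡ _))))) ⟩
          (∑[ y < n ] (1 * (f x₀ y * H y))) * (∑[ y < n ] (1 * (f x₀ y * H y)))
            ≤⟨ cauchySchwarz ∑-isSum (λ _ → 1) (f x₀) H ⟩
          (∑[ y < n ] (1 * (f x₀ y * f x₀ y))) * (∑[ y < n ] (1 * (H y * H y)))
            ≡⟨ cong₂ _*_ (∑-cong λ y → trans (*-identityˡ _) (square≡id (f≤1 x₀ y))) S≡ ⟩
          d * S ∎
          where
          open ≤-Reasoning
          H : Fin n → ℕ
          H y = ∑[ x < n ] F x y
          l₁ : ∀ h a b → h * (a * a * b) ≡ a * (h * (a * b))
          l₁ = solve-∀
          absorb : ∀ x y → F x y ≡ f x₀ y * F x y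
          absorb x y = trans (cong (λ a → h x * (a * f x y)) (sym (square≡id (f≤1 x₀ y)))) (l₁ (h x) (f x₀ y) (f x y))
          S≡ : (∑[ y < n ] (1 * (H y * H y))) ≡ S
          S≡ = trans (∑-cong λ y → trans (*-identityˡ _) (sym (∑-product (λ x → F x y) (λ x → F x y))))
                 (trans (∑-comm _) (∑-cong λ x → ∑-comm _))

        R≡ : R ≡ ∑[ x < n ] ∑[ x′ < n ] (good x x′ * codegree F x x′)
        R≡ = ∑-cong λ x → trans (∑-cong λ y → ∑-*ˡ (F x y) _) (trans (∑-comm _) (∑-cong λ x′ →
               trans (∑-cong λ y → lem (F x y) (F x′ y) (good x x′)) (sym (∑-*ˡ (good x x′) _))))
          where
          lem : ∀ a b g → a * (b * g) ≡ g * (a * b)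
          lem = solve-∀

        S≤ : S ≤ R + P * P * c₁
        S≤ = begin
          S ≤⟨ ∑∑-mono bound ⟩
          ∑[ x < n ] ∑[ x′ < n ] (good x x′ * codegree F x x′ + h x * h x′ * c₁)
            ≡⟨ trans (∑-cong λ x → ∑-distrib-+ _ _) (∑-distrib-+ _ _) ⟩
          (∑[ x < n ] ∑[ x′ < n ] (good x x′ * codegree F x x′)) + ∑[ x < n ] ∑[ x′ < n ] (h x * h x′ * c₁)
            ≡⟨ cong₂ _+_ (sym R≡) (trans (trans (∑-cong λ x → sym (∑-*ʳ _ c₁)) (sym (∑-*ʳ _ c₁))) (cong (_* c₁) (∑-product h h))) ⟩
          R + P * P * c₁ ∎
          where
          open ≤-Reasoning
          vanish : ∀ x x′ → h x * h x′ ≡ 0 → codegree F x x′ ≡ 0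
          vanish x x′ e = trans (∑-cong λ y → trans (lem (h x) (f x₀ y * f x y) (h x′) (f x₀ y * f x′ y))
                            (cong (_* (f x₀ y * f x y * (f x₀ y * f x′ y))) e)) (∑-0 n)
            where
            lem : ∀ a b c d → a * b * (c * d) ≡ a * c * (b * d)
            lem = solve-∀
          bound : ∀ x x′ → codegree F x x′ ≤ good x x′ * codegree F x x′ + h x * h x′ * c₁
          bound x x′ with ≤1⇒0∨1 (*-mono-≤ (h≤1 x) (h≤1 x′))
          ... | inj₁ e = ≤-trans (≤-reflexive (vanish x x′ e)) z≤n
          ... | inj₂ e = ≤-trans (cod≤good x x′) (≤-reflexive (cong (good x x′ * codegree F x x′ +_)
                           (sym (trans (cong (_* c₁) e) (*-identityˡ c₁)))))

        d>0 : 0 < d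
        d>0 = ≤-trans (*-mono-< {0} {2 * (ρ * ρ)} {0} {c₁} (*-mono-< {0} {2} {0} {ρ * ρ} (s≤s z≤n) (*-mono-< ρ>0 ρ>0)) c₁>0) c₁-lo

        -- The number P = 16βρ + 1 of selected vertices is chosen for this.
        4g₀d<size : 4 * (g₀ * d) < size
        4g₀d<size = *-cancelʳ-< ρ _ _ (begin-strict
          4 * (g₀ * d) * ρ ≡⟨ lem β d ρ ⟩
          16 * β * ρ * d <⟨ *-monoˡ-< d {{>-nonZero d>0}} (≤-refl {suc (16 * β * ρ)}) ⟩
          suc (16 * β * ρ) * d ≡⟨ cong (_* d) (sym P≡) ⟩
          P * d ≤⟨ Pd≤sizeρ ⟩
          size * ρ ∎)
          where
          open ≤-Reasoning
          lem : ∀ b d r → 4 * (4 * b * d) * r ≡ 16 * b * r * d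
          lem = solve-∀

        size>0 : 0 < size
        size>0 = ≤-trans (s≤s z≤n) 4g₀d<size

        -- The mean codegree in `F` is at least d/ρ², and c₁ is at most half of that; so the pairs
        -- cut off carry at most half of the sum `S`.
        2c₁P²d≤size² : 2 * (d * (P * P * c₁)) ≤ size * size
        2c₁P²d≤size² = *-cancelʳ-≤ _ _ (ρ * ρ) {{>-nonZero (*-mono-< ρ>0 ρ>0)}} (begin
          2 * (d * (P * P * c₁)) * (ρ * ρ) ≡⟨ l₁ d P c₁ ρ ⟩
          P * P * d * (2 * (ρ * ρ) * c₁) ≤⟨ *-monoʳ-≤ (P * P * d) c₁-lo ⟩
          P * P * d * d ≡⟨ l₂ P d ⟩
          P * d * (P * d) ≤⟨ *-mono-≤ Pd≤sizeρ Pd≤sizeρ ⟩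
          size * ρ * (size * ρ) ≡⟨ l₃ size ρ ⟩
          size * size * (ρ * ρ) ∎)
          where
          open ≤-Reasoning
          l₁ : ∀ d P c r → 2 * (d * (P * P * c)) * (r * r) ≡ P * P * d * (2 * (r * r) * c)
          l₁ = solve-∀
          l₂ : ∀ P d → P * P * d * d ≡ P * d * (P * d)
          l₂ = solve-∀
          l₃ : ∀ s r → s * r * (s * r) ≡ s * s * (r * r)
          l₃ = solve-∀

        -- At least half of `S` lies on good pairs, so dR ≥ size²/2, whereas size exceeds 4 g₀ d.
        rich : size * g₀ < R
        rich = *-cancelˡ-< d _ _ (+-cancelʳ-< (d * (P * P * c₁)) _ _ (*-cancelˡ-< 2 _ _ (begin-strict
          2 * (d * (size * g₀) + d * (P * P * c₁)) ≡⟨ *-distribˡ-+ 2 (d * (size * g₀)) _ ⟩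
          2 * (d * (size * g₀)) + 2 * (d * (P * P * c₁)) <⟨ +-mono-<-≤ A<size² 2c₁P²d≤size² ⟩
          size * size + size * size ≤⟨ +-mono-≤ size²≤dS size²≤dS ⟩
          d * S + d * S ≤⟨ +-mono-≤ (*-monoʳ-≤ d S≤) (*-monoʳ-≤ d S≤) ⟩
          d * (R + P * P * c₁) + d * (R + P * P * c₁) ≡⟨ l₂ d R (P * P * c₁) ⟩
          2 * (d * R + d * (P * P * c₁)) ∎)))
          where
          open ≤-Reasoning
          l₁ : ∀ d s g → 2 * (d * (s * g)) + 2 * (g * d) * s ≡ 4 * (g * d) * s
          l₁ = solve-∀
          l₂ : ∀ d r p → d * (r + p) + d * (r + p) ≡ 2 * (d * r + d * p)
          l₂ = solve-∀
          A<size² : 2 * (d * (size * g₀)) < size * size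
          A<size² = begin-strict
            2 * (d * (size * g₀)) ≤⟨ m≤m+n _ _ ⟩
            2 * (d * (size * g₀)) + 2 * (g₀ * d) * size ≡⟨ l₁ d size g₀ ⟩
            4 * (g₀ * d) * size <⟨ *-monoˡ-< size {{>-nonZero size>0}} 4g₀d<size ⟩
            size * size ∎

      -- Here size is at most P d, with P ≤ 17βρ and d at most 2ρ²(c₁ + 1) ≤ 4ρ²c₁. Then β and c₁
      -- cancel, and 68 is 17 · 4.
      heavy-inequality : β ^ suc k ≤ κ k ^ suc k * (68 * (ρ * ρ * ρ))
      heavy-inequality = *-cancelʳ-≤ _ _ (g₀ * c₁) {{>-nonZero (*-mono-< (≤-trans β>0 (m≤m+n β _)) c₁>0)}} (begin
        β ^ suc k * (g₀ * c₁)
          ≤⟨ bipartite-inequality g₀ β ≤-refl 4β≤c₁ rich ⟩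
        κ k ^ suc k * (4 * size) ≤⟨ *-monoʳ-≤ (κ k ^ suc k) (*-monoʳ-≤ 4 (≤-trans size≤Pd (*-mono-≤ P≤ (<⇒≤ c₁-hi)))) ⟩
        κ k ^ suc k * (4 * (17 * (β * ρ) * (2 * (ρ * ρ) * suc c₁)))
          ≤⟨ *-monoʳ-≤ (κ k ^ suc k) (*-monoʳ-≤ 4 (*-monoʳ-≤ (17 * (β * ρ)) (*-monoʳ-≤ (2 * (ρ * ρ)) suc≤))) ⟩
        κ k ^ suc k * (4 * (17 * (β * ρ) * (2 * (ρ * ρ) * (c₁ + c₁)))) ≡⟨ l₁ (κ k ^ suc k) β ρ c₁ ⟩
        κ k ^ suc k * (68 * (ρ * ρ * ρ)) * (g₀ * c₁) ∎)
        where
        open ≤-Reasoning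
        suc≤ : suc c₁ ≤ c₁ + c₁
        suc≤ = +-monoˡ-≤ c₁ c₁>0
        l₁ : ∀ x b r c → x * (4 * (17 * (b * r) * (2 * (r * r) * (c + c)))) ≡ x * (68 * (r * r * r)) * (4 * b * c)
        l₁ = solve-∀
        l₂ : ∀ b r → b * r + 16 * b * r ≡ 17 * (b * r)
        l₂ = solve-∀
        P≤ : P ≤ 17 * (β * ρ)
        P≤ = ≤-trans (≤-reflexive P≡) (≤-trans (+-monoˡ-≤ (16 * β * ρ) (*-mono-< β>0 ρ>0)) (≤-reflexive (l₂ β ρ)))

-- The values c x ≈ d/4^i contribute at most C 8^i (d/4^i)², and these bounds form a convergent geometric
-- series; the term 16 C d² in levels strengthens the induction.
∑-heavy-levels : ∀ {n} (c : Fin n → ℕ) (d C : ℕ) (c≤d : ∀ x → c x ≤ d) → ∀ I →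
  (∀ i → i ≤ I → ∑[ x < n ] indicator (d ≤? c x * (2 ^ i * 2 ^ i)) ≤ C * (2 ^ i * 2 ^ i * 2 ^ i)) →
  (∑[ x < n ] (indicator (d ≤? c x * (2 ^ I * 2 ^ I)) * (c x * c x))) ≤ 17 * C * (d * d)
∑-heavy-levels {n} c d C c≤d I count = *-cancelˡ-≤ (2 ^ I) {{m^n≢0 2 I}} (≤-trans (m≤m+n _ _) (levels I count))
  where
  open ≤-Reasoning
  ind : ℕ → Fin n → ℕ
  ind a x = indicator (d ≤? c x * (a * a))
  Φ : ℕ → ℕ
  Φ a = ∑[ x < n ] (ind a x * (c x * c x))
  -- An x counted for 2a but not for a has c x < d/a². There are at most 8Ca³ of them, so `Φ` grows
  -- by at most 8Cd²/a.
  step : ∀ a → 0 < a → ∑ n (ind (2 * a)) ≤ C * (2 * a * (2 * a) * (2 * a)) → a * Φ (2 * a) ≤ a * Φ a + 8 * C * (d * d)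
  step a a>0 cnt = *-cancelˡ-≤ (a * a * a) {{>-nonZero (*-mono-< (*-mono-< a>0 a>0) a>0)}} (begin
    a * a * a * (a * Φ (2 * a)) ≡⟨ trans (sym (*-assoc (a * a * a) a _)) (∑-*ˡ (a * a * a * a) _) ⟩
    ∑[ x < n ] (a * a * a * a * (ind (2 * a) x * (c x * c x))) ≤⟨ ∑-mono pointwise ⟩
    ∑[ x < n ] (a * a * a * a * (ind a x * (c x * c x)) + ind (2 * a) x * (d * d))
      ≡⟨ trans (∑-distrib-+ _ _) (cong₂ _+_ (sym (∑-*ˡ (a * a * a * a) _)) (sym (∑-*ʳ (ind (2 * a)) (d * d)))) ⟩
    a * a * a * a * Φ a + ∑ n (ind (2 * a)) * (d * d) ≤⟨ +-monoʳ-≤ (a * a * a * a * Φ a) (*-monoˡ-≤ (d * d) cnt) ⟩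
    a * a * a * a * Φ a + C * (2 * a * (2 * a) * (2 * a)) * (d * d) ≡⟨ l₁ a (Φ a) C (d * d) ⟩
    a * a * a * (a * Φ a + 8 * C * (d * d)) ∎)
    where
    l₁ : ∀ a p C e → a * a * a * a * p + C * (2 * a * (2 * a) * (2 * a)) * e ≡ a * a * a * (a * p + 8 * C * e)
    l₁ = solve-∀
    l₂ : ∀ a y → a * a * a * a * (1 * (y * y)) ≡ y * (a * a) * (y * (a * a))
    l₂ = solve-∀
    pointwise : ∀ x → a * a * a * a * (ind (2 * a) x * (c x * c x)) ≤ a * a * a * a * (ind a x * (c x * c x)) + ind (2 * a) x * (d * d)
    pointwise x with d ≤? c x * (a * a) | d ≤? c x * (2 * a * (2 * a))
    ... | yes _  | z      = ≤-trans (*-monoʳ-≤ (a * a * a * a) (*-monoˡ-≤ (c x * c x) (indicator≤1 z))) (m≤m+n _ _)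
    ... | no  _  | no  _  = ≤-trans (≤-reflexive (*-zeroʳ (a * a * a * a))) z≤n
    ... | no  lt | yes _  = begin
      a * a * a * a * (1 * (c x * c x)) ≡⟨ l₂ a (c x) ⟩
      c x * (a * a) * (c x * (a * a)) ≤⟨ *-mono-≤ (<⇒≤ (≰⇒> lt)) (<⇒≤ (≰⇒> lt)) ⟩
      d * d ≤⟨ m≤n+m _ _ ⟩
      a * a * a * a * 0 + d * d ≡⟨ cong (a * a * a * a * 0 +_) (sym (*-identityˡ (d * d))) ⟩
      a * a * a * a * 0 + 1 * (d * d) ∎
  levels : ∀ I → (∀ i → i ≤ I → ∑ n (ind (2 ^ i)) ≤ C * (2 ^ i * 2 ^ i * 2 ^ i)) →
           2 ^ I * Φ (2 ^ I) + 16 * C * (d * d) ≤ 2 ^ I * (17 * C * (d * d))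
  levels zero    count = begin
    1 * Φ 1 + 16 * C * (d * d) ≤⟨ +-monoˡ-≤ (16 * C * (d * d)) (*-monoʳ-≤ 1 (∑-mono λ x → *-monoʳ-≤ (ind 1 x) (*-mono-≤ (c≤d x) (c≤d x)))) ⟩
    1 * (∑[ x < n ] (ind 1 x * (d * d))) + 16 * C * (d * d) ≡⟨ cong (λ y → 1 * y + 16 * C * (d * d)) (sym (∑-*ʳ (ind 1) (d * d))) ⟩
    1 * (∑ n (ind 1) * (d * d)) + 16 * C * (d * d) ≤⟨ +-monoˡ-≤ (16 * C * (d * d)) (*-monoʳ-≤ 1 (*-monoˡ-≤ (d * d) (count 0 z≤n))) ⟩
    1 * (C * 1 * (d * d)) + 16 * C * (d * d) ≡⟨ lem C (d * d) ⟩
    1 * (17 * C * (d * d)) ∎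
    where
    lem : ∀ C e → 1 * (C * 1 * e) + 16 * C * e ≡ 1 * (17 * C * e)
    lem = solve-∀
  levels (suc I) count = begin
    2 * a * Φ (2 * a) + 16 * C * (d * d) ≡⟨ l₁ a (Φ (2 * a)) C (d * d) ⟩
    2 * (a * Φ (2 * a) + 8 * C * (d * d)) ≤⟨ *-monoʳ-≤ 2 (+-monoˡ-≤ (8 * C * (d * d)) (step a (m^n>0 2 I) (count (suc I) ≤-refl))) ⟩
    2 * (a * Φ a + 8 * C * (d * d) + 8 * C * (d * d)) ≡⟨ l₂ (a * Φ a) C (d * d) ⟩
    2 * (a * Φ a + 16 * C * (d * d)) ≤⟨ *-monoʳ-≤ 2 (levels I λ i le → count i (m≤n⇒m≤1+n le)) ⟩
    2 * (a * (17 * C * (d * d))) ≡⟨ sym (*-assoc 2 a _) ⟩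
    2 * a * (17 * C * (d * d)) ∎
    where
    a = 2 ^ I
    l₁ : ∀ a p C e → 2 * a * p + 16 * C * e ≡ 2 * (a * p + 8 * C * e)
    l₁ = solve-∀
    l₂ : ∀ p C e → 2 * (p + 8 * C * e + 8 * C * e) ≡ 2 * (p + 16 * C * e)
    l₂ = solve-∀

-- The factor 16 · 69 · κ is the coefficient of r³ in `heavy-count`; 17 comes from the dyadic
-- summation.
C₁ : ℕ → ℕ
C₁ k = 17 * (16 * 69 * κ k)

module Heavy {n : ℕ} (G : Graph n) (k : ℕ) (5≤k : 5 ≤ k) where

  open Host G k

  module _ (free : Free G (Glued (suc (suc k)))) (prism? : ∀ u → Dec (PrismAt u))
           (f : Fin n → Fin n → ℕ) (f≤1 : ∀ x y → f x y ≤ 1) (f⇒Adj : ∀ x y → f x y ≢ 0 → Adj x y) where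

    private
      -- For β = 69κr and ρ = r² the walk inequality would give 69^(k+1) r^(k+1) ≤ 68 r⁶. But k + 1
      -- = ℓ - 1 is at least 6, as ℓ ≥ 7.
      too-big : ∀ κ r → 0 < κ → 0 < r → ¬ ((69 * (κ * r)) ^ suc k ≤ κ ^ suc k * (68 * (r * r * (r * r) * (r * r))))
      too-big κ r κ>0 r>0 le = <⇒≱ (*-monoʳ-< (κ ^ suc k) {{>-nonZero κk>0}} (*-monoˡ-< r⁶ {{>-nonZero r⁶>0}} (≤-refl {69}))) (begin
        κ ^ suc k * (69 * r⁶) ≤⟨ *-monoʳ-≤ (κ ^ suc k) (*-mono-≤ 69≤ r⁶≤) ⟩
        κ ^ suc k * (69 ^ suc k * r ^ suc k) ≡⟨ l₁ (κ ^ suc k) (69 ^ suc k) (r ^ suc k) ⟩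
        69 ^ suc k * (κ ^ suc k * r ^ suc k) ≡⟨ cong (69 ^ suc k *_) (sym (^-distribʳ-* (suc k) κ r)) ⟩
        69 ^ suc k * (κ * r) ^ suc k ≡⟨ sym (^-distribʳ-* (suc k) 69 (κ * r)) ⟩
        (69 * (κ * r)) ^ suc k ≤⟨ le ⟩
        κ ^ suc k * (68 * r⁶) ∎)
        where
        open ≤-Reasoning
        r⁶ = r * r * (r * r) * (r * r)
        r⁶>0 : 0 < r⁶
        r⁶>0 = *-mono-< (*-mono-< (*-mono-< r>0 r>0) (*-mono-< r>0 r>0)) (*-mono-< r>0 r>0)
        κk>0 : 0 < κ ^ suc k
        κk>0 = m^n>0 κ {{>-nonZero κ>0}} (suc k)
        69≤ : 69 ≤ 69 ^ suc k
        69≤ = ≤-trans (≤-reflexive (sym (*-identityʳ 69))) (*-monoʳ-≤ 69 (m^n>0 69 k))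
        l₀ : ∀ r → r * r * (r * r) * (r * r) ≡ r * (r * (r * (r * (r * (r * 1)))))
        l₀ = solve-∀
        r⁶≤ : r⁶ ≤ r ^ suc k
        r⁶≤ = ≤-trans (≤-reflexive (l₀ r)) (^-monoʳ-≤ r {{>-nonZero r>0}} (s≤s 5≤k))
        l₁ : ∀ a b c → a * (b * c) ≡ b * (a * c)
        l₁ = solve-∀

    -- If there were more, 16βρ + 1 of them could be selected for `heavy-inequality`. The lower
    -- bound on the degree ensures that the quotient c₁ of d by 2r⁴ is at least 4β.
    heavy-count : ∀ x₀ r → 0 < r → 2 * (r * r * (r * r)) * (4 * (69 * (κ k * r))) ≤ degree f x₀ →
      ∑[ x < n ] indicator (degree f x₀ ≤? codegree f x x₀ * (r * r)) ≤ 16 * (69 * (κ k * r)) * (r * r)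
    heavy-count x₀ r r>0 big = ≮⇒≥ λ many → contra many
      where
      d = degree f x₀
      β = 69 * (κ k * r)
      β>0 : 0 < β
      β>0 = *-mono-< {0} {69} {0} {κ k * r} (s≤s z≤n) (*-mono-< (κ>0 k) r>0)
      ρ>0 : 0 < r * r
      ρ>0 = *-mono-< r>0 r>0
      contra : 16 * β * (r * r) < ∑[ x < n ] indicator (d ≤? codegree f x x₀ * (r * r)) → ⊥
      contra many with divide d (2 * (r * r * (r * r))) (*-mono-< {0} {2} (s≤s z≤n) (*-mono-< ρ>0 ρ>0))
                     | select (λ x → indicator (d ≤? codegree f x x₀ * (r * r))) (suc (16 * β * (r * r))) many (λ x → indicator≤1 _)
      ... | c₁ , lo , hi | h , h≤ , ∑h = too-big (κ k) r (κ>0 k) r>0 (heavy-inequality G k free prism? f f≤1 f⇒Adj x₀ h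
              (λ x → ≤-trans (h≤ x) (indicator≤1 (d ≤? codegree f x x₀ * (r * r)))) (r * r) ρ>0 heavy β β>0 ∑h c₁
              (s≤s⁻¹ (*-cancelˡ-< (2 * (r * r * (r * r))) (4 * β) (suc c₁) (≤-<-trans big hi))) lo hi)
        where
        heavy : ∀ x → h x ≢ 0 → d ≤ codegree f x x₀ * (r * r)
        heavy x ne with d ≤? codegree f x x₀ * (r * r) | h≤ x
        ... | yes le | _  = le
        ... | no  _  | h0 = ⊥-elim (ne (n≤0⇒n≡0 h0))

    codegree≤degree : ∀ x x₀ → codegree f x x₀ ≤ degree f x₀
    codegree≤degree x x₀ = ∑-mono λ y → ≤-trans (*-monoˡ-≤ (f x₀ y) (f≤1 x y)) (≤-reflexive (*-identityˡ _))

    heavy-sum : ∀ x₀ I → degree f x₀ ≡ 0 ⊎ 552 * κ k * (2 ^ I * 2 ^ I * 2 ^ I * 2 ^ I * 2 ^ I) ≤ degree f x₀ →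
      (∑[ x < n ] (indicator (degree f x₀ ≤? codegree f x x₀ * (2 ^ I * 2 ^ I)) * (codegree f x x₀ * codegree f x x₀)))
        ≤ C₁ k * (degree f x₀ * degree f x₀)
    heavy-sum x₀ I (inj₁ d0) = ≤-trans (≤-reflexive (trans (∑-cong λ x →
        trans (cong (λ y → indicator (degree f x₀ ≤? codegree f x x₀ * (2 ^ I * 2 ^ I)) * (y * y))
                (n≤0⇒n≡0 (≤-trans (codegree≤degree x x₀) (≤-reflexive d0))))
              (*-zeroʳ (indicator (degree f x₀ ≤? codegree f x x₀ * (2 ^ I * 2 ^ I))))) (∑-0 n))) z≤n
    heavy-sum x₀ I (inj₂ big) = ∑-heavy-levels (λ x → codegree f x x₀) (degree f x₀) (16 * 69 * κ k)
        (λ x → codegree≤degree x x₀) I λ i i≤I →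
          ≤-trans (heavy-count x₀ (2 ^ i) (m^n>0 2 i) (≤-trans (≤-reflexive (l₁ (κ k) (2 ^ i))) (≤-trans (mono⁵ i i≤I) big)))
                  (≤-reflexive (l₂ (κ k) (2 ^ i)))
      where
      l₁ : ∀ κ r → 2 * (r * r * (r * r)) * (4 * (69 * (κ * r))) ≡ 552 * κ * (r * r * r * r * r)
      l₁ = solve-∀
      l₂ : ∀ κ r → 16 * (69 * (κ * r)) * (r * r) ≡ 16 * 69 * κ * (r * r * r)
      l₂ = solve-∀
      mono⁵ : ∀ i → i ≤ I → 552 * κ k * (2 ^ i * 2 ^ i * 2 ^ i * 2 ^ i * 2 ^ i) ≤ 552 * κ k * (2 ^ I * 2 ^ I * 2 ^ I * 2 ^ I * 2 ^ I)
      mono⁵ i i≤I = *-monoʳ-≤ (552 * κ k) (*-mono-≤ (*-mono-≤ (*-mono-≤ (*-mono-≤ p p) p) p) p)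
        where
        p : 2 ^ i ≤ 2 ^ I
        p = ^-monoʳ-≤ 2 i≤I

-- 4-cycles with two light diagonals

none-or-some : ∀ a b c d → 1 ≤ (1 ∸ a) * (1 ∸ b) * ((1 ∸ c) * (1 ∸ d)) + (a + b + (c + d))
none-or-some (suc a) b       c       d       = ≤-trans (s≤s z≤n) (m≤n+m _ _)
none-or-some zero    (suc b) c       d       = ≤-trans (s≤s z≤n) (m≤n+m _ _)
none-or-some zero    zero    (suc c) d       = ≤-trans (s≤s z≤n) (m≤n+m _ _)
none-or-some zero    zero    zero    (suc d) = ≤-trans (s≤s z≤n) (m≤n+m _ _)
none-or-some zero    zero    zero    zero    = s≤s z≤n

module Light {n : ℕ} (G : Graph n) (k : ℕ) (5≤k : 5 ≤ k) where

  open Host G k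
  open Heavy G k 5≤k

  module _ (free : Free G (Glued (suc (suc k)))) (prism? : ∀ u → Dec (PrismAt u))
           (f : Fin n → Fin n → ℕ) (f≤1 : ∀ x y → f x y ≤ 1) (f⇒Adj : ∀ x y → f x y ≢ 0 → Adj x y)
           (f-sym : ∀ x y → f x y ≡ f y x) (I : ℕ)
           (min-degree : ∀ x → degree f x ≡ 0 ⊎ 552 * κ k * (2 ^ I * 2 ^ I * 2 ^ I * 2 ^ I * 2 ^ I) ≤ degree f x) where

    private
      N = n * n
      d = degree f
      cod = codegree f
      τ = 2 ^ I * 2 ^ I
      S = ∑[ x < n ] (d x * d x)
      C4 = ∑[ x < n ] ∑[ x′ < n ] (cod x x′ * cod x x′)

      -- Not symmetric: the codegree is compared with the degree of the first argument. As `cod x x`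
      -- is `d x`, a diagonal with x = x′ is heavy, so degenerate 4-cycles are excluded as well.
      heavy : Fin n → Fin n → ℕ
      heavy x₀ x = indicator (d x₀ ≤? cod x x₀ * τ)

      light : Fin n → Fin n → ℕ
      light x x′ = (1 ∸ heavy x x′) * (1 ∸ heavy x′ x)

      light≤1 : ∀ x x′ → light x x′ ≤ 1
      light≤1 x x′ = *-mono-≤ (m∸n≤m 1 (heavy x x′)) (m∸n≤m 1 (heavy x′ x))

      light-cod : ∀ x a → τ * (cod x a * light x a) ≤ d x
      light-cod x a with d x ≤? cod a x * τ
      ... | yes _  = ≤-trans (≤-reflexive (trans (cong (τ *_) (*-zeroʳ (cod x a))) (*-zeroʳ τ))) z≤n
      ... | no  lt = begin
        τ * (cod x a * (1 * (1 ∸ heavy a x))) ≤⟨ *-monoʳ-≤ τ (*-monoʳ-≤ (cod x a) (≤-trans (≤-reflexive (*-identityˡ _)) (m∸n≤m 1 (heavy a x)))) ⟩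
        τ * (cod x a * 1) ≡⟨ lem τ (cod x a) ⟩
        cod x a * τ ≡⟨ cong (_* τ) (codegree-sym f x a) ⟩
        cod a x * τ ≤⟨ <⇒≤ (≰⇒> lt) ⟩
        d x ∎
        where
        open ≤-Reasoning
        lem : ∀ t c → t * (c * 1) ≡ c * t
        lem = solve-∀

      Q W : Fin n → Fin n → Fin n → Fin n → ℕ
      Q x y x′ y′ = f x y * f x′ y * (f x y′ * f x′ y′)
      W x y x′ y′ = Q x y x′ y′ * (light x x′ * light y y′)

      w : State → State → ℕ
      w u v = W (X u) (Y u) (X v) (Y v)

      w-sym : ∀ u v → w u v ≡ w v u
      w-sym u v = lem (f (X u) (Y u)) (f (X v) (Y u)) (f (X u) (Y v)) (f (X v) (Y v))
                      (1 ∸ heavy (X u) (X v)) (1 ∸ heavy (X v) (X u)) (1 ∸ heavy (Y u) (Y v)) (1 ∸ heavy (Y v) (Y u))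
        where
        lem : ∀ a b c d p q r s → a * b * (c * d) * (p * q * (r * s)) ≡ d * c * (b * a) * (q * p * (s * r))
        lem = solve-∀

      w-step : ∀ u v → w u v ≢ 0 → Step u v
      w-step u v ne = f⇒Adj _ _ (a*b≢0⇒a≢0 (f (X u) (Y u)) (f (X v) (Y u)) ab)
                    , f⇒Adj _ _ (a*b≢0⇒a≢0 (f (X u) (Y v)) (f (X v) (Y v)) cd)
                    , f⇒Adj _ _ (a*b≢0⇒b≢0 (f (X u) (Y u)) (f (X v) (Y u)) ab)
        where
        q : Q (X u) (Y u) (X v) (Y v) ≢ 0
        q = a*b≢0⇒a≢0 (Q (X u) (Y u) (X v) (Y v)) _ ne
        ab : f (X u) (Y u) * f (X v) (Y u) ≢ 0
        ab = a*b≢0⇒a≢0 _ (f (X u) (Y v) * f (X v) (Y v)) q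
        cd : f (X u) (Y v) * f (X v) (Y v) ≢ 0
        cd = a*b≢0⇒b≢0 (f (X u) (Y u) * f (X v) (Y u)) _ q

      Q-swap : ∀ x y x′ y′ → Q x y x′ y′ ≡ Q y x y′ x′
      Q-swap x y x′ y′ = trans (lem (f x y) (f x′ y) (f x y′) (f x′ y′))
        (cong₂ _*_ (cong₂ _*_ (f-sym x y) (f-sym x y′)) (cong₂ _*_ (f-sym x′ y) (f-sym x′ y′)))
        where
        lem : ∀ a b c d → a * b * (c * d) ≡ a * c * (b * d)
        lem = solve-∀

      ∑Q : ∀ (A : Fin n → Fin n → ℕ) →
        (∑[ x < n ] ∑[ y < n ] ∑[ x′ < n ] ∑[ y′ < n ] (Q x y x′ y′ * A x x′))
          ≡ ∑[ x < n ] ∑[ x′ < n ] (A x x′ * (cod x x′ * cod x x′))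
      ∑Q A = ∑-cong λ x → trans (∑-comm _) (∑-cong λ x′ → trans (∑∑-cong λ y y′ → lem (f x y * f x′ y) (f x y′ * f x′ y′) (A x x′))
        (trans (∑-cong λ y → sym (∑-*ˡ (A x x′) _)) (trans (sym (∑-*ˡ (A x x′) _))
          (cong (A x x′ *_) (∑-product (λ y → f x y * f x′ y) (λ y → f x y * f x′ y))))))
        where
        lem : ∀ a b c → a * b * c ≡ c * (a * b)
        lem = solve-∀

      ∑Q-swap : ∀ (A : Fin n → Fin n → ℕ) →
        (∑[ x < n ] ∑[ y < n ] ∑[ x′ < n ] ∑[ y′ < n ] (Q x y x′ y′ * A y y′))
          ≡ ∑[ x < n ] ∑[ x′ < n ] (A x x′ * (cod x x′ * cod x x′))
      ∑Q-swap A = trans (∑-comm _) (trans (∑∑-cong λ y x → trans (∑-comm _) (∑∑-cong λ y′ x′ → cong (_* A y y′) (Q-swap x y x′ y′))) (∑Q A))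

      heavy-total : (∑[ x < n ] ∑[ x′ < n ] (heavy x x′ * (cod x x′ * cod x x′))) ≤ C₁ k * S
      heavy-total = begin
        ∑[ x < n ] ∑[ x′ < n ] (heavy x x′ * (cod x x′ * cod x x′))
          ≡⟨ ∑∑-cong (λ x x′ → cong (λ c → heavy x x′ * (c * c)) (codegree-sym f x x′)) ⟩
        ∑[ x < n ] ∑[ x′ < n ] (heavy x x′ * (cod x′ x * cod x′ x))
          ≤⟨ ∑-mono (λ x → heavy-sum free prism? f f≤1 f⇒Adj x I (min-degree x)) ⟩
        ∑[ x < n ] (C₁ k * (d x * d x)) ≡⟨ sym (∑-*ˡ (C₁ k) _) ⟩
        C₁ k * S ∎
        where open ≤-Reasoning

      heavy-totalᵀ : (∑[ x < n ] ∑[ x′ < n ] (heavy x′ x * (cod x x′ * cod x x′))) ≤ C₁ k * S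
      heavy-totalᵀ = ≤-trans (≤-reflexive (trans (∑-comm _) (∑∑-cong λ x x′ →
        cong (λ c → heavy x x′ * (c * c)) (codegree-sym f x′ x)))) heavy-total

      ∑W = ∑[ x < n ] ∑[ y < n ] ∑[ x′ < n ] ∑[ y′ < n ] W x y x′ y′

      ∑₄-+ : ∀ (A B : Fin n → Fin n → Fin n → Fin n → ℕ) →
        (∑[ x < n ] ∑[ y < n ] ∑[ x′ < n ] ∑[ y′ < n ] (A x y x′ y′ + B x y x′ y′))
          ≡ (∑[ x < n ] ∑[ y < n ] ∑[ x′ < n ] ∑[ y′ < n ] A x y x′ y′) + ∑[ x < n ] ∑[ y < n ] ∑[ x′ < n ] ∑[ y′ < n ] B x y x′ y′
      ∑₄-+ A B = add (∑-isSum ⊗ (∑-isSum ⊗ (∑-isSum ⊗ ∑-isSum))) (λ { (x , y , x′ , y′) → A x y x′ y′ }) (λ { (x , y , x′ , y′) → B x y x′ y′ })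

      C4≤ : C4 ≤ ∑W + 4 * (C₁ k * S)
      C4≤ = begin
        C4 ≡⟨ ∑∑-cong (λ x x′ → sym (*-identityˡ _)) ⟩
        ∑[ x < n ] ∑[ x′ < n ] (1 * (cod x x′ * cod x x′)) ≡⟨ sym (∑Q (λ _ _ → 1)) ⟩
        ∑[ x < n ] ∑[ y < n ] ∑[ x′ < n ] ∑[ y′ < n ] (Q x y x′ y′ * 1)
          ≤⟨ ∑∑-mono (λ x y → ∑∑-mono λ x′ y′ → ≤-trans
               (*-monoʳ-≤ (Q x y x′ y′) (none-or-some (heavy x x′) (heavy x′ x) (heavy y y′) (heavy y′ y)))
               (≤-reflexive (lem (Q x y x′ y′) (light x x′ * light y y′) (heavy x x′) (heavy x′ x) (heavy y y′) (heavy y′ y)))) ⟩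
        ∑[ x < n ] ∑[ y < n ] ∑[ x′ < n ] ∑[ y′ < n ]
          (W x y x′ y′ + ((Q x y x′ y′ * heavy x x′ + Q x y x′ y′ * heavy x′ x) + (Q x y x′ y′ * heavy y y′ + Q x y x′ y′ * heavy y′ y)))
          ≡⟨ trans (∑₄-+ W _) (cong (∑W +_) (trans (∑₄-+ _ _) (cong₂ _+_ (∑₄-+ _ _) (∑₄-+ _ _)))) ⟩
        ∑W + ((A₁ + A₂) + (A₃ + A₄))
          ≤⟨ +-monoʳ-≤ ∑W (+-mono-≤ (+-mono-≤ (≤-trans (≤-reflexive (∑Q heavy)) heavy-total)
                                               (≤-trans (≤-reflexive (∑Q (λ x x′ → heavy x′ x))) heavy-totalᵀ))
                                     (+-mono-≤ (≤-trans (≤-reflexive (∑Q-swap heavy)) heavy-total)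
                                               (≤-trans (≤-reflexive (∑Q-swap (λ y y′ → heavy y′ y))) heavy-totalᵀ))) ⟩
        ∑W + ((C₁ k * S + C₁ k * S) + (C₁ k * S + C₁ k * S)) ≡⟨ cong (∑W +_) (l₂ (C₁ k * S)) ⟩
        ∑W + 4 * (C₁ k * S) ∎
        where
        open ≤-Reasoning
        A₁ = ∑[ x < n ] ∑[ y < n ] ∑[ x′ < n ] ∑[ y′ < n ] (Q x y x′ y′ * heavy x x′)
        A₂ = ∑[ x < n ] ∑[ y < n ] ∑[ x′ < n ] ∑[ y′ < n ] (Q x y x′ y′ * heavy x′ x)
        A₃ = ∑[ x < n ] ∑[ y < n ] ∑[ x′ < n ] ∑[ y′ < n ] (Q x y x′ y′ * heavy y y′)
        A₄ = ∑[ x < n ] ∑[ y < n ] ∑[ x′ < n ] ∑[ y′ < n ] (Q x y x′ y′ * heavy y′ y)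
        lem : ∀ q l a b c d → q * (l + (a + b + (c + d))) ≡ q * l + ((q * a + q * b) + (q * c + q * d))
        lem = solve-∀
        l₂ : ∀ x → (x + x) + (x + x) ≡ 4 * x
        l₂ = solve-∀

      -- If the diagonal from x to a is light, the steps with x′ = a have at most d x / τ choices of
      -- y′; likewise those with y′ = a have at most d y / τ choices of x′.
      Θ : Fin n → Fin n → ℕ
      Θ x y = f x y * (d x + d y)

      θ : State → ℕ
      θ u = Θ (X u) (Y u)

      ∑θ : ∑ N θ ≡ 2 * S
      ∑θ = begin
        ∑ N θ ≡⟨ ∑-pairs n n Θ ⟩
        ∑[ x < n ] ∑[ y < n ] (f x y * (d x + d y)) ≡⟨ ∑-cong (λ x → trans (∑-cong λ y → *-distribˡ-+ (f x y) _ _) (∑-distrib-+ _ _)) ⟩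
        ∑[ x < n ] ((∑[ y < n ] (f x y * d x)) + ∑[ y < n ] (f x y * d y)) ≡⟨ ∑-distrib-+ _ _ ⟩
        (∑[ x < n ] ∑[ y < n ] (f x y * d x)) + (∑[ x < n ] ∑[ y < n ] (f x y * d y))
          ≡⟨ cong₂ _+_ half (trans (∑-comm _) (trans (∑∑-cong λ y x → cong (_* d y) (f-sym x y)) half)) ⟩
        S + S ≡⟨ cong (S +_) (sym (+-identityʳ S)) ⟩
        2 * S ∎
        where
        open ≡-Reasoning
        half : (∑[ x < n ] ∑[ y < n ] (f x y * d x)) ≡ S
        half = ∑-cong λ x → sym (∑-*ʳ (f x) (d x))

      ∑∑w : (∑[ u < N ] ∑[ v < N ] w u v) ≡ ∑W
      ∑∑w = trans (∑-cong λ u → ∑-pairs n n (W (X u) (Y u))) (∑-pairs n n (λ x y → ∑[ x′ < n ] ∑[ y′ < n ] W x y x′ y′))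

      spread : ∀ x y a → τ * ∑[ x′ < n ] ∑[ y′ < n ] (W x y x′ y′ * (δ a x′ + δ a y′)) ≤ Θ x y
      spread x y a = begin
        τ * ∑[ x′ < n ] ∑[ y′ < n ] (W x y x′ y′ * (δ a x′ + δ a y′))
          ≡⟨ cong (τ *_) (trans (∑-cong λ x′ → trans (∑-cong λ y′ → *-distribˡ-+ (W x y x′ y′) _ _) (∑-distrib-+ _ _)) (∑-distrib-+ _ _)) ⟩
        τ * ((∑[ x′ < n ] ∑[ y′ < n ] (W x y x′ y′ * δ a x′)) + ∑[ x′ < n ] ∑[ y′ < n ] (W x y x′ y′ * δ a y′))
          ≡⟨ cong (τ *_) (cong₂ _+_
               (trans (∑-cong λ x′ → sym (∑-*ʳ _ (δ a x′))) (trans (∑-cong λ x′ → cong (∑ n (W x y x′) *_) (δ-sym a x′)) (∑-δʳ a (λ x′ → ∑ n (W x y x′)))))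
               (∑-cong λ x′ → trans (∑-cong λ y′ → cong (W x y x′ y′ *_) (δ-sym a y′)) (∑-δʳ a (W x y x′)))) ⟩
        τ * ((∑[ y′ < n ] W x y a y′) + ∑[ x′ < n ] W x y x′ a) ≡⟨ *-distribˡ-+ τ _ _ ⟩
        τ * (∑[ y′ < n ] W x y a y′) + τ * (∑[ x′ < n ] W x y x′ a) ≤⟨ +-mono-≤ first second ⟩
        f x y * d x + f x y * d y ≡⟨ sym (*-distribˡ-+ (f x y) (d x) (d y)) ⟩
        Θ x y ∎
        where
        open ≤-Reasoning
        l₁ : ∀ p q r l m → p * q * r * (l * m) ≡ q * (m * (p * l * r))
        l₁ = solve-∀
        l₂ : ∀ t p l c → t * (p * l * c) ≡ p * (t * (c * l))
        l₂ = solve-∀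
        l₃ : ∀ p q r s l m → p * q * (r * s) * (l * m) ≡ r * (l * (p * m * (q * s)))
        l₃ = solve-∀
        drop : ∀ {a b} c → a ≤ 1 → b ≤ 1 → a * (b * c) ≤ c
        drop c a≤1 b≤1 = ≤-trans (*-mono-≤ a≤1 (*-monoˡ-≤ c b≤1)) (≤-reflexive (trans (*-identityˡ _) (*-identityˡ c)))
        first : τ * (∑[ y′ < n ] W x y a y′) ≤ f x y * d x
        first = begin
          τ * (∑[ y′ < n ] W x y a y′)
            ≤⟨ *-monoʳ-≤ τ (∑-mono λ y′ → ≤-trans (≤-reflexive (l₁ (f x y) (f a y) (f x y′ * f a y′) (light x a) (light y y′)))
                 (drop (f x y * light x a * (f x y′ * f a y′)) (f≤1 a y) (light≤1 y y′))) ⟩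
          τ * (∑[ y′ < n ] (f x y * light x a * (f x y′ * f a y′))) ≡⟨ cong (τ *_) (sym (∑-*ˡ (f x y * light x a) _)) ⟩
          τ * (f x y * light x a * cod x a) ≡⟨ l₂ τ (f x y) (light x a) (cod x a) ⟩
          f x y * (τ * (cod x a * light x a)) ≤⟨ *-monoʳ-≤ (f x y) (light-cod x a) ⟩
          f x y * d x ∎
        second : τ * (∑[ x′ < n ] W x y x′ a) ≤ f x y * d y
        second = begin
          τ * (∑[ x′ < n ] W x y x′ a)
            ≤⟨ *-monoʳ-≤ τ (∑-mono λ x′ → ≤-trans (≤-reflexive (l₃ (f x y) (f x′ y) (f x a) (f x′ a) (light x x′) (light y a)))
                 (drop (f x y * light y a * (f x′ y * f x′ a)) (f≤1 x a) (light≤1 x x′))) ⟩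
          τ * (∑[ x′ < n ] (f x y * light y a * (f x′ y * f x′ a)))
            ≡⟨ cong (τ *_) (trans (sym (∑-*ˡ (f x y * light y a) _)) (cong (f x y * light y a *_) (∑-cong λ x′ → cong₂ _*_ (f-sym x′ y) (f-sym x′ a)))) ⟩
          τ * (f x y * light y a * cod y a) ≡⟨ l₂ τ (f x y) (light y a) (cod y a) ⟩
          f x y * (τ * (cod y a * light y a)) ≤⟨ *-monoʳ-≤ (f x y) (light-cod y a) ⟩
          f x y * d y ∎

      W≤1 : ∀ x y x′ y′ → 1 * W x y x′ y′ ≤ 1
      W≤1 x y x′ y′ = ≤-trans (≤-reflexive (*-identityˡ _)) (*-mono-≤ (*-mono-≤ (*-mono-≤ (f≤1 x y) (f≤1 x′ y)) (*-mono-≤ (f≤1 x y′) (f≤1 x′ y′)))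
                                                                      (*-mono-≤ (light≤1 x x′) (light≤1 y y′)))

      -- Each of the d x edges at x has m at most M / d x, so every x contributes at most M.
      mass : ∀ M m → (∀ u → m u * θ u ≤ M) → (∀ u → (∀ v → w u v ≡ 0) → m u ≡ 0) → 1 * (1 * ∑ N m) ≤ n * M
      mass M m mθ≤M isolated = begin
        1 * (1 * ∑ N m) ≡⟨ trans (*-identityˡ _) (*-identityˡ _) ⟩
        ∑ N m ≡⟨ ∑-combine n n m ⟩
        ∑[ x < n ] ∑[ y < n ] m (combine x y) ≤⟨ ∑-mono row ⟩
        ∑[ x < n ] M ≡⟨ ∑-const n M ⟩
        n * M ∎
        where
        open ≤-Reasoning
        X-combine : ∀ x y → X (combine x y) ≡ x
        X-combine x y = cong proj₁ (remQuot-combine {n} {n} x y)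
        Y-combine : ∀ x y → Y (combine x y) ≡ y
        Y-combine x y = cong proj₂ (remQuot-combine {n} {n} x y)
        nonedge : ∀ x y → f x y ≡ 0 → m (combine x y) ≡ 0
        nonedge x y e = isolated (combine x y) λ v →
          let u = combine x y in
          cong (λ a → a * f (X v) (Y u) * (f (X u) (Y v) * f (X v) (Y v)) * (light (X u) (X v) * light (Y u) (Y v)))
               (trans (cong₂ f (X-combine x y) (Y-combine x y)) e)
        bound : ∀ x y → d x * m (combine x y) ≤ f x y * M
        bound x y with ≤1⇒0∨1 (f≤1 x y)
        ... | inj₁ f0 = ≤-trans (≤-reflexive (trans (cong (d x *_) (nonedge x y f0)) (*-zeroʳ (d x)))) z≤n
        ... | inj₂ f1 = begin
          d x * m (combine x y) ≤⟨ *-monoˡ-≤ (m (combine x y)) (m≤m+n (d x) (d y)) ⟩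
          (d x + d y) * m (combine x y) ≡⟨ trans (*-comm _ (m (combine x y))) (cong (m (combine x y) *_) (sym (trans (cong (_* (d x + d y)) f1) (*-identityˡ _)))) ⟩
          m (combine x y) * Θ x y ≡⟨ cong (m (combine x y) *_) (cong₂ Θ (sym (X-combine x y)) (sym (Y-combine x y))) ⟩
          m (combine x y) * θ (combine x y) ≤⟨ mθ≤M (combine x y) ⟩
          M ≡⟨ sym (trans (cong (_* M) f1) (*-identityˡ M)) ⟩
          f x y * M ∎
        row : ∀ x → (∑[ y < n ] m (combine x y)) ≤ M
        row x with d x Data.Nat.≟ 0
        ... | yes d0 = ≤-trans (≤-reflexive (trans (∑-cong λ y → nonedge x y (∑≡0⇒≡0 (f x) d0 y)) (∑-0 n))) z≤n
        ... | no  ne = *-cancelˡ-≤ (d x) {{≢-nonZero ne}} (begin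
          d x * ∑[ y < n ] m (combine x y) ≡⟨ ∑-*ˡ (d x) _ ⟩
          ∑[ y < n ] (d x * m (combine x y)) ≤⟨ ∑-mono (bound x) ⟩
          ∑[ y < n ] (f x y * M) ≡⟨ sym (∑-*ʳ (f x) M) ⟩
          d x * M ∎)

    -- At most 4 `C₁ k` S of the quadruples counted by `C4` have a heavy diagonal, which leaves more
    -- than 4S = 2 ∑ θ, as pruning requires.
    light-inequality : 4 * S + 4 * (C₁ k * S) < C4 → (2 ^ I * 2 ^ I) ^ suc k * (1 * 1) ≤ κ k ^ suc k * n
    light-inequality many = spread-inequality free prism? w w-sym w-step θ
      (subst₂ _<_ (trans (lem S) (cong (2 *_) (sym ∑θ))) (sym ∑∑w) (+-cancelʳ-< (4 * (C₁ k * S)) _ _ (≤-trans many C4≤)))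
      τ (λ u a → ≤-trans (≤-reflexive (cong (τ *_) (∑-pairs n n (λ x′ y′ → W (X u) (Y u) x′ y′ * (δ a x′ + δ a y′))))) (spread (X u) (Y u) a))
      1 1 (λ u v → W≤1 (X u) (Y u) (X v) (Y v)) 1 n mass
      where
      lem : ∀ s → 4 * s ≡ 2 * (2 * s)
      lem = solve-∀

-- Counting edges

sum-tabulate : ∀ {n} (f : Fin n → ℕ) → sumᴸ (tabulate f) ≡ ∑ n f
sum-tabulate {zero}  f = sym (∑-zero f)
sum-tabulate {suc n} f = trans (cong (f zero +_) (sum-tabulate (f ∘ suc))) (sym (∑-suc f))

sum-allFin : ∀ {n} (f : Fin n → ℕ) → sumᴸ (map f (allFin n)) ≡ ∑ n f
sum-allFin f = trans (cong sumᴸ (map-tabulate (λ i → i) f)) (sum-tabulate f)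

<ᵇ-asym : ∀ a b → (a <ᵇ b) ≡ true → (b <ᵇ a) ≡ false
<ᵇ-asym zero    (suc b) e = refl
<ᵇ-asym (suc a) (suc b) e = <ᵇ-asym a b e

adjacency : ∀ {n} → Graph n → Fin n → Fin n → ℕ
adjacency G x y = if adj G x y then 1 else 0

adjacency-sym : ∀ {n} (G : Graph n) x y → adjacency G x y ≡ adjacency G y x
adjacency-sym G x y = cong (if_then 1 else 0) (adj-sym G x y)

adjacency≤1 : ∀ {n} (G : Graph n) x y → adjacency G x y ≤ 1
adjacency≤1 G x y with adj G x y
... | true  = ≤-refl
... | false = z≤n

adjacency⇒adj : ∀ {n} (G : Graph n) x y → adjacency G x y ≢ 0 → adj G x y ≡ true
adjacency⇒adj G x y ne with adj G x y
... | true  = refl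
... | false = ⊥-elim (ne refl)

2*edges≤ : ∀ {n} (G : Graph n) → 2 * edges G ≤ ∑[ x < n ] ∑[ y < n ] adjacency G x y
2*edges≤ {n} G = begin
  2 * edges G ≡⟨ cong (2 *_) edges≡ ⟩
  2 * (∑[ x < n ] ∑[ y < n ] ordered x y) ≡⟨ cong ((∑[ x < n ] ∑[ y < n ] ordered x y) +_) (trans (+-identityʳ _) (∑-comm _)) ⟩
  (∑[ x < n ] ∑[ y < n ] ordered x y) + ∑[ x < n ] ∑[ y < n ] ordered y x
    ≡⟨ sym (trans (∑-cong λ x → ∑-distrib-+ _ _) (∑-distrib-+ _ _)) ⟩
  ∑[ x < n ] ∑[ y < n ] (ordered x y + ordered y x) ≤⟨ ∑∑-mono bound ⟩
  ∑[ x < n ] ∑[ y < n ] adjacency G x y ∎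
  where
  open ≤-Reasoning
  ordered : Fin n → Fin n → ℕ
  ordered x y = if (toℕ x <ᵇ toℕ y) ∧ adj G x y then 1 else 0
  edges≡ : edges G ≡ ∑[ x < n ] ∑[ y < n ] ordered x y
  edges≡ = trans (sum-allFin (λ x → sumᴸ (map (ordered x) (allFin n)))) (∑-cong λ x → sum-allFin (ordered x))
  bound : ∀ x y → ordered x y + ordered y x ≤ adjacency G x y
  bound x y with toℕ x <ᵇ toℕ y in x<y | toℕ y <ᵇ toℕ x in y<x
  ... | false | false = z≤n
  ... | false | true  = ≤-reflexive (adjacency-sym G y x)
  ... | true  | false = ≤-reflexive (+-identityʳ _)
  ... | true  | true  with trans (sym y<x) (<ᵇ-asym (toℕ x) (toℕ y) x<y)
  ...   | ()

-- A single instance of excluded middle is irrefutable; by induction so are finitely many at once.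
¬¬-dec : ∀ {N} {P : Fin N → Set} → ¬ ¬ (∀ u → Dec (P u))
¬¬-dec {zero}  h = h λ ()
¬¬-dec {suc N} {P} h = ¬¬dec λ d → ¬¬-dec {N} {P ∘ suc} λ rest → h (cons d rest)
  where
  ¬¬dec : ¬ ¬ Dec (P zero)
  ¬¬dec g = g (no λ p → g (yes p))
  cons : Dec (P zero) → (∀ u → Dec (P (suc u))) → ∀ u → Dec (P u)
  cons d rest zero    = d
  cons d rest (suc u) = rest u

-- Roots and powers up to a constant factor

√-approx : ∀ x → ∃[ s ] (x ≤ s * s × s * s ≤ 4 * x)
√-approx zero = 0 , z≤n , z≤n
√-approx (suc x) with √-approx x
... | s , lo , hi with suc x ≤? s * s
...   | yes le = s , le , ≤-trans hi (*-monoʳ-≤ 4 (n≤1+n x))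
...   | no  gt = suc s , suc≤ , ≤-trans (≤-reflexive (lem s)) (≤-trans (s≤s (+-mono-≤ s²≤x (+-mono-≤ s≤x s≤x))) (≤-trans (s≤s (m≤m+n _ (x + 3))) (≤-reflexive (lem₂ x))))
  where
  s²≤x : s * s ≤ x
  s²≤x = s≤s⁻¹ (≰⇒> gt)
  s≤x : s ≤ x
  s≤x = ≤-trans (m≤m*m s) s²≤x
    where
    m≤m*m : ∀ m → m ≤ m * m
    m≤m*m zero    = z≤n
    m≤m*m (suc m) = m≤m*n (suc m) (suc m)
  lem : ∀ s → suc s * suc s ≡ suc (s * s + (s + s))
  lem = solve-∀
  lem₂ : ∀ x → suc (x + (x + x) + (x + 3)) ≡ 4 * suc x
  lem₂ = solve-∀
  suc≤ : suc x ≤ suc s * suc s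
  suc≤ = ≤-trans (s≤s lo) (≤-trans (s≤s (m≤m+n (s * s) (s + s))) (≤-reflexive (sym (lem s))))

power-approx : ∀ B → 2 ≤ B → ∀ n → ∃[ J ] (suc n ≤ B ^ J × B ^ J ≤ B * suc n)
power-approx B 2≤B zero    = 0 , ≤-refl , ≤-trans (≤-trans (s≤s z≤n) 2≤B) (≤-reflexive (sym (*-identityʳ B)))
power-approx B 2≤B (suc n) with power-approx B 2≤B n
... | J , lo , hi with suc (suc n) ≤? B ^ J
...   | yes le = J , le , ≤-trans hi (*-monoʳ-≤ B (n≤1+n (suc n)))
...   | no  gt = suc J , grow , *-monoʳ-≤ B (<⇒≤ (≰⇒> gt))
  where
  grow : suc (suc n) ≤ B ^ suc J
  grow = ≤-trans (s≤s lo) (≤-trans (+-monoˡ-≤ (B ^ J) (≤-trans (s≤s z≤n) lo)) (≤-trans (≤-reflexive (cong (B ^ J +_) (sym (+-identityʳ (B ^ J))))) (*-monoˡ-≤ (B ^ J) 2≤B)))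

n<2^n : ∀ n → n < 2 ^ n
n<2^n zero    = s≤s z≤n
n<2^n (suc n) = ≤-trans (+-mono-≤ (m^n>0 2 n) (n<2^n n)) (≤-reflexive (cong (2 ^ n +_) (sym (+-identityʳ (2 ^ n)))))

square-≤ : ∀ a b → a * a ≤ b * b → a ≤ b
square-≤ a b le = ≮⇒≥ λ lt → <⇒≱ (*-mono-< lt lt) le

square-< : ∀ a b → a * a < b * b → a < b
square-< a b lt = ≰⇒> λ le → <⇒≱ lt (*-mono-≤ le le)

-- Subgraphs of large minimum degree

module Dense (k : ℕ) (5≤k : 5 ≤ k) where

  opaque
    -- As B^J = (2^J)^12, taking B^J of order n makes 2^J of order n^(1/12), and τ of order n^(1/6).
    -- `E` is the constant of the degree condition in `heavy-sum` for 2^I = 2^κ 2^J. In `density`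
    -- the first summand secures that condition, the second the supply of 4-cycles.
    B E density : ℕ
    B = 2 ^ 12
    E = 552 * κ k * (2 ^ κ k * 2 ^ κ k * 2 ^ κ k * 2 ^ κ k * 2 ^ κ k)
    density = E * E * B + (5 + 4 * C₁ k)

    2≤B : 2 ≤ B
    2≤B = s≤s (s≤s z≤n)

    B^J≡ : ∀ J → B ^ J ≡ (2 ^ J) ^ 12
    B^J≡ J = trans (^-*-assoc 2 12 J) (trans (cong (2 ^_) (*-comm 12 J)) (sym (^-*-assoc 2 J 12)))

    E-def : E ≡ 552 * κ k * (2 ^ κ k * 2 ^ κ k * 2 ^ κ k * 2 ^ κ k * 2 ^ κ k)
    E-def = refl

    E²B≤density : E * E * B ≤ density
    E²B≤density = m≤m+n (E * E * B) (5 + 4 * C₁ k)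

    5+4C₁≤density : 5 + 4 * C₁ k ≤ density
    5+4C₁≤density = m≤n+m (5 + 4 * C₁ k) (E * E * B)

  module _ {n : ℕ} (G : Graph (suc n)) (free : Free G (Glued (suc (suc k)))) (δ₀ : ℕ)
           (δ₀²≥ : density * suc n ≤ δ₀ * δ₀) (dense : suc n * δ₀ < edges G) where

    private
      n′ = suc n

      open Host G k using (PrismAt)

      J = proj₁ (power-approx B 2≤B n)
      n≤B^J = proj₁ (proj₂ (power-approx B 2≤B n))
      B^J≤ = proj₂ (proj₂ (power-approx B 2≤B n))

      -- In τ = 4^I the factor 4^κ outweighs κ, and 4^J takes care of the number of vertices.
      I = κ k + J

      pruned = prune (adjacency G) (adjacency-sym G) (λ _ → δ₀) (begin-strict
        2 * (∑[ x < n′ ] δ₀) ≡⟨ cong (2 *_) (∑-const n′ δ₀) ⟩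
        2 * (n′ * δ₀) <⟨ *-monoʳ-< 2 dense ⟩
        2 * edges G ≤⟨ 2*edges≤ G ⟩
        ∑[ x < n′ ] ∑[ y < n′ ] adjacency G x y ∎)
        where open ≤-Reasoning

      χ = proj₁ pruned
      χ≤1 = proj₁ (proj₂ pruned)
      δ₀≤deg = proj₁ (proj₂ (proj₂ pruned))

      f : Fin n′ → Fin n′ → ℕ
      f x y = χ x * (χ y * adjacency G x y)

      f≤1 : ∀ x y → f x y ≤ 1
      f≤1 x y = *-mono-≤ (χ≤1 x) (*-mono-≤ (χ≤1 y) (adjacency≤1 G x y))

      f⇒Adj : ∀ x y → f x y ≢ 0 → adj G x y ≡ true
      f⇒Adj x y ne = adjacency⇒adj G x y (a*b≢0⇒b≢0 (χ y) _ (a*b≢0⇒b≢0 (χ x) _ ne))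

      f-sym : ∀ x y → f x y ≡ f y x
      f-sym x y = trans (cong (λ a → χ x * (χ y * a)) (adjacency-sym G x y)) (lem (χ x) (χ y) (adjacency G y x))
        where
        lem : ∀ a b c → a * (b * c) ≡ b * (a * c)
        lem = solve-∀

      d = degree f
      S = ∑[ x < n′ ] (d x * d x)
      C4 = ∑[ x < n′ ] ∑[ x′ < n′ ] (codegree f x x′ * codegree f x x′)
      U = ∑ n′ χ

      U≤n : U ≤ n′
      U≤n = ≤-trans (∑-mono χ≤1) (≤-reflexive (trans (∑-const n′ 1) (*-identityʳ n′)))

      d≡ : ∀ x → d x ≡ χ x * ∑[ y < n′ ] (χ y * adjacency G x y)
      d≡ x = sym (∑-*ˡ (χ x) _)

      χδ₀≤d : ∀ x → χ x * δ₀ ≤ d x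
      χδ₀≤d x with ≤1⇒0∨1 (χ≤1 x)
      ... | inj₁ e = ≤-trans (≤-reflexive (cong (_* δ₀) e)) z≤n
      ... | inj₂ e = ≤-trans (*-monoʳ-≤ (χ x) (δ₀≤deg x e)) (≤-reflexive (sym (d≡ x)))

      d-dichotomy : ∀ x → d x ≡ 0 ⊎ δ₀ ≤ d x
      d-dichotomy x with ≤1⇒0∨1 (χ≤1 x)
      ... | inj₁ e = inj₁ (trans (d≡ x) (cong (_* (∑[ y < n′ ] (χ y * adjacency G x y))) e))
      ... | inj₂ e = inj₂ (≤-trans (≤-reflexive (sym (trans (cong (_* δ₀) e) (*-identityˡ δ₀)))) (χδ₀≤d x))

      -- Squaring turns the fifth power of 2^J into the tenth, which is at most (2^J)^12 = B^J ≤ B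
      -- n; so degrees of order √n suffice.
      δ₀-large : 552 * κ k * (2 ^ I * 2 ^ I * 2 ^ I * 2 ^ I * 2 ^ I) ≤ δ₀
      δ₀-large = square-≤ _ δ₀ (begin
        e * e ≡⟨ cong (λ x → x * x) (trans (cong (λ x → 552 * κ k * (x * x * x * x * x)) (^-distribˡ-+-* 2 (κ k) J))
                                           (trans (l₁ (552 * κ k) (2 ^ κ k) j) (cong (_* (j * j * j * j * j)) (sym E-def)))) ⟩
        E * (j * j * j * j * j) * (E * (j * j * j * j * j)) ≡⟨ l₂ E j ⟩
        E * E * (j * j * j * j * j * (j * j * j * j * j))
          ≤⟨ *-monoʳ-≤ (E * E) (m≤m*n _ (j * j) {{>-nonZero (*-mono-< j>0 j>0)}}) ⟩
        E * E * (j * j * j * j * j * (j * j * j * j * j) * (j * j)) ≡⟨ cong (E * E *_) (trans (l₃ j) (sym (B^J≡ J))) ⟩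
        E * E * B ^ J ≤⟨ *-monoʳ-≤ (E * E) B^J≤ ⟩
        E * E * (B * n′) ≡⟨ sym (*-assoc (E * E) B n′) ⟩
        E * E * B * n′ ≤⟨ *-monoˡ-≤ n′ E²B≤density ⟩
        density * n′ ≤⟨ δ₀²≥ ⟩
        δ₀ * δ₀ ∎)
        where
        open ≤-Reasoning
        e = 552 * κ k * (2 ^ I * 2 ^ I * 2 ^ I * 2 ^ I * 2 ^ I)
        j = 2 ^ J
        j>0 : 0 < j
        j>0 = m^n>0 2 J
        l₁ : ∀ c a j → c * (a * j * (a * j) * (a * j) * (a * j) * (a * j)) ≡ c * (a * a * a * a * a) * (j * j * j * j * j)
        l₁ = solve-∀
        l₂ : ∀ s t → s * (t * t * t * t * t) * (s * (t * t * t * t * t)) ≡ s * s * (t * t * t * t * t * (t * t * t * t * t))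
        l₂ = solve-∀
        l₃ : ∀ j → j * j * j * j * j * (j * j * j * j * j) * (j * j)
                 ≡ j * (j * (j * (j * (j * (j * (j * (j * (j * (j * (j * (j * 1)))))))))))
        l₃ = solve-∀

      -- Counting paths with two edges by their ends shows that S is the sum of all codegrees. These
      -- vanish unless both ends survive pruning, so convexity runs over U² pairs only.
      S²≤U²C4 : S * S ≤ U * U * C4
      S²≤U²C4 = begin
        S * S ≡⟨ cong (λ x → x * x) S≡ ⟩
        (∑[ x < n′ ] ∑[ x′ < n′ ] (χ x * χ x′ * (1 * codegree f x x′))) * (∑[ x < n′ ] ∑[ x′ < n′ ] (χ x * χ x′ * (1 * codegree f x x′)))
          ≤⟨ cauchySchwarz (∑-isSum ⊗ ∑-isSum) (λ { (x , x′) → χ x * χ x′ }) (λ _ → 1) (λ { (x , x′) → codegree f x x′ }) ⟩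
        (∑[ x < n′ ] ∑[ x′ < n′ ] (χ x * χ x′ * 1)) * (∑[ x < n′ ] ∑[ x′ < n′ ] (χ x * χ x′ * (codegree f x x′ * codegree f x x′)))
          ≤⟨ *-mono-≤ (≤-reflexive (trans (∑∑-cong λ x x′ → *-identityʳ _) (∑-product χ χ)))
               (∑∑-mono λ x x′ → ≤-trans (*-monoˡ-≤ (codegree f x x′ * codegree f x x′) (*-mono-≤ (χ≤1 x) (χ≤1 x′))) (≤-reflexive (*-identityˡ _))) ⟩
        U * U * C4 ∎
        where
        open ≤-Reasoning
        absorb : ∀ x x′ → codegree f x x′ ≡ χ x * χ x′ * (1 * codegree f x x′)
        absorb x x′ = trans (∑-cong λ y → trans (cong₂ _*_ (idem x y) (idem x′ y)) (l₂ (χ x) (f x y) (χ x′) (f x′ y)))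
                            (trans (sym (∑-*ˡ (χ x * χ x′) _)) (cong (χ x * χ x′ *_) (sym (*-identityˡ _))))
          where
          l₂ : ∀ a b c e → a * b * (c * e) ≡ a * c * (b * e)
          l₂ = solve-∀
          idem : ∀ x y → f x y ≡ χ x * f x y
          idem x y = trans (cong (_* (χ y * adjacency G x y)) (sym (square≡id (χ≤1 x)))) (*-assoc (χ x) (χ x) _)
        S≡ : S ≡ ∑[ x < n′ ] ∑[ x′ < n′ ] (χ x * χ x′ * (1 * codegree f x x′))
        S≡ = trans (∑-cong λ y → trans (sym (∑-product (f y) (f y))) (∑∑-cong λ x x′ → cong₂ _*_ (f-sym y x) (f-sym y x′)))
               (trans (∑-comm _) (trans (∑-cong λ x → ∑-comm _) (∑∑-cong absorb)))

      Uδ₀²≤S : U * (δ₀ * δ₀) ≤ S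
      Uδ₀²≤S = ≤-trans (≤-reflexive (∑-*ʳ χ (δ₀ * δ₀))) (∑-mono λ x →
        ≤-trans (≤-reflexive (trans (cong (_* (δ₀ * δ₀)) (sym (square≡id (χ≤1 x)))) (lem (χ x) δ₀))) (*-mono-≤ (χδ₀≤d x) (χδ₀≤d x)))
        where
        lem : ∀ a b → a * a * (b * b) ≡ a * b * (a * b)
        lem = solve-∀

      S>0 : 0 < S
      S>0 with ∑>0⇒∃ d (≤-trans (proj₂ (proj₂ (proj₂ pruned))) (≤-reflexive (∑-cong λ x → sym (d≡ x))))
      ... | x , dx>0 = ≤-trans (*-mono-< dx>0 dx>0) (∑-≤-term (λ x → d x * d x) x)

      U>0 : 0 < U
      U>0 = ≰⇒> λ U≤0 → <⇒≱ (*-mono-< S>0 S>0) (≤-trans S²≤U²C4 (≤-reflexive (cong (λ u → u * u * C4) (n≤0⇒n≡0 U≤0))))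

      -- `C4` is at least S²/U² ≥ S δ₀²/U, and U is at most the number of vertices.
      densityS≤C4 : density * S ≤ C4
      densityS≤C4 = *-cancelˡ-≤ (U * U) {{>-nonZero (*-mono-< U>0 U>0)}} (begin
        U * U * (density * S) ≡⟨ l₁ U density S ⟩
        U * (density * U) * S ≤⟨ *-monoˡ-≤ S (*-monoʳ-≤ U (≤-trans (*-monoʳ-≤ density U≤n) δ₀²≥)) ⟩
        U * (δ₀ * δ₀) * S ≤⟨ *-monoˡ-≤ S Uδ₀²≤S ⟩
        S * S ≤⟨ S²≤U²C4 ⟩
        U * U * C4 ∎)
        where
        open ≤-Reasoning
        l₁ : ∀ u q s → u * u * (q * s) ≡ u * (q * u) * s
        l₁ = solve-∀

      many : 4 * S + 4 * (C₁ k * S) < C4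
      many = begin-strict
        4 * S + 4 * (C₁ k * S) <⟨ +-monoˡ-≤ (4 * S + 4 * (C₁ k * S)) S>0 ⟩
        S + (4 * S + 4 * (C₁ k * S)) ≡⟨ l₁ S (C₁ k) ⟩
        (5 + 4 * C₁ k) * S ≤⟨ *-monoˡ-≤ S 5+4C₁≤density ⟩
        density * S ≤⟨ densityS≤C4 ⟩
        C4 ∎
        where
        open ≤-Reasoning
        l₁ : ∀ s c → s + (4 * s + 4 * (c * s)) ≡ (5 + 4 * c) * s
        l₁ = solve-∀

      -- Since k + 1 ≥ 6, the power (4^J)^(k+1) is at least (2^J)^12 = B^J, which is at least the
      -- number of vertices.
      τ-large : κ k ^ suc k * n′ < (2 ^ I * 2 ^ I) ^ suc k * (1 * 1)
      τ-large = begin-strict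
        κ k ^ suc k * n′ <⟨ *-monoˡ-< n′ (^-monoˡ-< (suc k) κ<a) ⟩
        (a * a) ^ suc k * n′ ≤⟨ *-monoʳ-≤ ((a * a) ^ suc k) n≤ ⟩
        (a * a) ^ suc k * (j * j) ^ suc k ≡⟨ sym (^-distribʳ-* (suc k) (a * a) (j * j)) ⟩
        (a * a * (j * j)) ^ suc k ≡⟨ cong (_^ suc k) (trans (l₁ a j) (cong (λ x → x * x) (sym (^-distribˡ-+-* 2 (κ k) J)))) ⟩
        (2 ^ I * 2 ^ I) ^ suc k ≡⟨ sym (*-identityʳ _) ⟩
        (2 ^ I * 2 ^ I) ^ suc k * (1 * 1) ∎
        where
        open ≤-Reasoning
        a = 2 ^ κ k
        j = 2 ^ J
        l₁ : ∀ a j → a * a * (j * j) ≡ a * j * (a * j)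
        l₁ = solve-∀
        κ<a : κ k < a * a
        κ<a = ≤-trans (n<2^n (κ k)) (m≤m*n a a {{m^n≢0 2 (κ k)}})
        n≤ : n′ ≤ (j * j) ^ suc k
        n≤ = begin
          n′ ≤⟨ n≤B^J ⟩
          B ^ J ≡⟨ B^J≡ J ⟩
          j ^ 12 ≡⟨ sym (^-*-assoc j 2 6) ⟩
          (j ^ 2) ^ 6 ≡⟨ cong (λ x → (j * x) ^ 6) (*-identityʳ j) ⟩
          (j * j) ^ 6 ≤⟨ ^-monoʳ-≤ (j * j) {{>-nonZero (*-mono-< (m^n>0 2 J) (m^n>0 2 J))}} (s≤s 5≤k) ⟩
          (j * j) ^ suc k ∎

      refute : ¬ (∀ u → Dec (PrismAt u))
      refute prism? = <⇒≱ τ-large (Light.light-inequality G k 5≤k free prism? f f≤1 f⇒Adj f-sym I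
        (λ x → map₂ (≤-trans δ₀-large) (d-dichotomy x)) many)

    -- Whether an edge lies in a prism may be decided classically, the goal being ⊥.
    impossible : ⊥
    impossible = ¬¬-dec refute

  -- As δ₀ serves an integer s with s² between density · n and four times that; more than 2 √density
  -- n^(3/2) edges would exceed n s.
  edge-bound : ∀ n (G : Graph n) → Free G (Glued (suc (suc k))) → edges G * edges G ≤ 4 * density * n ^ 3
  edge-bound zero    G free = z≤n
  edge-bound (suc n) G free = ≮⇒≥ dense
    where
    open ≤-Reasoning
    l₁ : ∀ n q → n * n * (4 * (q * n)) ≡ 4 * q * (n * (n * (n * 1)))
    l₁ = solve-∀
    l₂ : ∀ n s → n * s * (n * s) ≡ n * n * (s * s)
    l₂ = solve-∀
    dense : ¬ (4 * density * suc n ^ 3 < edges G * edges G)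
    dense lt with √-approx (density * suc n)
    ... | s , lo , hi = impossible G free s lo (square-< _ _ (begin-strict
      suc n * s * (suc n * s) ≡⟨ l₂ (suc n) s ⟩
      suc n * suc n * (s * s) ≤⟨ *-monoʳ-≤ (suc n * suc n) hi ⟩
      suc n * suc n * (4 * (density * suc n)) ≡⟨ l₁ (suc n) density ⟩
      4 * density * suc n ^ 3 <⟨ lt ⟩
      edges G * edges G ∎))

-- Comparison of the two patterns and conclusion

Glued⇒GluedMinus : ∀ ℓ {n} (G : Graph n) → Contains G (Glued ℓ) → Contains G (GluedMinus ℓ)
Glued⇒GluedMinus ℓ G (f , inj , hom) = f , inj , λ u v e → hom u v (proj₁ e)

theorem3p1 : ∀ (ℓ : ℕ) → 7 ≤ ℓ →
    (∀ (n m : ℕ) → ExLe n (Glued ℓ) m → ExLe n (GluedMinus ℓ) m)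
    × (∃[ C ] ∃[ N ] ∀ (n : ℕ) → N ≤ n → ∀ (G : Graph n) → Free G (Glued ℓ) →
    edges G * edges G ≤ C * n ^ 3)
theorem3p1 (suc (suc k)) (s≤s (s≤s 5≤k)) =
    -- A graph without the smaller pattern has no copy of the larger one either, so every bound for
    -- the larger pattern applies to it.
    (λ n m le G free → le G (free ∘ Glued⇒GluedMinus (suc (suc k)) G))
  , 4 * Dense.density k 5≤k , 0 , λ n _ G free → Dense.edge-bound k 5≤k n G free
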